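{- There is a randomized algorithm for the 0-1 knapsack problem that runs in $\widetilde{O}(n^{3/2}p_{\max})$ time and outputs the optimal value $\mathrm{OPT}$ correctly with high probability.
   Context: In the 0-1 knapsack problem, the input is a capacity $W\in\mathbb{Z}^+$ and $n$ items $(w_1,p_1),\dots,(w_n,p_n)$ with weights $w_i\in\mathbb{Z}^+$ and profits $p_i\in\mathbb{Z}^+$. The goal is to compute $\mathrm{OPT}=\max\{\sum_{i\in S}p_i : S\subseteq\{1,\dots,n\},\ \sum_{i\in S}w_i\le W\}$. Here $p_{\max}=\max_i p_i$. The notation $\widetilde{O}(\cdot)$ hides polylogarithmic factors, and "with high probability" means with probability at least $1-1/\mathrm{poly}(n)$. -}

module Defs where

open import Data.Bool.Base using (Bool; true; false; if_then_else_)
open import Data.Fin.Subset using (Subset)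
open import Data.Integer.Base using (+_)
open import Data.List.Base using (List; []; _∷_; _++_; map; filter; length)
open import Data.List.Extrema.Nat using (max)
open import Data.Nat.Base
open import Data.Nat.GeneralisedArithmetic using (iterate)
open import Data.Nat.Logarithm using (⌊log₂_⌋)
open import Data.Nat.Properties using (_≟_; _≤?_; m^n≢0)
open import Data.Rational.Base as ℚ using (ℚ; 1ℚ)
open import Data.Vec.Base as Vec using (Vec; toList; zipWith)
open import Data.Vec.Relation.Unary.All using (All)
open import Level using (Level)
open import Relation.Binary.PropositionalEquality using (_≡_)
open import Relation.Nullary.Decidable using (does)
open import Relation.Unary using (Pred; Decidable)

------------------------------------------------------------------------
-- 0-1 knapsack

bitVectors : ∀ n → List (Vec Bool n)
bitVectors zero    = Vec.[] ∷ []
bitVectors (suc n) = map (false Vec.∷_) (bitVectors n) ++ map (true Vec.∷_) (bitVectors n)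

record Knapsack (n : ℕ) : Set where
  field
    capacity  : ℕ
    weights   : Vec ℕ n
    profits   : Vec ℕ n
    capacity⁺ : 0 < capacity
    weights⁺  : All (0 <_) weights
    profits⁺  : All (0 <_) profits

sumOver : ∀ {n} → Subset n → Vec ℕ n → ℕ
sumOver S xs = Vec.sum (zipWith (λ inS x → if inS then x else 0) S xs)

module _ {n : ℕ} (I : Knapsack n) where
  open Knapsack I

  Feasible : Subset n → Set
  Feasible S = sumOver S weights ≤ capacity

  feasible? : Decidable Feasible
  feasible? S = sumOver S weights ≤? capacity

  -- The empty set is feasible, so the base value 0 does not affect the maximum.
  OPT : ℕ
  OPT = max 0 (map (λ S → sumOver S profits) (filter feasible? (bitVectors n)))

  w-max : ℕ
  w-max = max 0 (toList weights)

  p-max : ℕ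
  p-max = max 0 (toList profits)

------------------------------------------------------------------------
-- Randomized word RAM
--
-- Programs are structured (if/while rather than jumps) and in three-address
-- form: every elementary instruction, every coin flip and every test of an
-- if or while takes one time step.

Reg : Set
Reg = ℕ

-- sub is truncated at 0, division by 0 yields 0, and lt yields 0 or 1.
data Op : Set where
  add sub mul div lt : Op

data Stmt : Set where
  const  : Reg → ℕ → Stmt
  arith  : Reg → Op → Reg → Reg → Stmt
  load   : (dest addr : Reg) → Stmt
  store  : (addr src : Reg) → Stmt
  flip   : Reg → Stmt
  ifnz   : Reg → (then else : List Stmt) → Stmt
  while  : Reg → (body : List Stmt) → Stmt

Program : Set
Program = List Stmt

Store : Set
Store = ℕ → ℕ

_[_↦_] : Store → ℕ → ℕ → Store
(s [ i ↦ v ]) j = if does (i ≟ j) then v else s j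

⟦_⟧ : Op → ℕ → ℕ → ℕ
⟦ add ⟧ x y       = x + y
⟦ sub ⟧ x y       = x ∸ y
⟦ mul ⟧ x y       = x * y
⟦ div ⟧ x zero    = 0
⟦ div ⟧ x (suc y) = x / suc y
⟦ lt  ⟧ x y       = if x <ᵇ y then 1 else 0

-- The control component lists the statements that remain to be executed.
record Config : Set where
  constructor config
  field
    control : List Stmt
    regs    : Store
    memory  : Store
    coins   : List Bool

open Config

Halted : Config → Set
Halted c = control c ≡ []

module WordRAM (wordLength : ℕ) where

  truncate : ℕ → ℕ
  truncate x = _%_ x (2 ^ wordLength) {{m^n≢0 2 wordLength}}

  step : Config → Config
  step (config [] r m ω) = config [] r m ω
  step (config (const x k ∷ p) r m ω) = config p (r [ x ↦ truncate k ]) m ω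
  step (config (arith x o y z ∷ p) r m ω) =
    config p (r [ x ↦ truncate (⟦ o ⟧ (r y) (r z)) ]) m ω
  step (config (load x a ∷ p) r m ω) = config p (r [ x ↦ m (r a) ]) m ω
  step (config (store a x ∷ p) r m ω) = config p r (m [ r a ↦ r x ]) ω
  step (config (flip x ∷ p) r m []) = config p (r [ x ↦ 0 ]) m []
  step (config (flip x ∷ p) r m (b ∷ ω)) =
    config p (r [ x ↦ truncate (if b then 1 else 0) ]) m ω
  step (config (ifnz x p₁ p₂ ∷ p) r m ω) with r x
  ... | zero  = config (p₂ ++ p) r m ω
  ... | suc _ = config (p₁ ++ p) r m ω
  step (config (while x q ∷ p) r m ω) with r x
  ... | zero  = config p r m ω
  ... | suc _ = config (q ++ while x q ∷ p) r m ω

  -- All words not listed in the input are initially 0.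
  inputMemory : List ℕ → Store
  inputMemory []       _       = 0
  inputMemory (x ∷ _)  zero    = truncate x
  inputMemory (_ ∷ xs) (suc i) = inputMemory xs i

  initial : Program → List ℕ → List Bool → Config
  initial p input ω = config p (λ _ → 0) (inputMemory input) ω

------------------------------------------------------------------------
-- Randomized algorithms for knapsack

-- An algorithm is a single program for all instances, together with the
-- constant factor hidden in "words of Θ(log) bits".
record Algorithm : Set where
  field
    program    : Program
    wordFactor : ℕ

module _ {n : ℕ} (I : Knapsack n) where
  open Knapsack I

  encode : List ℕ
  encode = n ∷ capacity ∷ toList weights ++ toList profits

  -- The number of bits needed to write down n and each number in the input.
  inputBits : ℕ
  inputBits = suc ⌊log₂ (n ⊔ capacity ⊔ w-max I ⊔ p-max I) ⌋

  -- The configuration after t steps with coin tape ω.  At most one coin is used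
  -- per step, so a tape of length t never runs out during these steps.
  run : ∀ {t} → Algorithm → Vec Bool t → Config
  run {t} A ω = iterate step (initial program encode (toList ω)) t
    where
    open Algorithm A
    open WordRAM (wordFactor * inputBits)

output : Config → ℕ
output c = regs c 0

HaltsWithin : ∀ {n} → Algorithm → Knapsack n → ℕ → Set
HaltsWithin A I t = ∀ (ω : Vec Bool t) → Halted (run I A ω)

-- Probability of an event over t independent fair coins.
Pr : ∀ {ℓ : Level} {t : ℕ} {P : Pred (Vec Bool t) ℓ} → Decidable P → ℚ
Pr {t = t} P? = ℚ._/_ (+ length (filter P? (bitVectors t))) (2 ^ t) {{m^n≢0 2 t}}

-- Pr[output = OPT] over the coin tapes of length t; if A halts within t steps
-- on every tape, this does not depend on t.
PrCorrect : ∀ {n} → Algorithm → Knapsack n → ℕ → ℚ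
PrCorrect A I t = Pr {t = t} (λ ω → output (run I A ω) ≟ OPT I)

1-1/_^_ : ∀ n → ℕ → .{{NonZero n}} → ℚ
1-1/ n ^ c = 1ℚ ℚ.- ℚ._/_ (+ 1) (n ^ c) {{m^n≢0 n c}}

-- t ≤ n^(3/2) · m, with both sides squared to stay within ℕ.
_≤_^3/2·_ : ℕ → ℕ → ℕ → Set
t ≤ n ^3/2· m = t ^ 2 ≤ n ^ 3 * m ^ 2

-- The successor keeps the factor positive when a = 1.
polylog : ℕ → ℕ → ℕ
polylog k a = suc ⌊log₂ a ⌋ ^ k

{-# OPTIONS --safe #-}
-- The idea (He and Xu). Give every item an independent random key in [0, 2^L), with
-- 2^L of order √n, and add the items to a dynamic program over profits in the order
-- of their keys. For a fixed set S of profit P, the items of S with key below b have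
-- profit close to b P / 2^L, so if P is known up to O(p-max) then each item only
-- needs to be relaxed in a window of Õ(√n p-max) cells. Closeness needs just second
-- moments: the keys are drawn bit by bit, the squared imbalances of the splits at one
-- level sum to at most n p-max² in expectation, and the deviation of a prefix is a
-- combination of one imbalance per level; by Markov a row of keys is good for S
-- with probability at least 1/2. With Θ(c log n) independent rows, some row is good
-- for each of the n + 1 truncations of an optimal solution to its first m items,
-- except with probability n^-c.
--
-- The optimum is approximated by bisection with the same program: if a guess G is at
-- most OPT, some truncation of an optimal solution has profit in [G - p-max, G], and
-- it is found; and since only feasible sets are found, no value exceeds OPT.

module Submission where

open import Defs
open import Data.Bool.Base using (Bool; true; false; if_then_else_; not; _∧_; T)
open import Data.Empty using (⊥)
open import Data.Integer.Base as ℤ using (ℤ; ∣_∣; 0ℤ) renaming (+_ to ℤ⁺)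
import Data.Integer.Properties as ℤₚ
import Data.Integer.Tactic.RingSolver as ℤSolver
open import Data.List.Base using (List; []; _∷_; _++_; map; filter; length; take; drop)
open import Data.List.Extrema.Nat using (max; argmax-sel; max≤v⁺; xs≤max)
open import Data.List.Membership.Propositional using (_∈_)
open import Data.List.Membership.Propositional.Properties using (∈-map⁺; ∈-map⁻; ∈-filter⁺; ∈-filter⁻; ∈-++⁺ˡ; ∈-++⁺ʳ)
import Data.List.Properties as Listₚ
import Data.List.Relation.Unary.All as All
open import Data.List.Relation.Unary.Any using (here)
open import Data.Nat.Base
open import Data.Nat.DivMod hiding (_div_; _mod_; _divMod_)
open import Data.Nat.GeneralisedArithmetic using (iterate)
open import Data.Nat.Logarithm using (⌊log₂_⌋; ⌊log₂⌋-mono-≤; ⌊log₂[2^n]⌋≡n; ⌊log₂[2*b]⌋≡1+⌊log₂b⌋)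
open import Data.Nat.Properties
open import Data.Nat.Tactic.RingSolver using (solve-∀)
open import Data.Product.Base using (∃-syntax; _×_; _,_; proj₁; proj₂)
open import Data.Rational.Base as ℚ using (ℚ)
import Data.Rational.Properties as ℚₚ
import Data.Rational.Unnormalised.Base as ℚᵘ
import Data.Rational.Unnormalised.Properties as ℚᵘₚ
open import Data.Sum.Base using (_⊎_; inj₁; inj₂)
open import Data.Unit.Base using (⊤; tt)
open import Data.Vec.Base as Vec using (Vec; toList)
import Data.Vec.Relation.Unary.All as VecAll
open import Function.Base using (_∘_; case_of_)
open import Relation.Binary.PropositionalEquality
open import Relation.Nullary.Decidable using (does; yes; no)
open import Relation.Nullary.Negation using (¬_; contradiction)
open import Relation.Unary using (Decidable)

-- Finite sums

-- Why 2^L is of order √n: items with equal keys form one bucket, so only the B = 2^L bucket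
-- boundaries need concentration, while inside a bucket the running profit may lie anywhere between
-- the two boundary values. That adds about G / B = O(√n p-max) cells for a guess G, the same order
-- as the deviation. It also makes it affordable to sweep all n items for each bucket instead of
-- sorting by key.
--
-- Controlling all boundaries at once would usually take exponential tails or a maximal inequality.
-- Here the splits of one level are controlled by a single nonnegative variable, the sum of their
-- squares: a bound on it bounds every split, and no union bound over boundaries is paid.
--
-- The guesses depend on the same random keys as the passes that answer them. So goodness has to be
-- stated for sets fixed before any coin is drawn; the truncations serve for every guess because
-- their profits rise in steps of at most p-max. Passes err only downwards, hence the bounds that
-- keep the run inside its memory and time hold on all tapes, and only the bounds that certify
-- optimality depend on good rows.

∑ : ℕ → (ℕ → ℕ) → ℕ
∑ zero    f = 0
∑ (suc n) f = ∑ n f + f n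

sel : Bool → ℕ → ℕ
sel b x = if b then x else 0

interchange : ∀ a b c d → (a + b) + (c + d) ≡ (a + c) + (b + d)
interchange = solve-∀

∑-cong : ∀ n {f g} → (∀ j → j < n → f j ≡ g j) → ∑ n f ≡ ∑ n g
∑-cong zero    eq = refl
∑-cong (suc n) eq = cong₂ _+_ (∑-cong n λ j j<n → eq j (m<n⇒m<1+n j<n)) (eq n ≤-refl)

∑-mono : ∀ n {f g} → (∀ j → j < n → f j ≤ g j) → ∑ n f ≤ ∑ n g
∑-mono zero    le = z≤n
∑-mono (suc n) le = +-mono-≤ (∑-mono n λ j j<n → le j (m<n⇒m<1+n j<n)) (le n ≤-refl)

∑-+ : ∀ n f g → ∑ n (λ j → f j + g j) ≡ ∑ n f + ∑ n g
∑-+ zero    f g = refl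
∑-+ (suc n) f g = trans (cong (_+ (f n + g n)) (∑-+ n f g)) (interchange (∑ n f) (∑ n g) (f n) (g n))

∑-*ˡ : ∀ n c f → ∑ n (λ j → c * f j) ≡ c * ∑ n f
∑-*ˡ zero    c f = sym (*-zeroʳ c)
∑-*ˡ (suc n) c f = trans (cong (_+ c * f n) (∑-*ˡ n c f)) (sym (*-distribˡ-+ c (∑ n f) (f n)))

∑-const : ∀ n c → ∑ n (λ _ → c) ≡ n * c
∑-const zero    c = refl
∑-const (suc n) c = trans (cong (_+ c) (∑-const n c)) (+-comm (n * c) c)

∑-zero : ∀ n → ∑ n (λ _ → 0) ≡ 0
∑-zero n = trans (∑-const n 0) (*-zeroʳ n)

∑-bound : ∀ n {f c} → (∀ j → j < n → f j ≤ c) → ∑ n f ≤ n * c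
∑-bound n {c = c} le = ≤-trans (∑-mono n le) (≤-reflexive (∑-const n c))

∑-front : ∀ n f → ∑ (suc n) f ≡ f 0 + ∑ n (f ∘ suc)
∑-front zero    f = +-comm 0 (f 0)
∑-front (suc n) f = trans (cong (_+ f (suc n)) (∑-front n f)) (+-assoc (f 0) _ _)

∑-monoˡ : ∀ f {m n} → m ≤ n → ∑ m f ≤ ∑ n f
∑-monoˡ f {n = zero}  z≤n = ≤-refl
∑-monoˡ f {n = suc n} m≤1+n with m≤n⇒m<n∨m≡n m≤1+n
... | inj₁ (s≤s m≤n) = ≤-trans (∑-monoˡ f m≤n) (m≤m+n _ _)
... | inj₂ refl      = ≤-refl

term≤∑ : ∀ n f {j} → j < n → f j ≤ ∑ n f
term≤∑ n f {j} j<n = ≤-trans (m≤n+m (f j) (∑ j f)) (∑-monoˡ f j<n)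

sel≤ : ∀ b x → sel b x ≤ x
sel≤ true  x = ≤-refl
sel≤ false x = z≤n

<ᵇ-true : ∀ {m n} → m < n → (m <ᵇ n) ≡ true
<ᵇ-true {m} {n} m<n with m <ᵇ n | <⇒<ᵇ m<n
... | true | _ = refl

<ᵇ-false : ∀ {m n} → n ≤ m → (m <ᵇ n) ≡ false
<ᵇ-false {m} {n} n≤m with m <ᵇ n | <ᵇ⇒< m n
... | true  | f = contradiction (f tt) (≤⇒≯ n≤m)
... | false | _ = refl

<ᵇ-true⁻¹ : ∀ {m n} → (m <ᵇ n) ≡ true → m < n
<ᵇ-true⁻¹ {m} {n} eq = <ᵇ⇒< m n (subst T (sym eq) tt)

<ᵇ-false⁻¹ : ∀ {m n} → (m <ᵇ n) ≡ false → n ≤ m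
<ᵇ-false⁻¹ {m} {n} eq = ≮⇒≥ λ m<n → case trans (sym eq) (<ᵇ-true m<n) of λ ()

≡ᵇ-true : ∀ {m n} → m ≡ n → (m ≡ᵇ n) ≡ true
≡ᵇ-true {m} {n} m≡n with m ≡ᵇ n | ≡⇒≡ᵇ m n m≡n
... | true | _ = refl

≡ᵇ-true⁻¹ : ∀ {m n} → (m ≡ᵇ n) ≡ true → m ≡ n
≡ᵇ-true⁻¹ {m} {n} eq = ≡ᵇ⇒≡ m n (subst T (sym eq) tt)

below : ℕ → (ℕ → ℕ) → (ℕ → ℕ) → ℕ → ℕ
below n k a b = ∑ n λ j → sel (k j <ᵇ b) (a j)

inside : (ℕ → ℕ) → (ℕ → ℕ) → ℕ → ℕ → ℕ
inside k a b i = ∑ i λ j → sel (k j ≡ᵇ b) (a j)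

sel-<ᵇ-suc : ∀ x b y → sel (x <ᵇ suc b) y ≡ sel (x <ᵇ b) y + sel (x ≡ᵇ b) y
sel-<ᵇ-suc zero    zero    y = refl
sel-<ᵇ-suc zero    (suc b) y = sym (+-identityʳ y)
sel-<ᵇ-suc (suc x) zero    y = refl
sel-<ᵇ-suc (suc x) (suc b) y = sel-<ᵇ-suc x b y

below-suc : ∀ n k a b → below n k a (suc b) ≡ below n k a b + inside k a b n
below-suc n k a b =
  trans (∑-cong n λ j _ → sel-<ᵇ-suc (k j) b (a j))
        (∑-+ n (λ j → sel (k j <ᵇ b) (a j)) (λ j → sel (k j ≡ᵇ b) (a j)))

below-zero : ∀ n k a → below n k a 0 ≡ 0
below-zero n k a = ∑-zero n

below≤ : ∀ n k a b → below n k a b ≤ ∑ n a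
below≤ n k a b = ∑-mono n λ j _ → sel≤ (k j <ᵇ b) (a j)

below-all : ∀ n k a b → (∀ j → j < n → k j < b) → below n k a b ≡ ∑ n a
below-all n k a b k<b = ∑-cong n λ j j<n → cong (λ t → sel t (a j)) (<ᵇ-true (k<b j j<n))

∑-inside : ∀ n k a b → ∑ b (λ J → inside k a J n) ≡ below n k a b
∑-inside n k a zero    = sym (below-zero n k a)
∑-inside n k a (suc b) = trans (cong (_+ inside k a b n) (∑-inside n k a b)) (sym (below-suc n k a b))

-- Random keys

-- false beyond the end, like the coin tape of a program.
bit : List Bool → ℕ → Bool
bit []       _       = false
bit (b ∷ _)  zero    = b
bit (_ ∷ bs) (suc j) = bit bs j

-- 2^N times the expectation of g under N fair coins.
𝔼 : ℕ → (List Bool → ℕ) → ℕ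
𝔼 zero    g = g []
𝔼 (suc N) g = 𝔼 N (g ∘ (false ∷_)) + 𝔼 N (g ∘ (true ∷_))

𝔼-cong : ∀ N {f g} → (∀ xs → f xs ≡ g xs) → 𝔼 N f ≡ 𝔼 N g
𝔼-cong zero    eq = eq []
𝔼-cong (suc N) eq = cong₂ _+_ (𝔼-cong N (eq ∘ (false ∷_))) (𝔼-cong N (eq ∘ (true ∷_)))

𝔼-mono : ∀ N {f g} → (∀ xs → f xs ≤ g xs) → 𝔼 N f ≤ 𝔼 N g
𝔼-mono zero    le = le []
𝔼-mono (suc N) le = +-mono-≤ (𝔼-mono N (le ∘ (false ∷_))) (𝔼-mono N (le ∘ (true ∷_)))

𝔼-+ : ∀ N f g → 𝔼 N (λ xs → f xs + g xs) ≡ 𝔼 N f + 𝔼 N g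
𝔼-+ zero    f g = refl
𝔼-+ (suc N) f g =
  trans (cong₂ _+_ (𝔼-+ N (f ∘ (false ∷_)) (g ∘ (false ∷_))) (𝔼-+ N (f ∘ (true ∷_)) (g ∘ (true ∷_))))
        (interchange (𝔼 N (f ∘ (false ∷_))) _ _ _)

𝔼-*ˡ : ∀ N c f → 𝔼 N (λ xs → c * f xs) ≡ c * 𝔼 N f
𝔼-*ˡ zero    c f = refl
𝔼-*ˡ (suc N) c f =
  trans (cong₂ _+_ (𝔼-*ˡ N c (f ∘ (false ∷_))) (𝔼-*ˡ N c (f ∘ (true ∷_)))) (sym (*-distribˡ-+ c _ _))

double : ∀ x → 2 * x ≡ x + x
double = solve-∀

𝔼-const : ∀ N c → 𝔼 N (λ _ → c) ≡ 2 ^ N * c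
𝔼-const zero    c = sym (*-identityˡ c)
𝔼-const (suc N) c = begin
  𝔼 N (λ _ → c) + 𝔼 N (λ _ → c) ≡⟨ cong₂ _+_ (𝔼-const N c) (𝔼-const N c) ⟩
  2 ^ N * c + 2 ^ N * c           ≡⟨ double (2 ^ N * c) ⟨
  2 * (2 ^ N * c)                 ≡⟨ *-assoc 2 (2 ^ N) c ⟨
  2 ^ suc N * c                   ∎
  where open ≡-Reasoning

𝔼-∑ : ∀ N n (f : ℕ → List Bool → ℕ) → 𝔼 N (λ xs → ∑ n (λ j → f j xs)) ≡ ∑ n (λ j → 𝔼 N (f j))
𝔼-∑ N zero    f = trans (𝔼-const N 0) (*-zeroʳ (2 ^ N))
𝔼-∑ N (suc n) f = trans (𝔼-+ N (λ xs → ∑ n (λ j → f j xs)) (f n)) (cong (_+ 𝔼 N (f n)) (𝔼-∑ N n f))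

-- Fubini for two consecutive blocks of coins; in this form the independence of levels and of rows
-- is used.
𝔼-split : ∀ N M (h : List Bool → List Bool → ℕ) →
  𝔼 (N + M) (λ zs → h (take N zs) (drop N zs)) ≡ 𝔼 N (λ xs → 𝔼 M (h xs))
𝔼-split zero    M h = refl
𝔼-split (suc N) M h =
  cong₂ _+_ (𝔼-split N M (h ∘ (false ∷_))) (𝔼-split N M (h ∘ (true ∷_)))

-- Second moments of signed sums

sq : ℤ → ℕ
sq z = ∣ z ∣ * ∣ z ∣

+sq : ∀ z → ℤ⁺ (sq z) ≡ z ℤ.* z
+sq (ℤ⁺ n)          = ℤₚ.pos-* n n
+sq (ℤ.-[1+_] n) = refl

parallelogramℤ : ∀ x a → (x ℤ.+ a) ℤ.* (x ℤ.+ a) ℤ.+ (x ℤ.- a) ℤ.* (x ℤ.- a) ≡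
                         (x ℤ.* x ℤ.+ a ℤ.* a) ℤ.+ (x ℤ.* x ℤ.+ a ℤ.* a)
parallelogramℤ = ℤSolver.solve-∀

parallelogram : ∀ x a → sq (x ℤ.+ ℤ⁺ a) + sq (x ℤ.- ℤ⁺ a) ≡ 2 * (sq x + a * a)
parallelogram x a = ℤₚ.+-injective (begin
  ℤ⁺ (sq (x ℤ.+ ℤ⁺ a) + sq (x ℤ.- ℤ⁺ a))
    ≡⟨ ℤₚ.pos-+ (sq (x ℤ.+ ℤ⁺ a)) (sq (x ℤ.- ℤ⁺ a)) ⟩
  ℤ⁺ (sq (x ℤ.+ ℤ⁺ a)) ℤ.+ ℤ⁺ (sq (x ℤ.- ℤ⁺ a))
    ≡⟨ cong₂ ℤ._+_ (+sq (x ℤ.+ ℤ⁺ a)) (+sq (x ℤ.- ℤ⁺ a)) ⟩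
  (x ℤ.+ ℤ⁺ a) ℤ.* (x ℤ.+ ℤ⁺ a) ℤ.+ (x ℤ.- ℤ⁺ a) ℤ.* (x ℤ.- ℤ⁺ a)
    ≡⟨ parallelogramℤ x (ℤ⁺ a) ⟩
  (x ℤ.* x ℤ.+ ℤ⁺ a ℤ.* ℤ⁺ a) ℤ.+ (x ℤ.* x ℤ.+ ℤ⁺ a ℤ.* ℤ⁺ a)
    ≡⟨ cong₂ (λ u v → (u ℤ.+ v) ℤ.+ (u ℤ.+ v)) (+sq x) (ℤₚ.pos-* a a) ⟨
  (ℤ⁺ (sq x) ℤ.+ ℤ⁺ (a * a)) ℤ.+ (ℤ⁺ (sq x) ℤ.+ ℤ⁺ (a * a))
    ≡⟨ cong ℤ⁺ (sym (double (sq x + a * a))) ⟩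
  ℤ⁺ (2 * (sq x + a * a)) ∎)
  where open ≡-Reasoning

heads tails : ℕ → (ℕ → ℕ) → List Bool → ℕ
heads n a xs = ∑ n λ j → sel (bit xs j) (a j)
tails n a xs = ∑ n λ j → sel (not (bit xs j)) (a j)

walk : ℤ → ℕ → (ℕ → ℕ) → List Bool → ℤ
walk x n a xs = (x ℤ.+ ℤ⁺ (tails n a xs)) ℤ.- ℤ⁺ (heads n a xs)

walk-shift⁺ : ∀ x c t h → (x ℤ.+ (c ℤ.+ t)) ℤ.- (0ℤ ℤ.+ h) ≡ ((x ℤ.+ c) ℤ.+ t) ℤ.- h
walk-shift⁺ = ℤSolver.solve-∀

walk-shift⁻ : ∀ x c t h → (x ℤ.+ (0ℤ ℤ.+ t)) ℤ.- (c ℤ.+ h) ≡ ((x ℤ.- c) ℤ.+ t) ℤ.- h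
walk-shift⁻ = ℤSolver.solve-∀

walk-step⁺ : ∀ x n a xs → walk x (suc n) a (false ∷ xs) ≡ walk (x ℤ.+ ℤ⁺ (a 0)) n (a ∘ suc) xs
walk-step⁺ x n a xs =
  trans (cong₂ (λ t h → (x ℤ.+ ℤ⁺ t) ℤ.- ℤ⁺ h) (∑-front n _) (∑-front n _))
        (walk-shift⁺ x (ℤ⁺ (a 0)) (ℤ⁺ (tails n (a ∘ suc) xs)) (ℤ⁺ (heads n (a ∘ suc) xs)))

walk-step⁻ : ∀ x n a xs → walk x (suc n) a (true ∷ xs) ≡ walk (x ℤ.- ℤ⁺ (a 0)) n (a ∘ suc) xs
walk-step⁻ x n a xs =
  trans (cong₂ (λ t h → (x ℤ.+ ℤ⁺ t) ℤ.- ℤ⁺ h) (∑-front n _) (∑-front n _))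
        (walk-shift⁻ x (ℤ⁺ (a 0)) (ℤ⁺ (tails n (a ∘ suc) xs)) (ℤ⁺ (heads n (a ∘ suc) xs)))

collect : ∀ e u v c s → u + v ≡ 2 * (c + s) → ∀ t → e * (u + t) + e * (v + t) ≡ 2 * e * (c + (s + t))
collect e u v c s eq t = trans (lemma₁ e u v t) (trans (cong (λ w → e * (w + 2 * t)) eq) (lemma₂ e c s t))
  where
  lemma₁ : ∀ e u v t → e * (u + t) + e * (v + t) ≡ e * ((u + v) + 2 * t)
  lemma₁ = solve-∀
  lemma₂ : ∀ e c s t → e * (2 * (c + s) + 2 * t) ≡ 2 * e * (c + (s + t))
  lemma₂ = solve-∀

-- The first coin moves the start to `x + a 0` or `x - a 0`; by the parallelogram law the cross
-- terms cancel and the squares add up. The variable start `x` is what lets the induction on the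
-- coins go through.
walk-variance : ∀ n x a → 𝔼 n (λ xs → sq (walk x n a xs)) ≡ 2 ^ n * (sq x + ∑ n (λ j → a j * a j))
walk-variance zero    x a =
  trans (cong sq (trans (ℤₚ.+-identityʳ _) (ℤₚ.+-identityʳ x))) (sym (trans (*-identityˡ _) (+-identityʳ _)))
walk-variance (suc n) x a = begin
  𝔼 n (λ xs → sq (walk x (suc n) a (false ∷ xs))) + 𝔼 n (λ xs → sq (walk x (suc n) a (true ∷ xs)))
    ≡⟨ cong₂ _+_ (𝔼-cong n λ xs → cong sq (walk-step⁺ x n a xs)) (𝔼-cong n λ xs → cong sq (walk-step⁻ x n a xs)) ⟩
  𝔼 n (λ xs → sq (walk (x ℤ.+ ℤ⁺ (a 0)) n (a ∘ suc) xs)) + 𝔼 n (λ xs → sq (walk (x ℤ.- ℤ⁺ (a 0)) n (a ∘ suc) xs))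
    ≡⟨ cong₂ _+_ (walk-variance n (x ℤ.+ ℤ⁺ (a 0)) (a ∘ suc)) (walk-variance n (x ℤ.- ℤ⁺ (a 0)) (a ∘ suc)) ⟩
  2 ^ n * (sq (x ℤ.+ ℤ⁺ (a 0)) + rest) + 2 ^ n * (sq (x ℤ.- ℤ⁺ (a 0)) + rest)
    ≡⟨ collect (2 ^ n) _ _ (sq x) (a 0 * a 0) (parallelogram x (a 0)) rest ⟩
  2 ^ suc n * (sq x + (a 0 * a 0 + rest))
    ≡⟨ cong (λ s → 2 ^ suc n * (sq x + s)) (∑-front n (λ j → a j * a j)) ⟨
  2 ^ suc n * (sq x + ∑ (suc n) (λ j → a j * a j)) ∎
  where
  open ≡-Reasoning
  rest = ∑ n (λ j → a (suc j) * a (suc j))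

-- The new bit becomes the lowest one, so group `J` splits into groups `2J` and `2J + 1`, and the
-- order between different groups is kept.
refine : (ℕ → ℕ) → List Bool → ℕ → ℕ
refine k xs j = k j + k j + sel (bit xs j) 1

group : (ℕ → ℕ) → (ℕ → ℕ) → ℕ → ℕ → ℕ
group k a J j = sel (k j ≡ᵇ J) (a j)

-- The signed sum of a group decides how evenly the next bit splits it; by
-- walk-variance the squares of all these sums add up to ∑ a² in expectation.
energy : ℕ → (ℕ → ℕ) → (ℕ → ℕ) → ℕ → List Bool → ℕ
energy n k a B xs = ∑ B λ J → sq (walk 0ℤ n (group k a J) xs)

sel-sq : ∀ b x → sel b x * sel b x ≡ sel b (x * x)
sel-sq true  x = refl
sel-sq false x = refl

energy-mean : ∀ n k a B → 𝔼 n (energy n k a B) ≤ 2 ^ n * ∑ n (λ j → a j * a j)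
energy-mean n k a B = begin
  𝔼 n (energy n k a B)
    ≡⟨ 𝔼-∑ n B (λ J xs → sq (walk 0ℤ n (group k a J) xs)) ⟩
  ∑ B (λ J → 𝔼 n (λ xs → sq (walk 0ℤ n (group k a J) xs)))
    ≡⟨ ∑-cong B (λ J _ → walk-variance n 0ℤ (group k a J)) ⟩
  ∑ B (λ J → 2 ^ n * ∑ n (λ j → group k a J j * group k a J j))
    ≡⟨ ∑-*ˡ B (2 ^ n) _ ⟩
  2 ^ n * ∑ B (λ J → ∑ n (λ j → group k a J j * group k a J j))
    ≡⟨ cong (2 ^ n *_) (∑-cong B λ J _ → ∑-cong n λ j _ → sel-sq (k j ≡ᵇ J) (a j)) ⟩
  2 ^ n * ∑ B (λ J → inside k a² J n)
    ≡⟨ cong (2 ^ n *_) (∑-inside n k a² B) ⟩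
  2 ^ n * below n k a² B
    ≤⟨ *-monoʳ-≤ (2 ^ n) (below≤ n k a² B) ⟩
  2 ^ n * ∑ n a² ∎
  where
  open ≤-Reasoning
  a² = λ j → a j * a j

energies : ℕ → (ℕ → ℕ) → ℕ → ℕ → (ℕ → ℕ) → List Bool → ℕ
energies n a zero    B k zs = 0
energies n a (suc L) B k zs =
  energy n k a B (take n zs) + energies n a L (2 * B) (refine k (take n zs)) (drop n zs)

keys : ℕ → ℕ → (ℕ → ℕ) → List Bool → ℕ → ℕ
keys n zero    k zs = k
keys n (suc L) k zs = keys n L (refine k (take n zs)) (drop n zs)

-- The bound of `energy-mean` is the same for all keys, so it holds conditionally on the bits drawn
-- so far, and each level adds one more sum of squares.
energies-mean : ∀ n a L B k → 𝔼 (L * n) (energies n a L B k) ≤ 2 ^ (L * n) * (L * ∑ n (λ j → a j * a j))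
energies-mean n a zero    B k = z≤n
energies-mean n a (suc L) B k = begin
  𝔼 (n + L * n) (energies n a (suc L) B k)
    ≡⟨ 𝔼-split n (L * n) (λ xs ys → energy n k a B xs + later xs ys) ⟩
  𝔼 n (λ xs → 𝔼 (L * n) (λ ys → energy n k a B xs + later xs ys))
    ≡⟨ 𝔼-cong n (λ xs → trans (𝔼-+ (L * n) (λ _ → energy n k a B xs) (later xs))
                               (cong (_+ 𝔼 (L * n) (later xs)) (𝔼-const (L * n) _))) ⟩
  𝔼 n (λ xs → 2 ^ (L * n) * energy n k a B xs + 𝔼 (L * n) (later xs))
    ≤⟨ 𝔼-mono n (λ xs → +-monoʳ-≤ _ (energies-mean n a L (2 * B) (refine k xs))) ⟩
  𝔼 n (λ xs → 2 ^ (L * n) * energy n k a B xs + 2 ^ (L * n) * (L * V))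
    ≡⟨ 𝔼-+ n _ _ ⟩
  𝔼 n (λ xs → 2 ^ (L * n) * energy n k a B xs) + 𝔼 n (λ _ → 2 ^ (L * n) * (L * V))
    ≡⟨ cong₂ _+_ (𝔼-*ˡ n (2 ^ (L * n)) _) (𝔼-const n _) ⟩
  2 ^ (L * n) * 𝔼 n (energy n k a B) + 2 ^ n * (2 ^ (L * n) * (L * V))
    ≤⟨ +-monoˡ-≤ _ (*-monoʳ-≤ (2 ^ (L * n)) (energy-mean n k a B)) ⟩
  2 ^ (L * n) * (2 ^ n * V) + 2 ^ n * (2 ^ (L * n) * (L * V))
    ≡⟨ regroup (2 ^ (L * n)) (2 ^ n) V L ⟩
  (2 ^ n * 2 ^ (L * n)) * (suc L * V)
    ≡⟨ cong (_* (suc L * V)) (^-distribˡ-+-* 2 n (L * n)) ⟨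
  2 ^ (suc L * n) * (suc L * V) ∎
  where
  open ≤-Reasoning
  V = ∑ n (λ j → a j * a j)
  later : List Bool → List Bool → ℕ
  later xs ys = energies n a L (2 * B) (refine k xs) ys
  regroup : ∀ p q v l → p * (q * v) + q * (p * (l * v)) ≡ (q * p) * ((1 + l) * v)
  regroup = solve-∀

-- The prefix below `b` differs from its fair share `b / B` of the total by at most `δ`. Multiplying
-- by `B` and splitting into two inequalities avoids both division and subtraction.
record Balanced (n : ℕ) (a k : ℕ → ℕ) (B δ : ℕ) : Set where
  field
    upper : ∀ b → b ≤ B → B * below n k a b ≤ b * ∑ n a + B * δ
    lower : ∀ b → b ≤ B → b * ∑ n a ≤ B * below n k a b + B * δ
open Balanced

refine-even : ∀ k c b → (k + k + sel c 1 <ᵇ b + b) ≡ (k <ᵇ b)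
refine-even zero    c     zero    = refl
refine-even zero    true  (suc b) rewrite +-suc b b = refl
refine-even zero    false (suc b) = refl
refine-even (suc k) c     zero    = refl
refine-even (suc k) c     (suc b) rewrite +-suc k k | +-suc b b = refine-even k c b

refine-odd : ∀ k c b y → sel (k + k + sel c 1 <ᵇ suc (b + b)) y ≡ sel (k <ᵇ b) y + sel (not c) (sel (k ≡ᵇ b) y)
refine-odd zero    true  zero    y = refl
refine-odd zero    false zero    y = refl
refine-odd zero    true  (suc b) y = sym (+-identityʳ y)
refine-odd zero    false (suc b) y = sym (+-identityʳ y)
refine-odd (suc k) true  zero    y = refl
refine-odd (suc k) false zero    y = refl
refine-odd (suc k) c     (suc b) y rewrite +-suc k k | +-suc b b = refine-odd k c b y

sel-split : ∀ c y → y ≡ sel (not c) y + sel c y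
sel-split true  y = refl
sel-split false y = sym (+-identityʳ y)

inside-split : ∀ n k a b xs → inside k a b n ≡ tails n (group k a b) xs + heads n (group k a b) xs
inside-split n k a b xs =
  trans (∑-cong n λ j _ → sel-split (bit xs j) (group k a b j)) (∑-+ n _ _)

below-even : ∀ n k a xs b → below n (refine k xs) a (b + b) ≡ below n k a b
below-even n k a xs b = ∑-cong n λ j _ → cong (λ t → sel t (a j)) (refine-even (k j) (bit xs j) b)

below-odd : ∀ n k a xs b → below n (refine k xs) a (suc (b + b)) ≡ below n k a b + tails n (group k a b) xs
below-odd n k a xs b =
  trans (∑-cong n λ j _ → refine-odd (k j) (bit xs j) b (a j)) (∑-+ n _ _)

square-cancel : ∀ {x y} → x * x ≤ y * y → x ≤ y
square-cancel x²≤y² = ≮⇒≥ λ y<x → <⇒≱ (*-mono-< y<x y<x) x²≤y²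

n≤m+∣m⊖n∣ : ∀ m n → n ≤ m + ∣ m ℤ.⊖ n ∣
n≤m+∣m⊖n∣ m n with ≤-total m n
... | inj₁ m≤n = ≤-trans (m≤n+m∸n n m) (+-monoʳ-≤ m (≤-reflexive (sym (ℤₚ.∣⊖∣-≤ m≤n))))
... | inj₂ n≤m = ≤-trans n≤m (m≤m+n m _)

∣t-h∣≤⇒ : ∀ t h {s} → ∣ (0ℤ ℤ.+ ℤ⁺ t) ℤ.- ℤ⁺ h ∣ ≤ s → t ≤ h + s × h ≤ t + s
∣t-h∣≤⇒ t h {s} le =
  ≤-trans (n≤m+∣m⊖n∣ h t) (+-monoʳ-≤ h (subst (_≤ s) (ℤₚ.∣m⊖n∣≡∣n⊖m∣ t h) dist)) ,
  ≤-trans (n≤m+∣m⊖n∣ t h) (+-monoʳ-≤ t dist)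
  where
  dist : ∣ t ℤ.⊖ h ∣ ≤ s
  dist = subst (_≤ s) (cong ∣_∣ (ℤₚ.m-n≡m⊖n t h)) le

even-odd : ∀ b → ∃[ b′ ] (b ≡ b′ + b′ ⊎ b ≡ suc (b′ + b′))
even-odd zero = 0 , inj₁ refl
even-odd (suc b) with even-odd b
... | b′ , inj₁ eq = b′ , inj₂ (cong suc eq)
... | b′ , inj₂ eq = suc b′ , inj₁ (trans (cong suc eq) (cong suc (sym (+-suc b′ b′))))

half-≤ : ∀ b B → b + b ≤ 2 * B → b ≤ B
half-≤ b B le = *-cancelˡ-≤ 2 (≤-trans (≤-reflexive (double b)) le)

half-< : ∀ b B → suc (b + b) ≤ 2 * B → suc b ≤ B
half-< b B le = *-cancelˡ-< 2 b B (subst (_< 2 * B) (sym (double b)) le)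

-- Boundaries 2b are inherited. At a boundary 2b+1, twice the new sum differs from
-- the sum of the two neighbouring old ones by the signed sum of group b.
refine-balanced : ∀ n a k B δ lam xs → Balanced n a k B δ → energy n k a B xs ≤ lam * lam →
                  Balanced n a (refine k xs) (2 * B) (δ + lam)
refine-balanced n a k B δ lam xs bal small = record { upper = up ; lower = lo }
  where
  open ≤-Reasoning
  P = ∑ n a
  A = below n k a
  A′ = below n (refine k xs) a
  t h : ℕ → ℕ
  t b = tails n (group k a b) xs
  h b = heads n (group k a b) xs

  -- A single square is at most the sum of all of them, so the energy bounds the imbalance of every
  -- group at once.
  near : ∀ b → b < B → t b ≤ h b + lam × h b ≤ t b + lam
  near b b<B = ∣t-h∣≤⇒ (t b) (h b) (square-cancel (≤-trans (term≤∑ B (λ J → sq (walk 0ℤ n (group k a J) xs)) b<B) small))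

  next : ∀ b → A (suc b) ≡ A b + (t b + h b)
  next b = trans (below-suc n k a b) (cong (A b +_) (inside-split n k a b xs))

  -- The error at an odd boundary grows by half of `lam`, at an even one not at all; rounding both
  -- up to `lam` gives one bound for all boundaries.
  slack : ∀ x → x + (B * δ + B * δ) + B * lam ≤ x + 2 * B * (δ + lam)
  slack x = ≤-trans (m≤m+n _ (B * lam)) (≤-reflexive (rearrange x B δ lam))
    where
    rearrange : ∀ x B δ l → (x + (B * δ + B * δ) + B * l) + B * l ≡ x + 2 * B * (δ + l)
    rearrange = solve-∀

  up-even : ∀ b → b ≤ B → 2 * B * A b ≤ (b + b) * P + 2 * B * (δ + lam)
  up-even b b≤B = begin
    2 * B * A b                                 ≡⟨ e₁ B (A b) ⟩
    B * A b + B * A b                           ≤⟨ +-mono-≤ (upper bal b b≤B) (upper bal b b≤B) ⟩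
    (b * P + B * δ) + (b * P + B * δ)           ≡⟨ e₂ b P (B * δ) ⟩
    (b + b) * P + (B * δ + B * δ)               ≤⟨ m≤m+n _ _ ⟩
    (b + b) * P + (B * δ + B * δ) + B * lam     ≤⟨ slack _ ⟩
    (b + b) * P + 2 * B * (δ + lam)             ∎
    where
    e₁ : ∀ B A → 2 * B * A ≡ B * A + B * A
    e₁ = solve-∀
    e₂ : ∀ b P d → (b * P + d) + (b * P + d) ≡ (b + b) * P + (d + d)
    e₂ = solve-∀

  up-odd : ∀ b → b < B → 2 * B * (A b + t b) ≤ suc (b + b) * P + 2 * B * (δ + lam)
  up-odd b b<B = begin
    2 * B * (A b + t b)                         ≡⟨ e₁ B (A b) (t b) ⟩
    B * A b + B * (A b + (t b + t b))           ≤⟨ +-monoʳ-≤ (B * A b) (*-monoʳ-≤ B (+-monoʳ-≤ (A b) (+-monoʳ-≤ (t b) (proj₁ (near b b<B))))) ⟩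
    B * A b + B * (A b + (t b + (h b + lam)))   ≡⟨ e₂ B (A b) (t b) (h b) lam ⟩
    B * A b + B * (A b + (t b + h b)) + B * lam ≡⟨ cong (λ z → B * A b + B * z + B * lam) (next b) ⟨
    B * A b + B * A (suc b) + B * lam           ≤⟨ +-monoˡ-≤ (B * lam) (+-mono-≤ (upper bal b (<⇒≤ b<B)) (upper bal (suc b) b<B)) ⟩
    (b * P + B * δ) + (suc b * P + B * δ) + B * lam ≡⟨ e₃ b P (B * δ) (B * lam) ⟩
    suc (b + b) * P + (B * δ + B * δ) + B * lam ≤⟨ slack _ ⟩
    suc (b + b) * P + 2 * B * (δ + lam)         ∎
    where
    e₁ : ∀ B A t → 2 * B * (A + t) ≡ B * A + B * (A + (t + t))
    e₁ = solve-∀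
    e₂ : ∀ B A t h l → B * A + B * (A + (t + (h + l))) ≡ B * A + B * (A + (t + h)) + B * l
    e₂ = solve-∀
    e₃ : ∀ b P d e → (b * P + d) + ((1 + b) * P + d) + e ≡ (1 + (b + b)) * P + (d + d) + e
    e₃ = solve-∀

  lo-even : ∀ b → b ≤ B → (b + b) * P ≤ 2 * B * A b + 2 * B * (δ + lam)
  lo-even b b≤B = begin
    (b + b) * P                                 ≡⟨ *-distribʳ-+ P b b ⟩
    b * P + b * P                               ≤⟨ +-mono-≤ (lower bal b b≤B) (lower bal b b≤B) ⟩
    (B * A b + B * δ) + (B * A b + B * δ)       ≡⟨ e₂ B (A b) (B * δ) ⟩
    2 * B * A b + (B * δ + B * δ)               ≤⟨ m≤m+n _ _ ⟩
    2 * B * A b + (B * δ + B * δ) + B * lam     ≤⟨ slack _ ⟩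
    2 * B * A b + 2 * B * (δ + lam)             ∎
    where
    e₂ : ∀ B A d → (B * A + d) + (B * A + d) ≡ 2 * B * A + (d + d)
    e₂ = solve-∀

  lo-odd : ∀ b → b < B → suc (b + b) * P ≤ 2 * B * (A b + t b) + 2 * B * (δ + lam)
  lo-odd b b<B = begin
    suc (b + b) * P                             ≡⟨ e₁ b P ⟩
    b * P + suc b * P                           ≤⟨ +-mono-≤ (lower bal b (<⇒≤ b<B)) (lower bal (suc b) b<B) ⟩
    (B * A b + B * δ) + (B * A (suc b) + B * δ) ≡⟨ cong (λ z → (B * A b + B * δ) + (B * z + B * δ)) (next b) ⟩
    (B * A b + B * δ) + (B * (A b + (t b + h b)) + B * δ)
      ≤⟨ +-monoʳ-≤ (B * A b + B * δ) (+-monoˡ-≤ (B * δ) (*-monoʳ-≤ B (+-monoʳ-≤ (A b) (+-monoʳ-≤ (t b) (proj₂ (near b b<B)))))) ⟩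
    (B * A b + B * δ) + (B * (A b + (t b + (t b + lam))) + B * δ) ≡⟨ e₂ B (A b) (t b) lam (B * δ) ⟩
    2 * B * (A b + t b) + (B * δ + B * δ) + B * lam ≤⟨ slack _ ⟩
    2 * B * (A b + t b) + 2 * B * (δ + lam)     ∎
    where
    e₁ : ∀ b P → (1 + (b + b)) * P ≡ b * P + (1 + b) * P
    e₁ = solve-∀
    e₂ : ∀ B A t l d → (B * A + d) + (B * (A + (t + (t + l))) + d) ≡ 2 * B * (A + t) + (d + d) + B * l
    e₂ = solve-∀

  up : ∀ b → b ≤ 2 * B → 2 * B * A′ b ≤ b * P + 2 * B * (δ + lam)
  up b b≤ with even-odd b
  ... | b′ , inj₁ refl rewrite below-even n k a xs b′ = up-even b′ (half-≤ b′ B b≤)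
  ... | b′ , inj₂ refl rewrite below-odd n k a xs b′  = up-odd b′ (half-< b′ B b≤)

  lo : ∀ b → b ≤ 2 * B → b * P ≤ 2 * B * A′ b + 2 * B * (δ + lam)
  lo b b≤ with even-odd b
  ... | b′ , inj₁ refl rewrite below-even n k a xs b′ = lo-even b′ (half-≤ b′ B b≤)
  ... | b′ , inj₂ refl rewrite below-odd n k a xs b′  = lo-odd b′ (half-< b′ B b≤)

-- Energies are nonnegative, so the bound on their total bounds the energy of each level, and each
-- level costs one `lam`.
keys-balanced : ∀ n a L B k δ lam zs → Balanced n a k B δ → energies n a L B k zs ≤ lam * lam →
                Balanced n a (keys n L k zs) (2 ^ L * B) (δ + L * lam)
keys-balanced n a zero    B k δ lam zs bal small =
  subst₂ (Balanced n a k) (sym (*-identityˡ B)) (sym (+-identityʳ δ)) bal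
keys-balanced n a (suc L) B k δ lam zs bal small =
  subst₂ (Balanced n a _) (shift (2 ^ L) B) (+-assoc δ lam (L * lam))
    (keys-balanced n a L (2 * B) _ (δ + lam) lam (drop n zs)
      (refine-balanced n a k B δ lam (take n zs) bal (m+n≤o⇒m≤o _ small))
      (m+n≤o⇒n≤o (energy n k a B (take n zs)) small))
  where
  shift : ∀ e B → e * (2 * B) ≡ 2 * e * B
  shift = solve-∀

initial-balanced : ∀ n a → Balanced n a (λ _ → 0) 1 0
initial-balanced n a = record { upper = up ; lower = lo }
  where
  full : below n (λ _ → 0) a 1 ≡ ∑ n a
  full = below-all n (λ _ → 0) a 1 (λ _ _ → s≤s z≤n)
  up : ∀ b → b ≤ 1 → 1 * below n (λ _ → 0) a b ≤ b * ∑ n a + 1 * 0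
  up zero    b≤1       = ≤-reflexive (trans (*-identityˡ (below n (λ _ → 0) a 0)) (below-zero n (λ _ → 0) a))
  up (suc zero) b≤1       = ≤-reflexive (trans (cong (1 *_) full) (sym (+-identityʳ _)))
  up (suc (suc b)) (s≤s ())
  lo : ∀ b → b ≤ 1 → b * ∑ n a ≤ 1 * below n (λ _ → 0) a b + 1 * 0
  lo zero    b≤1       = z≤n
  lo (suc zero) b≤1       = ≤-reflexive (trans (cong (1 *_) (sym full)) (sym (+-identityʳ _)))
  lo (suc (suc b)) (s≤s ())

keys< : ∀ n L k B zs → (∀ j → k j < B) → ∀ j → keys n L k zs j < 2 ^ L * B
keys< n zero    k B zs k<B j = subst (k j <_) (sym (*-identityˡ B)) (k<B j)
keys< n (suc L) k B zs k<B j =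
  subst (keys n (suc L) k zs j <_) (shift (2 ^ L) B) (keys< n L (refine k (take n zs)) (2 * B) (drop n zs) refined j)
  where
  shift : ∀ e B → e * (2 * B) ≡ 2 * e * B
  shift = solve-∀
  refined : ∀ j → refine k (take n zs) j < 2 * B
  refined j = begin-strict
    k j + k j + sel (bit (take n zs) j) 1 ≤⟨ +-monoʳ-≤ (k j + k j) (sel≤ (bit (take n zs) j) 1) ⟩
    k j + k j + 1                         <⟨ n<1+n _ ⟩
    suc (k j + k j + 1)                   ≡⟨ e (k j) ⟩
    suc (k j) + suc (k j)                 ≤⟨ +-mono-≤ (k<B j) (k<B j) ⟩
    B + B                                 ≡⟨ double B ⟨
    2 * B                                 ∎
    where
    open ≤-Reasoning
    e : ∀ k → 1 + (k + k + 1) ≡ (1 + k) + (1 + k)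
    e = solve-∀

-- Failure probability of the rows

ind : Bool → ℕ
ind b = sel b 1

-- The energies of all levels are tested together, so that one application of Markov's inequality
-- covers a whole row.
bad-row : ℕ → ℕ → ℕ → (ℕ → ℕ) → List Bool → Bool
bad-row n L s a zs = s <ᵇ energies n a L 1 (λ _ → 0) zs

good-row : ∀ n L lam a zs → bad-row n L (lam * lam) a zs ≡ false →
           Balanced n a (keys n L (λ _ → 0) zs) (2 ^ L) (L * lam)
good-row n L lam a zs good =
  subst (λ B → Balanced n a (keys n L (λ _ → 0) zs) B (L * lam)) (*-identityʳ (2 ^ L))
    (keys-balanced n a L 1 _ 0 lam zs (initial-balanced n a) (<ᵇ-false⁻¹ good))

-- Markov's inequality.
bad-row-rare : ∀ n L s a → 2 * (L * ∑ n (λ j → a j * a j)) ≤ s → 0 < s →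
               2 * 𝔼 (L * n) (ind ∘ bad-row n L s a) ≤ 2 ^ (L * n)
bad-row-rare n L s a big s>0 = *-cancelˡ-≤ s {{>-nonZero s>0}} (begin
  s * (2 * 𝔼 (L * n) (ind ∘ bad-row n L s a))      ≡⟨ e₁ s _ ⟩
  2 * (s * 𝔼 (L * n) (ind ∘ bad-row n L s a))      ≡⟨ cong (2 *_) (𝔼-*ˡ (L * n) s _) ⟨
  2 * 𝔼 (L * n) (λ zs → s * ind (bad-row n L s a zs)) ≤⟨ *-monoʳ-≤ 2 (𝔼-mono (L * n) markov) ⟩
  2 * 𝔼 (L * n) (energies n a L 1 (λ _ → 0))       ≤⟨ *-monoʳ-≤ 2 (energies-mean n a L 1 (λ _ → 0)) ⟩
  2 * (2 ^ (L * n) * (L * V))                       ≡⟨ e₂ (2 ^ (L * n)) (L * V) ⟩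
  2 * (L * V) * 2 ^ (L * n)                         ≤⟨ *-monoˡ-≤ (2 ^ (L * n)) big ⟩
  s * 2 ^ (L * n)                                   ∎)
  where
  open ≤-Reasoning
  V = ∑ n (λ j → a j * a j)
  e₁ : ∀ s x → s * (2 * x) ≡ 2 * (s * x)
  e₁ = solve-∀
  e₂ : ∀ s x → 2 * (s * x) ≡ 2 * x * s
  e₂ = solve-∀
  markov : ∀ zs → s * ind (bad-row n L s a zs) ≤ energies n a L 1 (λ _ → 0) zs
  markov zs with bad-row n L s a zs in eq
  ... | true  = ≤-trans (≤-reflexive (*-identityʳ s)) (<⇒≤ (<ᵇ-true⁻¹ eq))
  ... | false = ≤-trans (≤-reflexive (*-zeroʳ s)) z≤n

all-bad : ℕ → (List Bool → Bool) → ℕ → List Bool → Bool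
all-bad N bad zero    zs = true
all-bad N bad (suc R) zs = bad (take N zs) ∧ all-bad N bad R (drop N zs)

ind-∧ : ∀ b c → ind (b ∧ c) ≡ ind b * ind c
ind-∧ true  c = sym (*-identityˡ (ind c))
ind-∧ false c = refl

-- Rows use disjoint blocks of coins, so their failure probabilities multiply. `M` counts the coins
-- after the last row: the tape is as long as the time bound, and the rows use only its beginning.
all-bad-rare : ∀ N bad → 2 * 𝔼 N (ind ∘ bad) ≤ 2 ^ N → ∀ R M →
               2 ^ R * 𝔼 (R * N + M) (ind ∘ all-bad N bad R) ≤ 2 ^ (R * N + M)
all-bad-rare N bad rare zero    M = ≤-reflexive (trans (*-identityˡ _) (trans (𝔼-const M 1) (*-identityʳ _)))
all-bad-rare N bad rare (suc R) M = begin
  2 ^ suc R * 𝔼 (N + R * N + M) (ind ∘ all-bad N bad (suc R))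
    ≡⟨ cong (λ K → 2 ^ suc R * 𝔼 K (ind ∘ all-bad N bad (suc R))) (+-assoc N (R * N) M) ⟩
  2 ^ suc R * 𝔼 (N + (R * N + M)) (ind ∘ all-bad N bad (suc R))
    ≡⟨ cong (2 ^ suc R *_) (𝔼-split N (R * N + M) (λ xs ys → ind (bad xs ∧ all-bad N bad R ys))) ⟩
  2 ^ suc R * 𝔼 N (λ xs → 𝔼 (R * N + M) (λ ys → ind (bad xs ∧ all-bad N bad R ys)))
    ≡⟨ cong (2 ^ suc R *_) (𝔼-cong N λ xs → trans (𝔼-cong (R * N + M) λ ys → ind-∧ (bad xs) _)
         (trans (𝔼-*ˡ (R * N + M) (ind (bad xs)) _) (*-comm (ind (bad xs)) _))) ⟩
  2 ^ suc R * 𝔼 N (λ xs → E * ind (bad xs))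
    ≡⟨ cong (2 ^ suc R *_) (𝔼-*ˡ N E _) ⟩
  2 ^ suc R * (E * 𝔼 N (ind ∘ bad))
    ≡⟨ e (2 ^ R) E _ ⟩
  (2 * 𝔼 N (ind ∘ bad)) * (2 ^ R * E)
    ≤⟨ *-mono-≤ rare (all-bad-rare N bad rare R M) ⟩
  2 ^ N * 2 ^ (R * N + M)
    ≡⟨ ^-distribˡ-+-* 2 N (R * N + M) ⟨
  2 ^ (N + (R * N + M))
    ≡⟨ cong (2 ^_) (+-assoc N (R * N) M) ⟨
  2 ^ (suc R * N + M) ∎
  where
  open ≤-Reasoning
  E = 𝔼 (R * N + M) (ind ∘ all-bad N bad R)
  e : ∀ p E x → 2 * p * (E * x) ≡ (2 * x) * (p * E)
  e = solve-∀

row : ℕ → ℕ → List Bool → List Bool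
row N r zs = take N (drop (r * N) zs)

some-good : ∀ N bad R zs → all-bad N bad R zs ≡ false → ∃[ r ] (r < R × bad (row N r zs) ≡ false)
some-good N bad (suc R) zs eq with bad (take N zs) in first
... | false = 0 , s≤s z≤n , first
... | true with some-good N bad R (drop N zs) eq
...   | r , r<R , good = suc r , s≤s r<R ,
        trans (cong (bad ∘ take N) (sym (Listₚ.drop-drop N (r * N) zs))) good

-- The dynamic program

fold : ∀ {A : Set} → ℕ → (A → ℕ → A) → A → A
fold zero    g x = x
fold (suc n) g x = g (fold n g x) n

fold-inv : ∀ {A : Set} (P : ℕ → A → Set) n {g : A → ℕ → A} {x} → P 0 x →
           (∀ i y → i < n → P i y → P (suc i) (g y i)) → P n (fold n g x)
fold-inv P zero    base next = base
fold-inv P (suc n) base next = next n _ ≤-refl (fold-inv P n base λ i y i<n → next i y (m<n⇒m<1+n i<n))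

≡ᵇ-view : ∀ i j → (i ≡ j × (i ≡ᵇ j) ≡ true) ⊎ (i ≢ j × (i ≡ᵇ j) ≡ false)
≡ᵇ-view i j with i ≡ᵇ j in eq
... | true  = inj₁ (≡ᵇ-true⁻¹ eq , refl)
... | false = inj₂ ((λ i≡j → case trans (sym eq) (≡ᵇ-true i≡j) of λ ()) , refl)

update-same : ∀ (f : Store) i x → (f [ i ↦ x ]) i ≡ x
update-same f i x with ≡ᵇ-view i i
... | inj₁ (_ , is) rewrite is = refl
... | inj₂ (i≢i , is) rewrite is = contradiction refl i≢i

update-other : ∀ (f : Store) {i j} x → i ≢ j → (f [ i ↦ x ]) j ≡ f j
update-other f {i} {j} x i≢j with ≡ᵇ-view i j
... | inj₁ (i≡j , is) rewrite is = contradiction i≡j i≢j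
... | inj₂ (_ , is) rewrite is = refl

-- The maximum, in the form in which the program computes it by truncated subtraction.
raise : ℕ → ℕ → ℕ
raise x y = x + (y ∸ x)

x≤raise : ∀ x y → x ≤ raise x y
x≤raise x y = m≤m+n x (y ∸ x)

y≤raise : ∀ x y → y ≤ raise x y
y≤raise x y = m≤n+m∸n y x

raise-sel : ∀ x y → raise x y ≡ x ⊎ raise x y ≡ y
raise-sel x y with ≤-total x y
... | inj₁ x≤y = inj₂ (m+[n∸m]≡n x≤y)
... | inj₂ y≤x = inj₁ (trans (cong (x +_) (m≤n⇒m∸n≡0 y≤x)) (+-identityʳ x))

raise≤ : ∀ {x y z} → x ≤ z → y ≤ z → raise x y ≤ z
raise≤ {x} {y} x≤z y≤z with raise-sel x y
... | inj₁ eq = ≤-trans (≤-reflexive eq) x≤z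
... | inj₂ eq = ≤-trans (≤-reflexive eq) y≤z

-- A table f maps a profit v to 0 if v is not reached, and otherwise to one
-- more than the capacity left by the lightest set found with profit v.
relax : (cnt v p w : ℕ) → Store → Store
relax zero    v p w f = f
relax (suc c) v p w f = relax c (v ∸ 1) p w (f [ v ↦ raise (f v) (f (v ∸ p) ∸ w) ])

update-raise : ∀ f v x u → f u ≤ (f [ v ↦ raise (f v) x ]) u
update-raise f v x u with ≡ᵇ-view v u
... | inj₁ (refl , is) rewrite is = x≤raise (f v) x
... | inj₂ (_ , is) rewrite is = ≤-refl

relax-mono : ∀ c v p w f u → f u ≤ relax c v p w f u
relax-mono zero    v p w f u = ≤-refl
relax-mono (suc c) v p w f u = ≤-trans (update-raise f v _ u) (relax-mono c (v ∸ 1) p w _ u)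

-- Writes made before the loop reaches cell `u` only raise cells, so the value then read at `u ∸ p`
-- is at least the original one.
relax-hit : ∀ c v p w f u → u ≤ v → v < u + c → f (u ∸ p) ∸ w ≤ relax c v p w f u
relax-hit zero    v p w f u u≤v v<u+c = contradiction (subst (v <_) (+-identityʳ u) v<u+c) (≤⇒≯ u≤v)
relax-hit (suc c) v p w f u u≤v v<u+c with m≤n⇒m<n∨m≡n u≤v
... | inj₂ refl = ≤-trans (≤-trans (y≤raise (f u) _) (≤-reflexive (sym (update-same f u _)))) (relax-mono c (u ∸ 1) p w _ u)
... | inj₁ u<v  =
  ≤-trans (∸-monoˡ-≤ w (update-raise f v _ (u ∸ p)))
          (relax-hit c (v ∸ 1) p w _ u (≤-pred′ u<v) (closer v u<v v<u+c))
  where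
  ≤-pred′ : ∀ {u v} → u < v → u ≤ v ∸ 1
  ≤-pred′ (s≤s u≤v) = u≤v
  closer : ∀ v → u < v → v < u + suc c → v ∸ 1 < u + c
  closer (suc v) _ k< = s≤s⁻¹ (subst (suc v <_) (+-suc u c) k<)

-- An equality test from the available instructions: the two truncated differences sum to the
-- distance, and `1 ∸` sends every nonzero distance to 0.
eqℕ : ℕ → ℕ → ℕ
eqℕ x y = 1 ∸ ((x ∸ y) + (y ∸ x))

eqℕ-ind : ∀ x y → eqℕ x y ≡ ind (x ≡ᵇ y)
eqℕ-ind zero    zero    = refl
eqℕ-ind zero    (suc y) = 0∸n≡0 y
eqℕ-ind (suc x) zero    = 0∸n≡0 (x + 0)
eqℕ-ind (suc x) (suc y) = eqℕ-ind x y

-- `lo ∸ p + p` is the maximum of `lo` and `p`; from there up to `hi` lie the cells of the window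
-- whose profit is at least `p`.
span : (lo hi p : ℕ) → ℕ
span lo hi p = suc hi ∸ (lo ∸ p + p)

span-bound : ∀ lo hi p → p + span lo hi p ≤ suc hi ⊎ span lo hi p ≡ 0
span-bound lo hi p with ≤-total (lo ∸ p + p) (suc hi)
... | inj₁ le = inj₁ (≤-trans (+-monoˡ-≤ _ (m≤n+m p (lo ∸ p))) (≤-reflexive (m+[n∸m]≡n le)))
... | inj₂ ge = inj₂ (m≤n⇒m∸n≡0 ge)

-- Soundness and completeness of one pass

module DP (n : ℕ) (w p : ℕ → ℕ) (W : ℕ) (p⁺ : ∀ j → j < n → 0 < p j) where

  profit weight : (ℕ → Bool) → ℕ
  profit S = ∑ n λ j → sel (S j) (p j)
  weight S = ∑ n λ j → sel (S j) (w j)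

  module Pass (key lo hi : ℕ → ℕ) where

    -- Multiplying by the equality test replaces sorting by key: each bucket visits all items but
    -- relaxes only its own, and the `B * n` visits are of order n^(3/2).
    width : ℕ → ℕ → ℕ
    width b i = span (lo b) (hi b) (p i) * eqℕ (key i) b

    item : ℕ → Store → ℕ → Store
    item b f i = relax (width b i) (hi b) (p i) (w i) f

    bucket : Store → ℕ → Store
    bucket f b = fold n (item b) f

    start : Store → Store
    start f = f [ 0 ↦ suc W ]

    pass : ℕ → Store → Store
    pass B f = fold B bucket (start f)

    width≡ : ∀ b i → width b i ≡ sel (key i ≡ᵇ b) (span (lo b) (hi b) (p i))
    width≡ b i rewrite eqℕ-ind (key i) b with key i ≡ᵇ b
    ... | true  = *-identityʳ _
    ... | false = *-zeroʳ (span (lo b) (hi b) (p i))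

    width-fits : ∀ b i → p i + width b i ≤ suc (hi b) ⊎ width b i ≡ 0
    width-fits b i rewrite width≡ b i with key i ≡ᵇ b
    ... | true  = span-bound (lo b) (hi b) (p i)
    ... | false = inj₂ refl

    -- The items before position `(b , i)` in the order by key and then by index, in which the pass
    -- treats them.
    Done : ℕ → ℕ → ℕ → Set
    Done b i j = j < n × (key j < b ⊎ key j ≡ b × j < i)

    -- An inequality suffices: some witness set is claimed, not a lightest one. Its restriction to
    -- `D` guarantees that it omits an item still to be added.
    Reached : (ℕ → Set) → ℕ → ℕ → Set
    Reached D v x = ∃[ S ] ((∀ j → S j ≡ true → D j) × profit S ≡ v × x + weight S ≤ suc W)

    Sound : (ℕ → Set) → Store → Set
    Sound D f = ∀ v → 0 < f v → Reached D v (f v)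

    include : (ℕ → Bool) → ℕ → ℕ → Bool
    include S i j = if i ≡ᵇ j then true else S j

    ∑-include : ∀ m (S : ℕ → Bool) i (f : ℕ → ℕ) → i < m → S i ≡ false →
                ∑ m (λ j → sel (include S i j) (f j)) ≡ ∑ m (λ j → sel (S j) (f j)) + f i
    ∑-include (suc m) S i f i<1+m Si with m≤n⇒m<n∨m≡n i<1+m
    ... | inj₁ (s≤s i<m) = trans (cong₂ _+_ (∑-include m S i f i<m Si) (cong (λ t → sel t (f m)) (other m i<m)))
                                  (swapʳ (∑ m (λ j → sel (S j) (f j))) (f i) (sel (S m) (f m)))
      where
      other : ∀ m → i < m → include S i m ≡ S m
      other m i<m with ≡ᵇ-view i m
      ... | inj₁ (i≡m , is) rewrite is = contradiction i≡m (<⇒≢ i<m)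
      ... | inj₂ (_ , is) rewrite is = refl
      swapʳ : ∀ a b c → (a + b) + c ≡ (a + c) + b
      swapʳ = solve-∀
    ... | inj₂ refl = trans (cong₂ _+_ (∑-cong m others) last) (sym (+-assoc _ (sel (S i) (f i)) (f i)))
      where
      others : ∀ j → j < i → sel (include S i j) (f j) ≡ sel (S j) (f j)
      others j j<i with ≡ᵇ-view i j
      ... | inj₁ (i≡j , is) rewrite is = contradiction (sym i≡j) (<⇒≢ j<i)
      ... | inj₂ (_ , is) rewrite is = refl
      last : sel (include S i i) (f i) ≡ sel (S i) (f i) + f i
      last with ≡ᵇ-view i i
      ... | inj₁ (_ , is) rewrite is = cong (λ t → sel t (f i) + f i) (sym Si)
      ... | inj₂ (i≢i , is) rewrite is = contradiction refl i≢i

    extend : ∀ {D D′ : ℕ → Set} {i v x} → i < n → ¬ D i → (∀ j → D j → D′ j) → D′ i →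
             p i ≤ v → w i ≤ x → Reached D (v ∸ p i) x → Reached D′ v (x ∸ w i)
    extend {D} {D′} {i} {v} {x} i<n ¬Di D⊆D′ D′i pi≤v wi≤x (S , S⊆D , prof , wt) =
      include S i , valid , prof′ , wt′
      where
      Si : S i ≡ false
      Si with S i in eq
      ... | true  = contradiction (S⊆D i eq) ¬Di
      ... | false = refl
      valid : ∀ j → include S i j ≡ true → D′ j
      valid j eq with ≡ᵇ-view i j
      ... | inj₁ (refl , is) rewrite is = D′i
      ... | inj₂ (_ , is) rewrite is = D⊆D′ j (S⊆D j eq)
      prof′ : profit (include S i) ≡ v
      prof′ = trans (∑-include n S i p i<n Si) (trans (cong (_+ p i) prof) (m∸n+n≡m pi≤v))
      wt′ : x ∸ w i + weight (include S i) ≤ suc W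
      wt′ = begin
        x ∸ w i + weight (include S i) ≡⟨ cong (x ∸ w i +_) (∑-include n S i w i<n Si) ⟩
        x ∸ w i + (weight S + w i)     ≡⟨ e (x ∸ w i) (weight S) (w i) ⟩
        x ∸ w i + w i + weight S       ≡⟨ cong (_+ weight S) (m∸n+n≡m wi≤x) ⟩
        x + weight S                   ≤⟨ wt ⟩
        suc W                          ∎
        where
        open ≤-Reasoning
        e : ∀ a b c → a + (b + c) ≡ a + c + b
        e = solve-∀

    weaken : ∀ {D D′ : ℕ → Set} {v x} → (∀ j → D j → D′ j) → Reached D v x → Reached D′ v x
    weaken D⊆D′ (S , S⊆D , rest) = S , (λ j eq → D⊆D′ j (S⊆D j eq)) , rest

    -- Cells at most v are still untouched, as they are updated in descending
    -- order; so the new item is used at most once.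
    relax-sound : ∀ {D D′ : ℕ → Set} {i} → i < n → ¬ D i → (∀ j → D j → D′ j) → D′ i →
                  ∀ c v f → p i + c ≤ suc v → Sound D′ f →
                  (∀ u → u ≤ v → 0 < f u → Reached D u (f u)) → Sound D′ (relax c v (p i) (w i) f)
    relax-sound i<n ¬Di D⊆D′ D′i zero v f fits snd old = snd
    relax-sound {D} {D′} {i} i<n ¬Di D⊆D′ D′i (suc c) v f fits snd old =
      relax-sound {D} {D′} {i} i<n ¬Di D⊆D′ D′i c (v ∸ 1) f′ fits′ snd′ old′
      where
      x = f (v ∸ p i) ∸ w i
      f′ = f [ v ↦ raise (f v) x ]
      p+c≤v : p i + c ≤ v
      p+c≤v = s≤s⁻¹ (subst (_≤ suc v) (+-suc (p i) c) fits)
      pi≤v : p i ≤ v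
      pi≤v = m+n≤o⇒m≤o (p i) p+c≤v
      v>0 : 0 < v
      v>0 = <-≤-trans (p⁺ i i<n) pi≤v
      1+v-1 : suc (v ∸ 1) ≡ v
      1+v-1 = m+[n∸m]≡n v>0
      fits′ : p i + c ≤ suc (v ∸ 1)
      fits′ = subst (p i + c ≤_) (sym 1+v-1) p+c≤v
      cell : 0 < raise (f v) x → Reached D′ v (raise (f v) x)
      cell f>0 with raise-sel (f v) x
      ... | inj₁ eq = subst (Reached D′ v) (sym eq) (snd v (subst (0 <_) eq f>0))
      ... | inj₂ eq = subst (Reached D′ v) (sym eq)
          (extend {D} {D′} {i} i<n ¬Di D⊆D′ D′i pi≤v (<⇒≤ w<f) (old (v ∸ p i) (m∸n≤m v (p i)) (≤-<-trans z≤n w<f)))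
        where
        w<f : w i < f (v ∸ p i)
        w<f = ≰⇒> λ f≤w → contradiction (trans eq (m≤n⇒m∸n≡0 f≤w)) (≢-sym (<⇒≢ f>0))
      snd′ : Sound D′ f′
      snd′ u f>0 with ≡ᵇ-view v u
      ... | inj₁ (refl , is) rewrite is = cell f>0
      ... | inj₂ (_ , is) rewrite is = snd u f>0
      old′ : ∀ u → u ≤ v ∸ 1 → 0 < f′ u → Reached D u (f′ u)
      old′ u u≤ f>0 with ≡ᵇ-view v u
      ... | inj₁ (refl , is) rewrite is = contradiction (subst (u <_) 1+v-1 (s≤s u≤)) (<-irrefl refl)
      ... | inj₂ (_ , is) rewrite is = old u (≤-trans u≤ (m∸n≤m v 1)) f>0

    item-sound : ∀ b i f → i < n → Sound (Done b i) f → Sound (Done b (suc i)) (item b f i)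
    item-sound b i f i<n snd with key i ≟ b
    ... | no key≢b = λ v f>0 → weaken grow (subst (λ c → Reached (Done b i) v (relax c (hi b) (p i) (w i) f v)) (sym none)
                        (snd v (subst (λ c → 0 < relax c (hi b) (p i) (w i) f v) none f>0)))
      where
      none : width b i ≡ 0
      none rewrite width≡ b i with key i ≡ᵇ b in eq
      ... | true  = contradiction (≡ᵇ-true⁻¹ eq) key≢b
      ... | false = refl
      grow : ∀ j → Done b i j → Done b (suc i) j
      grow j (j<n , inj₁ k<)         = j<n , inj₁ k<
      grow j (j<n , inj₂ (eq , j<i)) = j<n , inj₂ (eq , m<n⇒m<1+n j<i)
    ... | yes key≡b with width-fits b i
    ...   | inj₁ fits = relax-sound {Done b i} {Done b (suc i)} {i} i<n fresh grow (i<n , inj₂ (key≡b , ≤-refl)) (width b i) (hi b) f fits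
                          (λ v f>0 → weaken grow (snd v f>0)) (λ u _ → snd u)
      where
      grow : ∀ j → Done b i j → Done b (suc i) j
      grow j (j<n , inj₁ k<)         = j<n , inj₁ k<
      grow j (j<n , inj₂ (eq , j<i)) = j<n , inj₂ (eq , m<n⇒m<1+n j<i)
      fresh : ¬ Done b i i
      fresh (_ , inj₁ k<)        = <-irrefl key≡b k<
      fresh (_ , inj₂ (_ , i<i)) = <-irrefl refl i<i
    ...   | inj₂ none = λ v f>0 → weaken grow (subst (λ c → Reached (Done b i) v (relax c (hi b) (p i) (w i) f v)) (sym none)
                          (snd v (subst (λ c → 0 < relax c (hi b) (p i) (w i) f v) none f>0)))
      where
      grow : ∀ j → Done b i j → Done b (suc i) j
      grow j (j<n , inj₁ k<)         = j<n , inj₁ k<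
      grow j (j<n , inj₂ (eq , j<i)) = j<n , inj₂ (eq , m<n⇒m<1+n j<i)

    pass-sound : ∀ B f → (∀ v → f v ≡ 0) → ∀ v → 0 < pass B f v → ∃[ S ] (profit S ≡ v × weight S ≤ W)
    pass-sound B f empty v f>0 = finish (fold-inv (λ b g → Sound (Done b 0) g) B first bucket-sound v f>0)
      where
      first : Sound (Done 0 0) (start f)
      first u f>0 with ≡ᵇ-view 0 u
      ... | inj₁ (refl , is) rewrite is = (λ _ → false) , (λ j ()) , ∑-zero n , ≤-reflexive (trans (cong (suc W +_) (∑-zero n)) (+-identityʳ (suc W)))
      ... | inj₂ (_ , is) rewrite is = contradiction (empty u) (≢-sym (<⇒≢ f>0))
      bucket-sound : ∀ b g → b < B → Sound (Done b 0) g → Sound (Done (suc b) 0) (bucket g b)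
      bucket-sound b g _ snd u f>0 =
        weaken next (fold-inv (λ i h → Sound (Done b i) h) n snd (λ i h i<n → item-sound b i h i<n) u f>0)
        where
        next : ∀ j → Done b n j → Done (suc b) 0 j
        next j (j<n , inj₁ k<)       = j<n , inj₁ (m<n⇒m<1+n k<)
        next j (j<n , inj₂ (eq , _)) = j<n , inj₁ (≤-reflexive (cong suc eq))
      finish : Reached (Done B 0) v (pass B f v) → ∃[ S ] (profit S ≡ v × weight S ≤ W)
      finish (S , _ , prof , wt) = S , prof , s≤s⁻¹ (≤-trans (+-monoˡ-≤ (weight S) f>0) wt)

    -- With the profits or weights masked by a set, this is how much of that set has been added at
    -- position `(b , i)`.
    cursor : (ℕ → ℕ) → ℕ → ℕ → ℕ
    cursor a b i = below n key a b + inside key a b i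

    cursor-next : ∀ a b → cursor a b n ≡ cursor a (suc b) 0
    cursor-next a b = trans (sym (below-suc n key a b)) (sym (+-identityʳ _))

    module _ (S : ℕ → Bool) (B : ℕ) (key<B : ∀ j → j < n → key j < B)
             (lo≤ : ∀ b → b < B → lo b ≤ below n key (λ j → sel (S j) (p j)) b)
             (≤hi : ∀ b → b < B → below n key (λ j → sel (S j) (p j)) (suc b) ≤ hi b) where

      a c : ℕ → ℕ
      a j = sel (S j) (p j)
      c j = sel (S j) (w j)

      -- With the weight added on the right, truncation does no harm: `f ≤ (f ∸ w) + w` holds even
      -- if the item does not fit. Feasibility of `S` enters only in `pass-complete`.
      Complete : ℕ → ℕ → Store → Set
      Complete b i f = suc W ≤ f (cursor a b i) + cursor c b i

      item-complete : ∀ b i f → b < B → i < n → Complete b i f → Complete b (suc i) (item b f i)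
      item-complete b i f b<B i<n inv rewrite width≡ b i with key i ≡ᵇ b in key≡ | S i in Si
      ... | false | _ = ≤-trans inv (≤-reflexive (cong₂ (λ u v → f (below n key a b + u) + (below n key c b + v))
                          (sym (+-identityʳ (inside key a b i))) (sym (+-identityʳ (inside key c b i)))))
      ... | true  | false = ≤-trans inv (≤-trans (+-monoˡ-≤ _ (relax-mono (span (lo b) (hi b) (p i)) (hi b) (p i) (w i) f (cursor a b i)))
                          (≤-reflexive (cong₂ (λ u v → relax (span (lo b) (hi b) (p i)) (hi b) (p i) (w i) f (below n key a b + u) + (below n key c b + v))
                          (sym (+-identityʳ (inside key a b i))) (sym (+-identityʳ (inside key c b i))))))
      ... | true  | true = begin
        suc W                                              ≤⟨ inv ⟩
        f (cursor a b i) + cursor c b i                    ≤⟨ +-monoˡ-≤ _ (m≤m∸n+n (f (cursor a b i)) (w i)) ⟩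
        f (cursor a b i) ∸ w i + w i + cursor c b i        ≡⟨ e (f (cursor a b i) ∸ w i) (w i) (below n key c b) (inside key c b i) ⟩
        f (cursor a b i) ∸ w i + (below n key c b + (inside key c b i + w i))
          ≡⟨ cong (λ t → f t ∸ w i + (below n key c b + (inside key c b i + w i))) back ⟨
        f (u ∸ p i) ∸ w i + (below n key c b + (inside key c b i + w i))
          ≤⟨ +-monoˡ-≤ _ (relax-hit (span (lo b) (hi b) (p i)) (hi b) (p i) (w i) f u u≤hi hi<) ⟩
        relax (span (lo b) (hi b) (p i)) (hi b) (p i) (w i) f u + (below n key c b + (inside key c b i + w i)) ∎
        where
        open ≤-Reasoning
        u = below n key a b + (inside key a b i + p i)
        e : ∀ x y z t → x + y + (z + t) ≡ x + (z + (t + y))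
        e = solve-∀
        m≤m∸n+n : ∀ m n → m ≤ m ∸ n + n
        m≤m∸n+n m n = ≤-trans (m≤n+m∸n m n) (≤-reflexive (+-comm n (m ∸ n)))
        back : u ∸ p i ≡ cursor a b i
        back = trans (cong (_∸ p i) (sym (+-assoc (below n key a b) _ (p i)))) (m+n∸n≡m (cursor a b i) (p i))
        step≡ : inside key a b (suc i) ≡ inside key a b i + p i
        step≡ = cong (inside key a b i +_) (trans (cong (λ t → sel t (a i)) key≡) (cong (λ t → sel t (p i)) Si))
        -- Within a bucket the profit of the growing set stays between its values at the two
        -- boundaries, hence inside the window.
        u≤hi : u ≤ hi b
        u≤hi = ≤-trans (+-monoʳ-≤ (below n key a b) (≤-trans (≤-reflexive (sym step≡)) (∑-monoˡ (λ j → sel (key j ≡ᵇ b) (a j)) i<n)))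
                       (≤-trans (≤-reflexive (sym (below-suc n key a b))) (≤hi b b<B))
        t≤u : lo b ∸ p i + p i ≤ u
        t≤u = ≤-trans (+-monoˡ-≤ (p i) (≤-trans (m∸n≤m (lo b) (p i)) (≤-trans (lo≤ b b<B) (m≤m+n _ (inside key a b i)))))
                      (≤-reflexive (+-assoc (below n key a b) _ (p i)))
        hi< : hi b < u + span (lo b) (hi b) (p i)
        hi< = ≤-trans (m≤n+m∸n (suc (hi b)) (lo b ∸ p i + p i)) (+-monoˡ-≤ _ t≤u)

      pass-complete : weight S ≤ W → ∀ f → 0 < pass B f (profit S)
      pass-complete light f = +-cancelʳ-< (weight S) 0 _ (≤-trans (s≤s light) final)
        where
        bucket-complete : ∀ b g → b < B → Complete b 0 g → Complete (suc b) 0 (bucket g b)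
        bucket-complete b g b<B inv =
          subst₂ (λ u v → suc W ≤ bucket g b u + v) (cursor-next a b) (cursor-next c b)
            (fold-inv (λ i h → Complete b i h) n inv (λ i h i<n → item-complete b i h b<B i<n))
        first : Complete 0 0 (start f)
        first = subst (λ u → suc W ≤ start f u + cursor c 0 0) (sym (trans (+-identityʳ _) (below-zero n key a))) (m≤m+n (suc W) _)
        whole : ∀ d → cursor d B 0 ≡ ∑ n d
        whole d = trans (+-identityʳ _) (below-all n key d B key<B)
        final : suc W ≤ pass B f (profit S) + weight S
        final = subst₂ (λ u v → suc W ≤ pass B f u + v) (whole a) (whole c) (fold-inv (λ b g → Complete b 0 g) B first bucket-complete)

-- Searching for the optimum

∑-prefix : ∀ n m (f : ℕ → ℕ) → m ≤ n → ∑ n (λ j → sel (j <ᵇ m) (f j)) ≡ ∑ m f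
∑-prefix n m f m≤n with m≤n⇒m<n∨m≡n m≤n
∑-prefix (suc n) m f _ | inj₁ (s≤s m≤n) =
  trans (cong₂ _+_ (∑-prefix n m f m≤n) (cong (λ t → sel t (f n)) (<ᵇ-false m≤n))) (+-identityʳ _)
... | inj₂ refl = ∑-cong n λ j j<n → cong (λ t → sel t (f j)) (<ᵇ-true j<n)

sel-∧ : ∀ b c x → sel (b ∧ c) x ≡ sel b (sel c x)
sel-∧ true  c x = refl
sel-∧ false c x = refl

≤-/ : ∀ x y d .{{_ : NonZero d}} → x * d ≤ y → x ≤ y / d
≤-/ x y d le = ≤-trans (≤-reflexive (sym (m*n/n≡m x d))) (/-monoˡ-≤ d le)

≤-half : ∀ x → x ≤ x / 2 + x / 2 + 1
≤-half x = begin
  x                   ≡⟨ m≡m%n+[m/n]*n x 2 ⟩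
  x % 2 + x / 2 * 2   ≤⟨ +-monoˡ-≤ _ (s≤s⁻¹ (m%n<n x 2)) ⟩
  1 + x / 2 * 2       ≡⟨ e (x / 2) ⟩
  x / 2 + x / 2 + 1   ∎
  where
  open ≤-Reasoning
  e : ∀ y → 1 + y * 2 ≡ y + y + 1
  e = solve-∀

half≤ : ∀ x → x / 2 + x / 2 ≤ x
half≤ x = ≤-trans (≤-reflexive (e (x / 2))) (m/n*n≤m x 2)
  where
  e : ∀ y → y + y ≡ y * 2
  e = solve-∀

scan : ℕ → Store → ℕ → ℕ
scan M f = fold M λ best v → raise best (ind (0 <ᵇ f v) * v)

scan-mono : ∀ M f best → best ≤ scan M f best
scan-mono zero    f best = ≤-refl
scan-mono (suc M) f best = ≤-trans (scan-mono M f best) (x≤raise _ _)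

scan-hit : ∀ M f best v → v < M → 0 < f v → v ≤ scan M f best
scan-hit (suc M) f best v v<1+M f>0 with m≤n⇒m<n∨m≡n v<1+M
... | inj₁ (s≤s v<M) = ≤-trans (scan-hit M f best v v<M f>0) (x≤raise _ _)
... | inj₂ refl = ≤-trans (≤-reflexive (sym (trans (cong (λ t → ind t * v) (<ᵇ-true f>0)) (*-identityˡ v)))) (y≤raise (scan v f best) _)

scan≤ : ∀ M f best X → best ≤ X → (∀ v → 0 < f v → v ≤ X) → scan M f best ≤ X
scan≤ M f best X base reach = fold-inv (λ _ b → b ≤ X) M base λ v b _ b≤X → raise≤ {b} b≤X (value v)
  where
  value : ∀ v → ind (0 <ᵇ f v) * v ≤ X
  value v with 0 <ᵇ f v in eq
  ... | true  = ≤-trans (≤-reflexive (*-identityˡ v)) (reach v (<ᵇ-true⁻¹ eq))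
  ... | false = z≤n

module Search
  (n : ℕ) (w p : ℕ → ℕ) (W : ℕ) (p⁺ : ∀ j → j < n → 0 < p j)
  (pm : ℕ) (p≤pm : ∀ j → j < n → p j ≤ pm) (pm⁺ : 0 < pm)
  (L : ℕ) (L⁺ : 0 < L) (n≤B² : n ≤ 2 ^ L * 2 ^ L) (R : ℕ)
  where

  open DP n w p W p⁺

  -- `lam` is chosen so that its square is at least `2 * L * n * pm²`, as Markov's inequality needs
  -- for failure probability 1/2; this uses `n ≤ B²`. Guesses stay at most `5 * U`, so no window
  -- reaches past `cells`.
  B U lam Δ cells : ℕ
  B = 2 ^ L
  U = n * pm
  lam = (L + L) * B * pm
  Δ = ((L * L + L * L) * B + 3) * pm
  cells = suc (5 * U + Δ)

  B⁺ : 0 < B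
  B⁺ = m^n>0 2 L

  instance
    B≢0 : NonZero B
    B≢0 = >-nonZero B⁺

  -- During bucket `b` the profit climbs from the prefix at `b` to the prefix at `b + 1`, predicted
  -- to be `b G / B` and `(b + 1) G / B`; the window covers both with margin `Δ`.
  lo hi : ℕ → ℕ → ℕ
  lo G b = (b * G) / B ∸ Δ
  hi G b = (b * G + G) / B + Δ

  -- L levels of random bits cost lam each, and the guess G may be 3 * pm off.
  Δ≡ : L * lam + 3 * pm ≡ Δ
  Δ≡ = e L B pm
    where
    e : ∀ L B p → L * ((L + L) * B * p) + 3 * p ≡ ((L * L + L * L) * B + 3) * p
    e = solve-∀

  module _ (a key : ℕ → ℕ) (G : ℕ) (bal : Balanced n a key B (L * lam))
           (G≤ : G ≤ ∑ n a + 3 * pm) (≤G : ∑ n a ≤ G + 3 * pm) where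
    open ≤-Reasoning

    window-lo : ∀ b → b < B → lo G b ≤ below n key a b
    window-lo b b<B = m≤n+o⇒m∸n≤o ((b * G) / B) Δ (≤-trans (*-cancelʳ-≤ _ _ B (begin
      (b * G) / B * B                          ≤⟨ m/n*n≤m (b * G) B ⟩
      b * G                                    ≤⟨ *-monoʳ-≤ b G≤ ⟩
      b * (∑ n a + 3 * pm)                     ≡⟨ *-distribˡ-+ b _ _ ⟩
      b * ∑ n a + b * (3 * pm)                 ≤⟨ +-mono-≤ (lower bal b (<⇒≤ b<B)) (*-monoˡ-≤ (3 * pm) (<⇒≤ b<B)) ⟩
      B * below n key a b + B * (L * lam) + B * (3 * pm) ≡⟨ e B (below n key a b) (L * lam) (3 * pm) ⟩
      (below n key a b + (L * lam + 3 * pm)) * B ∎)) (≤-reflexive (trans (cong (below n key a b +_) Δ≡) (+-comm _ Δ))))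
      where
      e : ∀ B A l q → B * A + B * l + B * q ≡ (A + (l + q)) * B
      e = solve-∀

    window-hi : ∀ b → b < B → below n key a (suc b) ≤ hi G b
    window-hi b b<B = ≤-trans (m≤n+m∸n A Δ) (≤-trans (+-monoʳ-≤ Δ (≤-/ (A ∸ Δ) (b * G + G) B (begin
      (A ∸ Δ) * B                    ≡⟨ *-distribʳ-∸ B A Δ ⟩
      A * B ∸ Δ * B                  ≤⟨ m≤n+o⇒m∸n≤o (A * B) (Δ * B) bound ⟩
      b * G + G                      ∎))) (≤-reflexive (+-comm Δ _)))
      where
      A = below n key a (suc b)
      e₁ : ∀ b G q l B → (1 + b) * (G + q) + B * l ≡ b * G + G + ((1 + b) * q + B * l)
      e₁ = solve-∀
      e₂ : ∀ x B q l → x + (B * q + B * l) ≡ (l + q) * B + x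
      e₂ = solve-∀
      bound : A * B ≤ Δ * B + (b * G + G)
      bound = begin
        A * B                                             ≡⟨ *-comm A B ⟩
        B * A                                             ≤⟨ upper bal (suc b) b<B ⟩
        suc b * ∑ n a + B * (L * lam)                     ≤⟨ +-monoˡ-≤ _ (*-monoʳ-≤ (suc b) ≤G) ⟩
        suc b * (G + 3 * pm) + B * (L * lam)              ≡⟨ e₁ b G (3 * pm) (L * lam) B ⟩
        b * G + G + (suc b * (3 * pm) + B * (L * lam))    ≤⟨ +-monoʳ-≤ (b * G + G) (+-monoˡ-≤ _ (*-monoˡ-≤ (3 * pm) b<B)) ⟩
        b * G + G + (B * (3 * pm) + B * (L * lam))        ≡⟨ e₂ (b * G + G) B (3 * pm) (L * lam) ⟩
        (L * lam + 3 * pm) * B + (b * G + G)              ≡⟨ cong (λ d → d * B + (b * G + G)) Δ≡ ⟩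
        Δ * B + (b * G + G)                               ∎

  profit≤U : ∀ S → profit S ≤ U
  profit≤U S = ∑-bound n λ j j<n → ≤-trans (sel≤ (S j) (p j)) (p≤pm j j<n)

  table : (ℕ → ℕ) → ℕ → Store
  table key G = Pass.pass key (lo G) (hi G) B (λ _ → 0)

  rounds : (ℕ → ℕ → ℕ) → ℕ → ℕ → ℕ
  rounds key G = fold R λ best r → scan cells (table (key r) G) best

  row-keys< : ∀ xs j → keys n L (λ _ → 0) xs j < B
  row-keys< xs j = subst (keys n L (λ _ → 0) xs j <_) (*-identityʳ B) (keys< n L (λ _ → 0) 1 xs (λ _ → s≤s z≤n) j)

  -- A conditional in arithmetic form, as `search-tail` computes it. The tolerance `pm` is there
  -- because a truncation matching the guess `Gt` is only known to come within `pm` of it.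
  advance : (G Gt best : ℕ) → ℕ
  advance G Gt best = G + (Gt ∸ G) * (1 ∸ ind (best + pm <ᵇ Gt))

  module _ (opt : ℕ) (S* : ℕ → Bool) (S*-profit : profit S* ≡ opt) (S*-light : weight S* ≤ W)
           (optimal : ∀ S → weight S ≤ W → profit S ≤ opt) where

    -- Only these n + 1 sets have to be followed, whatever guesses the search makes.
    target : ℕ → ℕ → Bool
    target m j = (j <ᵇ m) ∧ S* j

    gain : ℕ → ℕ → ℕ
    gain m j = sel (target m j) (p j)

    target-light : ∀ m → weight (target m) ≤ W
    target-light m = ≤-trans (∑-mono n λ j _ → ≤-trans (≤-reflexive (sel-∧ (j <ᵇ m) (S* j) (w j))) (sel≤ (j <ᵇ m) _)) S*-light

    target-profit : ∀ m → m ≤ n → profit (target m) ≡ ∑ m (λ j → sel (S* j) (p j))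
    target-profit m m≤n = trans (∑-cong n λ j _ → sel-∧ (j <ᵇ m) (S* j) (p j)) (∑-prefix n m _ m≤n)

    target-opt : profit (target n) ≡ opt
    target-opt = trans (target-profit n ≤-refl) S*-profit

    -- A discrete intermediate value argument, descending from the full optimal set: dropping one
    -- item lowers the profit by at most `pm`.
    between : ∀ G → G ≤ opt → ∃[ m ] (m ≤ n × profit (target m) ≤ G × G ≤ profit (target m) + pm)
    between G G≤opt = go n ≤-refl (≤-trans G≤opt (≤-reflexive (sym target-opt)))
      where
      go : ∀ m → m ≤ n → G ≤ profit (target m) → ∃[ m ] (m ≤ n × profit (target m) ≤ G × G ≤ profit (target m) + pm)
      go zero    m≤n G≤ = 0 , z≤n , ≤-trans (≤-reflexive (target-profit 0 z≤n)) z≤n , ≤-trans G≤ (m≤m+n _ pm)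
      go (suc m) m<n G≤ with ≤-total G (profit (target m))
      ... | inj₁ G≤′ = go m (<⇒≤ m<n) G≤′
      ... | inj₂ ≤G  = m , <⇒≤ m<n , ≤G , ≤-trans G≤ (≤-trans (≤-reflexive (target-profit (suc m) m<n))
          (≤-trans (+-monoʳ-≤ _ (≤-trans (sel≤ (S* m) (p m)) (p≤pm m m<n))) (≤-reflexive (cong (_+ pm) (sym (target-profit m (<⇒≤ m<n)))))))

    misses : ℕ → List Bool → Bool
    misses m = all-bad (L * n) (bad-row n L (lam * lam) (gain m)) R

    -- Counting the missed truncations turns the union bound into linearity of expectation.
    failures : List Bool → ℕ
    failures zs = ∑ (suc n) λ m → ind (misses m zs)

    Good : List Bool → Set
    Good zs = failures zs ≡ 0

    rows : List Bool → ℕ → ℕ → ℕ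
    rows zs r = keys n L (λ _ → 0) (row (L * n) r zs)

    good-misses : ∀ zs m → m ≤ n → Good zs → misses m zs ≡ false
    good-misses zs m m≤n good with misses m zs | term≤∑ (suc n) (λ m → ind (misses m zs)) {m} (s≤s m≤n)
    ... | false | _  = refl
    ... | true  | le = contradiction (≤-trans le (≤-reflexive good)) λ ()

    -- Holds for arbitrary keys: a bad row can lose sets but cannot produce an infeasible one.
    rounds-sound : ∀ key G best → best ≤ opt → rounds key G best ≤ opt
    rounds-sound key G best best≤ = fold-inv (λ _ b → b ≤ opt) R best≤ λ r b _ b≤ → scan≤ cells (table (key r) G) b opt b≤ (reach r)
      where
      reach : ∀ r v → 0 < table (key r) G v → v ≤ opt
      reach r v f>0 with Pass.pass-sound (key r) (lo G) (hi G) B (λ _ → 0) (λ _ → refl) v f>0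
      ... | S , prof , light = ≤-trans (≤-reflexive (sym prof)) (optimal S light)

    rounds-hit : ∀ key G best r v → r < R → v < cells → 0 < table (key r) G v → v ≤ rounds key G best
    rounds-hit key G best r v r<R v<M f>0 = go R r<R
      where
      step′ : ℕ → ℕ → ℕ
      step′ b r = scan cells (table (key r) G) b
      go : ∀ K → r < K → v ≤ fold K step′ best
      go (suc K) r<1+K with m≤n⇒m<n∨m≡n r<1+K
      ... | inj₁ (s≤s r<K) = ≤-trans (go K r<K) (scan-mono cells (table (key K) G) _)
      ... | inj₂ refl      = scan-hit cells (table (key K) G) (fold K step′ best) v v<M f>0

    rounds-complete : ∀ zs G best m → Good zs → m ≤ n → G ≤ profit (target m) + 3 * pm → profit (target m) ≤ G + 3 * pm →
                      profit (target m) ≤ rounds (rows zs) G best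
    rounds-complete zs G best m good m≤n G≤ ≤G
      with some-good (L * n) (bad-row n L (lam * lam) (gain m)) R zs (good-misses zs m m≤n good)
    ... | r , r<R , ok = rounds-hit (rows zs) G best r (profit (target m)) r<R
            (s≤s (≤-trans (profit≤U (target m)) (≤-trans (m≤n*m U 5) (m≤m+n (5 * U) Δ))))
            (Pass.pass-complete key (lo G) (hi G) (target m) B key<B (window-lo (gain m) key G bal G≤ ≤G) (window-hi (gain m) key G bal G≤ ≤G)
              (target-light m) (λ _ → 0))
      where
      key = rows zs r
      bal : Balanced n (gain m) key B (L * lam)
      bal = good-row n L lam (gain m) (row (L * n) r zs) ok
      key<B : ∀ j → j < n → key j < B
      key<B j _ = row-keys< (row (L * n) r zs) j

    -- Up to `pm`, `opt` is one of the `x + x + 2` integers from `G` on; this length survives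
    -- rounding in `x / 2`, as `x ≤ 2 (x / 2) + 1`. The first two fields hold on every tape, since
    -- the run must stay within its table and word length even when all rows are bad.
    record Bracketed (zs : List Bool) (x G best : ℕ) : Set where
      field
        best≤opt : best ≤ opt
        G≤opt+pm : G ≤ opt + pm
        opt≤     : Good zs → opt ≤ G + (x + x + 1)
        finished : Good zs → x ≡ 0 → best ≡ opt
    open Bracketed

    -- With `h = x / 2` the bracket has at most `4h + 4` integers, and the guess cuts off the first
    -- `2h + 2`.
    trial : ℕ → ℕ → ℕ
    trial x G = G + (x / 2 + x / 2 + 2)

    advance-cases : ∀ G Gt best → G ≤ Gt →
      (Gt ≤ best + pm × advance G Gt best ≡ Gt) ⊎ (best + pm < Gt × advance G Gt best ≡ G)
    advance-cases G Gt best G≤Gt with best + pm <ᵇ Gt in eq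
    ... | true  = inj₂ (<ᵇ-true⁻¹ eq , trans (cong (G +_) (*-zeroʳ (Gt ∸ G))) (+-identityʳ G))
    ... | false = inj₁ (<ᵇ-false⁻¹ eq , trans (cong (G +_) (*-identityʳ (Gt ∸ G))) (m+[n∸m]≡n G≤Gt))

    -- If `Gt ≤ opt`, a truncation of profit between `Gt - pm` and `Gt` is found on a good tape; so
    -- `best′ + pm < Gt` proves `opt < Gt`. Otherwise `Gt ≤ opt + pm`, since `best′` never exceeds
    -- `opt`.
    bracketed-step : ∀ zs x G best → 0 < x → Bracketed zs x G best →
      let Gt = trial x G; best′ = rounds (rows zs) Gt best in
      Bracketed zs (x / 2) (advance G Gt best′) best′
    bracketed-step zs x G best x>0 br = record
      { best≤opt = sound
      ; G≤opt+pm = G′≤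
      ; opt≤     = opt≤′
      ; finished = fin
      }
      where
      open ≤-Reasoning
      h = x / 2
      Gt = trial x G
      best′ = rounds (rows zs) Gt best
      sound : best′ ≤ opt
      sound = rounds-sound (rows zs) Gt best (best≤opt br)
      cases = advance-cases G Gt best′ (m≤m+n G _)
      G′≤ : advance G Gt best′ ≤ opt + pm
      G′≤ with cases
      ... | inj₁ (le , eq) = ≤-trans (≤-reflexive eq) (≤-trans le (+-monoˡ-≤ pm sound))
      ... | inj₂ (_ , eq)  = ≤-trans (≤-reflexive eq) (G≤opt+pm br)
      pm≤3pm : pm ≤ 3 * pm
      pm≤3pm = m≤n*m pm 3
      opt≤Gt : Good zs → opt ≤ Gt + (h + h + 1)
      opt≤Gt good = begin
        opt                                          ≤⟨ opt≤ br good ⟩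
        G + (x + x + 1)                              ≤⟨ +-monoʳ-≤ G (+-monoˡ-≤ 1 (+-mono-≤ (≤-half x) (≤-half x))) ⟩
        G + ((h + h + 1) + (h + h + 1) + 1)          ≡⟨ e G h ⟩
        G + (h + h + 2) + (h + h + 1)                ∎
        where
        e : ∀ G h → G + ((h + h + 1) + (h + h + 1) + 1) ≡ G + (h + h + 2) + (h + h + 1)
        e = solve-∀
      opt≤′ : Good zs → opt ≤ advance G Gt best′ + (h + h + 1)
      opt≤′ good with cases
      ... | inj₁ (_ , eq) = subst (λ g → opt ≤ g + (h + h + 1)) (sym eq) (opt≤Gt good)
      ... | inj₂ (miss , eq) = subst (λ g → opt ≤ g + (h + h + 1)) (sym eq) (s≤s⁻¹ (subst (opt <_) (e G h) (≰⇒> unreached)))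
        where
        e : ∀ G h → G + (h + h + 2) ≡ 1 + (G + (h + h + 1))
        e = solve-∀
        unreached : ¬ Gt ≤ opt
        unreached Gt≤opt with between Gt Gt≤opt
        ... | m , m≤n , P≤ , ≤P = <⇒≱ miss (≤-trans ≤P (+-monoˡ-≤ pm
              (rounds-complete zs Gt best m good m≤n (≤-trans ≤P (+-monoʳ-≤ _ pm≤3pm)) (≤-trans P≤ (m≤m+n Gt _)))))
      -- At `h = 0` the guess is `G + 2` and within `3 * pm` of `opt` on either side, so its windows
      -- already admit the whole optimal set, which is truncation `n`.
      fin : Good zs → h ≡ 0 → best′ ≡ opt
      fin good h≡0 = ≤-antisym sound (subst (_≤ best′) target-opt
          (rounds-complete zs Gt best n good ≤-refl
            (subst (λ o → Gt ≤ o + 3 * pm) (sym target-opt) Gt≤) (subst (_≤ Gt + 3 * pm) (sym target-opt) (≤-trans (opt≤Gt good) near))))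
        where
        Gt≤ : Gt ≤ opt + 3 * pm
        Gt≤ = begin
          G + (h + h + 2)         ≡⟨ cong (λ h → G + (h + h + 2)) h≡0 ⟩
          G + 2                   ≤⟨ +-mono-≤ (G≤opt+pm br) (*-monoʳ-≤ 2 pm⁺) ⟩
          opt + pm + 2 * pm       ≡⟨ +-assoc opt pm (2 * pm) ⟩
          opt + 3 * pm            ∎
        near : Gt + (h + h + 1) ≤ Gt + 3 * pm
        near = begin
          Gt + (h + h + 1)        ≡⟨ cong (λ h → Gt + (h + h + 1)) h≡0 ⟩
          Gt + 1                  ≤⟨ +-monoʳ-≤ Gt pm⁺ ⟩
          Gt + pm                 ≤⟨ +-monoʳ-≤ Gt pm≤3pm ⟩
          Gt + 3 * pm             ∎

    bracketed-start : ∀ zs → 0 < U → Bracketed zs U 0 0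
    bracketed-start zs U>0 = record
      { best≤opt = z≤n
      ; G≤opt+pm = z≤n
      ; opt≤     = λ _ → ≤-trans (≤-reflexive (sym S*-profit)) (≤-trans (profit≤U S*) (≤-trans (m≤m+n U U) (m≤m+n (U + U) 1)))
      ; finished = λ _ U≡0 → contradiction U≡0 (≢-sym (<⇒≢ U>0))
      }

    -- The factor 5 in `cells`: `2 * U` for `G ≤ opt + pm`, `U` for the two halves of `x`, and
    -- `2 * U` for the summand 2.
    trial≤ : ∀ zs x G best → 0 < U → x ≤ U → Bracketed zs x G best → trial x G ≤ 5 * U
    trial≤ zs x G best U>0 x≤U br = begin
      G + (x / 2 + x / 2 + 2) ≤⟨ +-mono-≤ (≤-trans (G≤opt+pm br) (+-mono-≤ (≤-trans (≤-reflexive (sym S*-profit)) (profit≤U S*)) (pm≤U U>0)))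
                                 (+-mono-≤ (≤-trans (half≤ x) x≤U) (*-monoʳ-≤ 2 U>0)) ⟩
      (U + U) + (U + 2 * U)   ≡⟨ e U ⟩
      5 * U                   ∎
      where
      open ≤-Reasoning
      e : ∀ U → (U + U) + (U + 2 * U) ≡ 5 * U
      e = solve-∀
      pm≤U : 0 < U → pm ≤ U
      pm≤U U>0 = m≤n*m pm n {{m*n≢0⇒m≢0 n {{>-nonZero U>0}}}}

    failures-rare : ∀ M → 2 ^ R * 𝔼 (R * (L * n) + M) failures ≤ suc n * 2 ^ (R * (L * n) + M)
    failures-rare M = begin
      2 ^ R * 𝔼 t failures                                    ≡⟨ cong (2 ^ R *_) (𝔼-∑ t (suc n) (λ m zs → ind (misses m zs))) ⟩
      2 ^ R * ∑ (suc n) (λ m → 𝔼 t (λ zs → ind (misses m zs))) ≡⟨ ∑-*ˡ (suc n) (2 ^ R) _ ⟨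
      ∑ (suc n) (λ m → 2 ^ R * 𝔼 t (λ zs → ind (misses m zs))) ≤⟨ ∑-bound (suc n) (λ m _ → all-bad-rare (L * n) _ (rare m) R M) ⟩
      suc n * 2 ^ t                                            ∎
      where
      open ≤-Reasoning
      t = R * (L * n) + M
      rare : ∀ m → 2 * 𝔼 (L * n) (ind ∘ bad-row n L (lam * lam) (gain m)) ≤ 2 ^ (L * n)
      rare m = bad-row-rare n L (lam * lam) (gain m) big (*-mono-< lam>0 lam>0)
        where
        lam>0 : 0 < lam
        lam>0 = *-mono-< (*-mono-< (≤-trans L⁺ (m≤m+n L L)) B⁺) pm⁺
        gain≤ : ∀ j → j < n → gain m j ≤ pm
        gain≤ j j<n = ≤-trans (sel≤ (target m j) (p j)) (p≤pm j j<n)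
        e₁ : ∀ L B p → 2 * (L * (B * B * (p * p))) * (L * 2) ≡ ((L + L) * B * p) * ((L + L) * B * p)
        e₁ = solve-∀
        big : 2 * (L * ∑ n (λ j → gain m j * gain m j)) ≤ lam * lam
        big = begin
          2 * (L * ∑ n (λ j → gain m j * gain m j)) ≤⟨ *-monoʳ-≤ 2 (*-monoʳ-≤ L (∑-bound n λ j j<n → *-mono-≤ (gain≤ j j<n) (gain≤ j j<n))) ⟩
          2 * (L * (n * (pm * pm)))                 ≤⟨ *-monoʳ-≤ 2 (*-monoʳ-≤ L (*-monoˡ-≤ (pm * pm) n≤B²)) ⟩
          2 * (L * (B * B * (pm * pm)))             ≤⟨ m≤m*n _ (L * 2) {{>-nonZero (*-mono-< L⁺ (s≤s z≤n))}} ⟩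
          2 * (L * (B * B * (pm * pm))) * (L * 2)   ≡⟨ e₁ L B pm ⟩
          lam * lam                                 ∎

-- Total correctness of RAM programs

iterate-+ : ∀ {A : Set} (f : A → A) x m n → iterate f x (m + n) ≡ iterate f (iterate f x m) n
iterate-+ f x zero    n = refl
iterate-+ f x (suc m) n = iterate-+ f (f x) m n

record State : Set where
  constructor state
  field
    regs  : Store
    mem   : Store
    coins : List Bool
open State

infix 4 _▸_
_▸_ : Program → State → Config
p ▸ s = config p (regs s) (mem s) (coins s)

module Hoare (wordLength : ℕ) where
  open WordRAM wordLength

  -- Control statements get a dummy value here; `Basic` excludes them.
  effect : Stmt → State → State
  effect (const x k)     (state r m ω) = state (r [ x ↦ truncate k ]) m ω
  effect (arith x o y z) (state r m ω) = state (r [ x ↦ truncate (⟦ o ⟧ (r y) (r z)) ]) m ω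
  effect (load x a)      (state r m ω) = state (r [ x ↦ m (r a) ]) m ω
  effect (store a x)     (state r m ω) = state r (m [ r a ↦ r x ]) ω
  effect (flip x)        (state r m ω) = state (r [ x ↦ truncate (ind (bit ω 0)) ]) m (drop 1 ω)
  effect (ifnz _ _ _)    s             = s
  effect (while _ _)     s             = s

  Basic : Stmt → Set
  Basic (ifnz _ _ _) = ⊥
  Basic (while _ _)  = ⊥
  Basic _            = ⊤

  truncate-small : ∀ {x} → x < 2 ^ wordLength → truncate x ≡ x
  truncate-small = m<n⇒m%n≡m {{m^n≢0 2 wordLength}}

  step-basic : ∀ i k s → Basic i → step (i ∷ k ▸ s) ≡ (k ▸ effect i s)
  step-basic (const _ _)     k s                   _ = refl
  step-basic (arith _ _ _ _) k s                   _ = refl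
  step-basic (load _ _)      k s                   _ = refl
  step-basic (store _ _)     k s                   _ = refl
  step-basic (flip x)        k (state r m [])      _ =
    cong (λ v → config k (r [ x ↦ v ]) m []) (sym (truncate-small (m^n>0 2 wordLength)))
  step-basic (flip x)        k (state r m (b ∷ ω)) _ = refl

  effects : Program → State → State
  effects []      s = s
  effects (i ∷ p) s = effects p (effect i s)

  Basics : Program → Set
  Basics []      = ⊤
  Basics (i ∷ p) = Basic i × Basics p

  Assertion : Set₁
  Assertion = State → Set

  -- Total correctness with a step bound. The continuation `k` is quantified after `u` and `s′`, so
  -- the run cannot depend on what follows; this makes triples compose.
  Triple : Assertion → Program → ℕ → Assertion → Set
  Triple P p t Q = ∀ s → P s →
    ∃[ u ] ∃[ s′ ] (u ≤ t × Q s′ × (∀ k → iterate step (p ++ k ▸ s) u ≡ (k ▸ s′)))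

  run-effects : ∀ p → Basics p → ∀ k s → iterate step (p ++ k ▸ s) (length p) ≡ (k ▸ effects p s)
  run-effects []      _        k s = refl
  run-effects (i ∷ p) (bi , b) k s =
    trans (cong (λ c → iterate step c (length p)) (step-basic i (p ++ k) s bi)) (run-effects p b k (effect i s))

  -- Registers are numerals, so on a concrete block `effects` computes, and facts about registers
  -- that the block does not write carry over as they stand.
  block : ∀ {P Q} p → Basics p → (∀ s → P s → Q (effects p s)) → Triple P p (length p) Q
  block p b post s Ps = length p , effects p s , ≤-refl , post s Ps , λ k → run-effects p b k s

  conseq : ∀ {P Q R p t u} → t ≤ u → (∀ s → Q s → R s) → Triple P p t Q → Triple P p u R
  conseq t≤u QR tr s Ps with tr s Ps
  ... | v , s′ , v≤t , Qs′ , run = v , s′ , ≤-trans v≤t t≤u , QR s′ Qs′ , run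

  infixr 5 _⨾_
  _⨾_ : ∀ {P Q R p q t u} → Triple P p t Q → Triple Q q u R → Triple P (p ++ q) (t + u) R
  _⨾_ {p = p} {q} tr₁ tr₂ s Ps with tr₁ s Ps
  ... | v₁ , s₁ , v₁≤t , Qs₁ , run₁ with tr₂ s₁ Qs₁
  ...   | v₂ , s₂ , v₂≤u , Rs₂ , run₂ = v₁ + v₂ , s₂ , +-mono-≤ v₁≤t v₂≤u , Rs₂ , λ k → begin
    iterate step ((p ++ q) ++ k ▸ s) (v₁ + v₂)          ≡⟨ cong (λ c → iterate step (c ▸ s) (v₁ + v₂)) (Listₚ.++-assoc p q k) ⟩
    iterate step (p ++ (q ++ k) ▸ s) (v₁ + v₂)          ≡⟨ iterate-+ step _ v₁ v₂ ⟩
    iterate step (iterate step (p ++ (q ++ k) ▸ s) v₁) v₂ ≡⟨ cong (λ c → iterate step c v₂) (run₁ (q ++ k)) ⟩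
    iterate step (q ++ k ▸ s₁) v₂                        ≡⟨ run₂ k ⟩
    (k ▸ s₂)                                             ∎
    where open ≡-Reasoning

  step-exit : ∀ x q k s → regs s x ≡ 0 → step (while x q ∷ k ▸ s) ≡ (k ▸ s)
  step-exit x q k s eq with regs s x
  ... | zero = refl

  step-enter : ∀ x q k s → 0 < regs s x → step (while x q ∷ k ▸ s) ≡ (q ++ while x q ∷ k ▸ s)
  step-enter x q k s x>0 with regs s x
  ... | suc _ = refl

  exit : ∀ {P} x q → (∀ s → P s → regs s x ≡ 0) → Triple P (while x q ∷ []) 1 P
  exit x q zero? s Ps = 1 , s , ≤-refl , Ps , λ k → step-exit x q k s (zero? s Ps)

  enter : ∀ {P Q R} x q {t u} → (∀ s → P s → 0 < regs s x) → Triple P q t Q → Triple Q (while x q ∷ []) u R →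
          Triple P (while x q ∷ []) (suc t + u) R
  enter x q pos? tr₁ tr₂ s Ps with tr₁ s Ps
  ... | v₁ , s₁ , v₁≤t , Qs₁ , run₁ with tr₂ s₁ Qs₁
  ...   | v₂ , s₂ , v₂≤u , Rs₂ , run₂ = suc v₁ + v₂ , s₂ , s≤s (+-mono-≤ v₁≤t v₂≤u) , Rs₂ , λ k → begin
    iterate step (step (while x q ∷ k ▸ s)) (v₁ + v₂)
      ≡⟨ cong (λ c → iterate step c (v₁ + v₂)) (step-enter x q k s (pos? s Ps)) ⟩
    iterate step (q ++ while x q ∷ k ▸ s) (v₁ + v₂)                   ≡⟨ iterate-+ step _ v₁ v₂ ⟩
    iterate step (iterate step (q ++ while x q ∷ k ▸ s) v₁) v₂        ≡⟨ cong (λ c → iterate step c v₂) (run₁ (while x q ∷ k)) ⟩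
    iterate step (while x q ∷ k ▸ s₁) v₂                              ≡⟨ run₂ k ⟩
    (k ▸ s₂)                                                          ∎
    where open ≡-Reasoning

  -- The register counts down while the index of the invariant counts up; the arbitrary start `k`
  -- allows induction on the `j` remaining rounds.
  for-from : ∀ (Inv : ℕ → Assertion) x q (t : ℕ → ℕ) j k →
             (∀ i s → Inv i s → regs s x ≡ (k + j) ∸ i) →
             (∀ i → i < k + j → Triple (Inv i) q (t i) (Inv (suc i))) →
             Triple (Inv k) (while x q ∷ []) (∑ j (λ i → suc (t (k + i))) + 1) (Inv (k + j))
  for-from Inv x q t zero k counter body rewrite +-identityʳ k =
    exit x q (λ s inv → trans (counter k s inv) (n∸n≡0 k))
  for-from Inv x q t (suc j) k counter body =
    conseq (≤-reflexive time) (λ _ inv → inv)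
      (enter x q (λ s inv → subst (0 <_) (sym (trans (counter k s inv) (m+n∸m≡n k (suc j)))) z<s)
        (body k (subst (suc k ≤_) (sym (+-suc k j)) (s≤s (m≤m+n k j))))
        (subst (λ N → Triple (Inv (suc k)) (while x q ∷ []) (∑ j (λ i → suc (t (suc k + i))) + 1) (Inv N)) (sym (+-suc k j))
          (for-from Inv x q t j (suc k)
            (λ i s inv → trans (counter i s inv) (cong (_∸ i) (+-suc k j)))
            (λ i i< → body i (subst (i <_) (sym (+-suc k j)) i<)))))
    where
    open ≡-Reasoning
    time : suc (t k) + (∑ j (λ i → suc (t (suc k + i))) + 1) ≡ ∑ (suc j) (λ i → suc (t (k + i))) + 1
    time = begin
      suc (t k) + (∑ j (λ i → suc (t (suc k + i))) + 1)
        ≡⟨ +-assoc (suc (t k)) _ 1 ⟨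
      suc (t k) + ∑ j (λ i → suc (t (suc k + i))) + 1
        ≡⟨ cong₂ (λ u v → u + v + 1) (cong (suc ∘ t) (sym (+-identityʳ k))) (∑-cong j λ i _ → cong (suc ∘ t) (sym (+-suc k i))) ⟩
      suc (t (k + 0)) + ∑ j (λ i → suc (t (k + suc i))) + 1
        ≡⟨ cong (_+ 1) (∑-front j (λ i → suc (t (k + i)))) ⟨
      ∑ (suc j) (λ i → suc (t (k + i))) + 1 ∎

  for : ∀ (Inv : ℕ → Assertion) x q N (t : ℕ → ℕ) → (∀ i s → Inv i s → regs s x ≡ N ∸ i) →
        (∀ i → i < N → Triple (Inv i) q (t i) (Inv (suc i))) →
        Triple (Inv 0) (while x q ∷ []) (∑ N (λ i → suc (t i)) + 1) (Inv N)
  for Inv x q N t = for-from Inv x q t N 0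

  for′ : ∀ (Inv : ℕ → Assertion) x q N t → (∀ i s → Inv i s → regs s x ≡ N ∸ i) →
         (∀ i → i < N → Triple (Inv i) q t (Inv (suc i))) →
         Triple (Inv 0) (while x q ∷ []) (N * suc t + 1) (Inv N)
  for′ Inv x q N t counter body =
    conseq (≤-reflexive (cong (_+ 1) (∑-const N (suc t)))) (λ _ inv → inv) (for Inv x q N (λ _ → t) counter body)

  -- For loops whose number of rounds is only bounded: the index is fuel, and at `Inv 0` the test
  -- has to fail.
  loop : ∀ (Inv : ℕ → Assertion) x q t N → (∀ s → Inv 0 s → regs s x ≡ 0) →
         (∀ i → Triple (λ s → Inv (suc i) s × 0 < regs s x) q t (Inv i)) →
         Triple (Inv N) (while x q ∷ []) (N * suc t + 1) (λ s → ∃[ i ] Inv i s × regs s x ≡ 0)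
  loop Inv x q t zero    done body =
    conseq ≤-refl (λ s inv → 0 , inv , done s inv) (exit x q done)
  loop Inv x q t (suc N) done body s inv with regs s x in eq
  ... | zero  = 1 , s , m≤n+m 1 (suc N * suc t) , (suc N , inv , eq) , λ k → step-exit x q k s eq
  ... | suc v = conseq (≤-reflexive (sym (+-assoc (suc t) (N * suc t) 1))) (λ _ post → post)
      (enter {λ s → Inv (suc N) s × 0 < regs s x} x q (λ _ → proj₂) (body N) (loop Inv x q t N done body)) s (inv , subst (0 <_) (sym eq) z<s)

-- The program

-- Memory holds the input, then R rows of n keys, then the table.
%best %one %n %W %pm %B %L %R %Δ %cells %keys %table %x %G %Gt %r %row %b %c %lo %hi %i %j %l : Reg
%a %p %w %k %e %t %u %v %zero %two %four : Reg
%best  = 0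
%one   = 1
%n     = 2
%W     = 3
%pm    = 4
%B     = 5
%L     = 6
%R     = 7
%Δ     = 8
%cells = 9
%keys  = 10
%table = 11
%x     = 12
%G     = 13
%Gt    = 14
%r     = 15
%row   = 16
%b     = 17
%c     = 18
%lo    = 19
%hi    = 20
%i     = 21
%j     = 22
%l     = 23
%a     = 24
%p     = 25
%w     = 26
%k     = 27
%e     = 28
%t     = 29
%u     = 30
%v     = 31
-- Never written, so it keeps its initial value 0.
%zero  = 32
%two   = 33
%four  = 34

relax-body : Program
relax-body =
  load %t %v ∷ arith %a sub %v %p ∷ load %a %a ∷ arith %a sub %a %w ∷ arith %a sub %a %t ∷
  arith %t add %t %a ∷ store %v %t ∷ arith %v sub %v %one ∷ arith %u sub %u %one ∷ []

-- Items outside the current bucket get the relaxation count %u = 0.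
item-head item-tail item-body : Program
item-head =
  arith %j sub %n %i ∷ arith %a add %row %j ∷ load %k %a ∷
  arith %t sub %k %c ∷ arith %k sub %c %k ∷ arith %t add %t %k ∷ arith %e sub %one %t ∷
  arith %a add %j %two ∷ load %w %a ∷ arith %a add %a %n ∷ load %p %a ∷
  arith %t sub %lo %p ∷ arith %t add %t %p ∷ arith %u add %hi %one ∷ arith %u sub %u %t ∷ arith %u mul %u %e ∷
  arith %v add %table %hi ∷ []
item-tail = arith %i sub %i %one ∷ []
item-body = item-head ++ (while %u relax-body ∷ []) ++ item-tail

bucket-head bucket-tail bucket-body : Program
bucket-head =
  arith %c sub %B %b ∷ arith %lo mul %c %Gt ∷ arith %hi add %lo %Gt ∷
  arith %lo div %lo %B ∷ arith %lo sub %lo %Δ ∷ arith %hi div %hi %B ∷ arith %hi add %hi %Δ ∷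
  arith %i add %n %zero ∷ []
bucket-tail = arith %b sub %b %one ∷ []
bucket-body = bucket-head ++ (while %i item-body ∷ []) ++ bucket-tail

-- The sweep also writes 0 to every cell it reads, so the next round finds an empty table.
scan-body : Program
scan-body =
  arith %j sub %cells %i ∷ arith %a add %table %j ∷ load %t %a ∷ arith %t lt %zero %t ∷ arith %t mul %t %j ∷
  arith %t sub %t %best ∷ arith %best add %best %t ∷ store %a %zero ∷ arith %i sub %i %one ∷ []

round-head round-mid round-tail round-body : Program
round-head = store %table %W ∷ arith %b add %B %zero ∷ []
round-mid  = arith %i add %cells %zero ∷ []
round-tail = arith %row add %row %n ∷ arith %r sub %r %one ∷ []
round-body = round-head ++ (while %b bucket-body ∷ []) ++ round-mid ++ (while %i scan-body ∷ []) ++ round-tail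

search-head search-tail search-body : Program
search-head =
  arith %x div %x %two ∷ arith %t add %x %x ∷ arith %t add %t %two ∷ arith %Gt add %G %t ∷
  arith %r add %R %zero ∷ arith %row add %keys %zero ∷ []
search-tail =
  arith %t add %best %pm ∷ arith %t lt %t %Gt ∷ arith %t sub %one %t ∷
  arith %u sub %Gt %G ∷ arith %u mul %u %t ∷ arith %G add %G %u ∷ []
search-body = search-head ++ (while %r round-body ∷ []) ++ search-tail

-- `%W` holds one more than the capacity, which is the table entry of the empty set.
Constants : (n W pm B R Δ cells keysAt tableAt : ℕ) → Store → Set
Constants n W pm B R Δ cells keysAt tableAt r =
  r %zero ≡ 0 × r %one ≡ 1 × r %two ≡ 2 × r %n ≡ n × r %W ≡ suc W × r %pm ≡ pm × r %B ≡ B ×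
  r %R ≡ R × r %Δ ≡ Δ × r %cells ≡ cells × r %keys ≡ keysAt × r %table ≡ tableAt

inputs pm-body log-head log-body : Program
inputs =
  const %one 1 ∷ const %two 2 ∷ const %four 4 ∷ load %n %zero ∷ load %W %one ∷ arith %W add %W %one ∷
  arith %i add %n %zero ∷ []
pm-body =
  arith %a add %n %i ∷ arith %a add %a %one ∷ load %p %a ∷ arith %p sub %p %pm ∷ arith %pm add %pm %p ∷
  arith %i sub %i %one ∷ []
log-head = arith %x add %n %zero ∷ const %B 1 ∷ []
log-body = arith %x div %x %four ∷ arith %B add %B %B ∷ arith %L add %L %one ∷ []

-- 2 (c + 1) L rows fail together with probability at most (n + 1)^-(c + 1).
constants : ℕ → Program
constants c =
  const %t (2 * suc c) ∷ arith %R mul %t %L ∷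
  arith %t mul %L %L ∷ arith %t add %t %t ∷ arith %t mul %t %B ∷ const %u 3 ∷ arith %t add %t %u ∷ arith %Δ mul %t %pm ∷
  arith %keys add %n %n ∷ arith %keys add %keys %two ∷ arith %t mul %R %n ∷ arith %table add %keys %t ∷
  arith %x mul %n %pm ∷ const %u 5 ∷ arith %t mul %u %x ∷ arith %t add %t %Δ ∷ arith %cells add %t %one ∷
  arith %r add %R %zero ∷ arith %row add %keys %zero ∷ []

bit-body level-head level-tail level-body row-head row-body : Program
bit-body =
  arith %a add %row %n ∷ arith %a sub %a %i ∷ load %k %a ∷ arith %k add %k %k ∷ flip %t ∷ arith %k add %k %t ∷
  store %a %k ∷ arith %i sub %i %one ∷ []
level-head = arith %i add %n %zero ∷ []
level-tail = arith %l sub %l %one ∷ []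
level-body = level-head ++ (while %i bit-body ∷ []) ++ level-tail
row-head   = arith %l add %L %zero ∷ []
row-body   = row-head ++ (while %l level-body ∷ []) ++ round-tail

solver : ℕ → Program
solver c =
  inputs ++ (while %i pm-body ∷ []) ++ log-head ++ (while %x log-body ∷ []) ++ constants c ++
  (while %r row-body ∷ []) ++ (while %x search-body ∷ [])

-- The middle term is the work of relaxation: `n` items, each relaxed in a single bucket, at 10
-- steps per cell of a window.
round-cost : (n pm B Δ cells : ℕ) → ℕ
round-cost n pm B Δ cells = B * (11 + n * 20) + n * (10 * (5 * B * pm + (Δ + Δ) + 1)) + 10 * cells + 7

search-cost : (R n pm B Δ cells : ℕ) → ℕ
search-cost R n pm B Δ cells = 6 + (R * suc (round-cost n pm B Δ cells) + 1 + 6)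

row-cost : (n L : ℕ) → ℕ
row-cost n L = 1 + (L * suc (1 + (n * 9 + 1 + 1)) + 1 + 2)

preparation-cost : (R n L : ℕ) → ℕ
preparation-cost R n L = 7 + (n * 7 + 1 + (2 + (L * 4 + 1 + (19 + (R * suc (row-cost n L) + 1)))))

solver-cost : (R n pm B L Δ cells T : ℕ) → ℕ
solver-cost R n pm B L Δ cells T = preparation-cost R n L + (T * suc (search-cost R n pm B Δ cells) + 1)

-- Machine arithmetic without overflow

module Bounded (wordLength K : ℕ) (K< : K < 2 ^ wordLength) where
  open WordRAM wordLength
  open Hoare wordLength

  fits : ∀ {x} → x ≤ K → truncate x ≡ x
  fits x≤K = truncate-small (≤-<-trans x≤K K<)

  -- Taking equations for the operands lets the value after an instruction be derived from known
  -- register contents in one step.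
  on-+ : ∀ {y z a b} → y ≡ a → z ≡ b → a + b ≤ K → truncate (y + z) ≡ a + b
  on-+ refl refl = fits

  on-* : ∀ {y z a b} → y ≡ a → z ≡ b → a * b ≤ K → truncate (y * z) ≡ a * b
  on-* refl refl = fits

  on-∸ : ∀ {y z a b} → y ≡ a → z ≡ b → a ≤ K → truncate (y ∸ z) ≡ a ∸ b
  on-∸ {a = a} {b} refl refl a≤K = fits (≤-trans (m∸n≤m a b) a≤K)

  on-/ : ∀ {y z a d} .{{_ : NonZero d}} → y ≡ a → z ≡ d → a ≤ K → truncate (⟦ div ⟧ y z) ≡ a / d
  on-/ {a = a} {suc d} refl refl a≤K = fits (≤-trans (m/n≤m a (suc d)) a≤K)

  on-< : ∀ {y z a b} → y ≡ a → z ≡ b → 1 ≤ K → truncate (if y <ᵇ z then 1 else 0) ≡ ind (a <ᵇ b)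
  on-< {a = a} {b} refl refl 1≤K = fits (≤-trans (sel≤ (a <ᵇ b) 1) 1≤K)

  copy : ∀ {y z a} → y ≡ a → z ≡ 0 → a ≤ K → truncate (y + z) ≡ a
  copy {a = a} y≡a z≡0 a≤K = trans (on-+ y≡a z≡0 (≤-trans (≤-reflexive (+-identityʳ a)) a≤K)) (+-identityʳ a)

  count-down : ∀ {y z N i} → y ≡ N ∸ i → z ≡ 1 → N ≤ K → truncate (y ∸ z) ≡ N ∸ suc i
  count-down {N = N} {i} y≡ z≡ N≤K = trans (on-∸ y≡ z≡ (≤-trans (m∸n≤m N i) N≤K)) (trans (∸-+-assoc N i 1) (cong (N ∸_) (+-comm i 1)))

-- Correctness of the search

-- `m₀` is the memory when the search begins, with the keys already written; `K` bounds every number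
-- that the search computes.
module Execution
  (n : ℕ) (w p : ℕ → ℕ) (W : ℕ) (p⁺ : ∀ j → j < n → 0 < p j)
  (pm : ℕ) (p≤pm : ∀ j → j < n → p j ≤ pm) (pm⁺ : 0 < pm)
  (L : ℕ) (L⁺ : 0 < L) (n≤B² : n ≤ 2 ^ L * 2 ^ L) (R : ℕ) (n⁺ : 0 < n)
  (wordLength K : ℕ) (K< : K < 2 ^ wordLength)
  (keysAt tableAt : ℕ) (items≤ : n + n + 2 ≤ keysAt) (keys≤ : keysAt + R * n ≤ tableAt)
  (table≤ : tableAt + suc (5 * (n * pm) + ((L * L + L * L) * 2 ^ L + 3) * pm) ≤ K)
  (product≤ : 2 ^ L * (5 * (n * pm)) + 5 * (n * pm) ≤ K) (W≤ : suc W ≤ K)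
  (m₀ : Store) (w-at : ∀ j → j < n → m₀ (j + 2) ≡ w j) (p-at : ∀ j → j < n → m₀ (j + 2 + n) ≡ p j)
  (zs : List Bool) (key-at : ∀ r j → r < R → j < n → m₀ (keysAt + r * n + j) ≡ keys n L (λ _ → 0) (row (L * n) r zs) j)
  where

  open DP n w p W p⁺
  open Search n w p W p⁺ pm p≤pm pm⁺ L L⁺ n≤B² R
  open Hoare wordLength
  open Bounded wordLength K K<

  key : ℕ → ℕ → ℕ
  key r = keys n L (λ _ → 0) (row (L * n) r zs)

  key< : ∀ r j → key r j < B
  key< r j = row-keys< (row (L * n) r zs) j

  U⁺ : 0 < U
  U⁺ = *-mono-< n⁺ pm⁺

  tableAt≤K : tableAt ≤ K
  tableAt≤K = m+n≤o⇒m≤o tableAt table≤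

  cells≤K : cells ≤ K
  cells≤K = m+n≤o⇒n≤o tableAt table≤

  5U≤cells : 5 * U ≤ cells
  5U≤cells = ≤-trans (m≤m+n (5 * U) Δ) (n≤1+n _)

  Δ≤cells : Δ ≤ cells
  Δ≤cells = ≤-trans (m≤n+m Δ (5 * U)) (n≤1+n _)

  2≤K : 2 ≤ K
  2≤K = ≤-trans (≤-trans (*-mono-≤ {2} {5} (s≤s (s≤s z≤n)) U⁺) 5U≤cells) cells≤K

  1≤K : 1 ≤ K
  1≤K = <⇒≤ 2≤K

  pm≤Δ : pm ≤ Δ
  pm≤Δ = m≤n*m pm ((L * L + L * L) * B + 3) {{>-nonZero (≤-trans (s≤s z≤n) (m≤n+m 3 ((L * L + L * L) * B)))}}

  2B≤Δ : B + B ≤ Δ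
  2B≤Δ = begin
    B + B                                ≡⟨ e B ⟩
    (1 * 1 + 1 * 1) * B * 1              ≤⟨ *-mono-≤ (*-monoˡ-≤ B (+-mono-≤ (*-mono-≤ L⁺ L⁺) (*-mono-≤ L⁺ L⁺))) pm⁺ ⟩
    (L * L + L * L) * B * pm             ≤⟨ *-monoˡ-≤ pm (m≤m+n ((L * L + L * L) * B) 3) ⟩
    Δ                                    ∎
    where
    open ≤-Reasoning
    e : ∀ B → B + B ≡ (1 * 1 + 1 * 1) * B * 1
    e = solve-∀

  2B≤K : B + B ≤ K
  2B≤K = ≤-trans 2B≤Δ (≤-trans Δ≤cells cells≤K)

  B≤K : B ≤ K
  B≤K = m+n≤o⇒m≤o B 2B≤K

  keysAt≤K : keysAt ≤ K
  keysAt≤K = ≤-trans (m+n≤o⇒m≤o keysAt keys≤) tableAt≤K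

  n≤K : n ≤ K
  n≤K = ≤-trans (m+n≤o⇒m≤o n (m+n≤o⇒m≤o (n + n) items≤)) keysAt≤K

  R≤K : R ≤ K
  R≤K = ≤-trans (m≤m*n R n {{>-nonZero n⁺}}) (≤-trans (m+n≤o⇒n≤o keysAt keys≤) tableAt≤K)

  row≤ : ∀ {r} → r ≤ R → keysAt + r * n ≤ tableAt
  row≤ r≤R = ≤-trans (+-monoʳ-≤ keysAt (*-monoˡ-≤ n r≤R)) keys≤

  key-addr : ∀ {r j} → r < R → j < n → keysAt + r * n + j < tableAt
  key-addr {r} {j} r<R j<n = <-≤-trans (+-monoʳ-< (keysAt + r * n) j<n) (≤-trans (≤-reflexive (e keysAt r n)) (row≤ r<R))
    where
    e : ∀ k r n → k + r * n + n ≡ k + (1 + r) * n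
    e = solve-∀

  p-addr : ∀ {j} → j < n → j + 2 + n < tableAt
  p-addr {j} j<n = <-≤-trans (+-monoˡ-< n (+-monoˡ-< 2 j<n)) (≤-trans (≤-reflexive (e n)) (≤-trans items≤ (m+n≤o⇒m≤o keysAt keys≤)))
    where
    e : ∀ n → n + 2 + n ≡ n + n + 2
    e = solve-∀

  w-addr : ∀ {j} → j < n → j + 2 < tableAt
  w-addr {j} j<n = ≤-<-trans (m≤m+n (j + 2) n) (p-addr j<n)

  module Window (G b : ℕ) (G≤ : G ≤ 5 * U) (b<B : b < B) where
    open ≤-Reasoning

    bG≤ : b * G ≤ B * (5 * U)
    bG≤ = *-mono-≤ (<⇒≤ b<B) G≤

    bG+G≤K : b * G + G ≤ K
    bG+G≤K = ≤-trans (+-mono-≤ bG≤ G≤) product≤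

    next≤ : b * G + G ≤ G * B
    next≤ = begin
      b * G + G   ≡⟨ +-comm (b * G) G ⟩
      suc b * G   ≤⟨ *-monoˡ-≤ G b<B ⟩
      B * G       ≡⟨ *-comm B G ⟩
      G * B       ∎

    hi-quotient≤ : (b * G + G) / B ≤ 5 * U
    hi-quotient≤ = ≤-trans (/-monoˡ-≤ B next≤) (≤-trans (≤-reflexive (m*n/n≡m G B)) G≤)

    lo-quotient≤ : (b * G) / B ≤ 5 * U
    lo-quotient≤ = ≤-trans (/-monoˡ-≤ B (m≤m+n (b * G) G)) hi-quotient≤

    hi<cells : hi G b < cells
    hi<cells = s≤s (+-monoˡ-≤ Δ hi-quotient≤)

    lo+p≤K : ∀ {q} → q ≤ pm → lo G b ∸ q + q ≤ K
    lo+p≤K {q} q≤pm = ≤-trans (+-mono-≤ (≤-trans (m∸n≤m (lo G b) q) (≤-trans (m∸n≤m _ Δ) lo-quotient≤)) (≤-trans q≤pm pm≤Δ))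
                              (≤-trans (n≤1+n _) cells≤K)

  -- Input and keys stay fixed during the search. The bound on the entries keeps arithmetic on table
  -- cells within a word.
  Layout : Store → Store → Set
  Layout f m = (∀ a → a < tableAt → m a ≡ m₀ a) × (∀ v → v < cells → m (tableAt + v) ≡ f v) × (∀ v → f v ≤ suc W)

  store-cell : ∀ {f m v x a y} → Layout f m → v < cells → x ≤ suc W → a ≡ tableAt + v → y ≡ x →
               Layout (f [ v ↦ x ]) (m [ a ↦ y ])
  store-cell {f} {m} {v} {x} (low , tab , small) v< x≤ refl refl = low′ , tab′ , small′
    where
    low′ : ∀ a → a < tableAt → (m [ tableAt + v ↦ x ]) a ≡ m₀ a
    low′ a a< = trans (update-other m x (λ eq → <⇒≱ a< (subst (tableAt ≤_) eq (m≤m+n tableAt v)))) (low a a<)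
    tab′ : ∀ u → u < cells → (m [ tableAt + v ↦ x ]) (tableAt + u) ≡ (f [ v ↦ x ]) u
    tab′ u u< with ≡ᵇ-view v u
    ... | inj₁ (refl , is) rewrite is = update-same m (tableAt + v) x
    ... | inj₂ (v≢u , is) rewrite is = trans (update-other m x (v≢u ∘ +-cancelˡ-≡ tableAt v u)) (tab u u<)
    small′ : ∀ u → (f [ v ↦ x ]) u ≤ suc W
    small′ u with ≡ᵇ-view v u
    ... | inj₁ (_ , is) rewrite is = x≤
    ... | inj₂ (_ , is) rewrite is = small u

  Env : Store → Set
  Env = Constants n W pm B R Δ cells keysAt tableAt

  module Round (x G Gt : ℕ) (Gt≤ : Gt ≤ 5 * U) where

    Searching : Store → Set
    Searching r = Env r × r %x ≡ x × r %G ≡ G × r %Gt ≡ Gt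

    module Item (ρ : ℕ) (ρ<R : ρ < R) (best : ℕ) (best≤ : best ≤ cells) where
      open Pass (key ρ) (lo Gt) (hi Gt)

      item-time : ℕ → ℕ → ℕ
      item-time b i = 17 + (width b i * 10 + 1 + 1)

      bucket-time : ℕ → ℕ
      bucket-time b = 8 + (∑ n (λ i → suc (item-time b i)) + 1 + 1)

      InRound : Store → Set
      InRound r = Searching r × r %r ≡ R ∸ ρ × r %row ≡ keysAt + ρ * n × r %best ≡ best

      module _ (b : ℕ) (b<B : b < B) where
        open Window Gt b Gt≤ b<B

        InBucket : Store → Set
        InBucket r = InRound r × r %b ≡ B ∸ b × r %c ≡ b × r %lo ≡ lo Gt b × r %hi ≡ hi Gt b

        InItem : ℕ → Store → Set
        InItem i r = InBucket r × r %i ≡ n ∸ i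

        module _ (i : ℕ) (i<n : i < n) where

          Relaxing : ℕ → ℕ → Store → State → Set
          Relaxing c v f s = InItem i (regs s) × regs s %p ≡ p i × regs s %w ≡ w i ×
                             regs s %u ≡ c × regs s %v ≡ tableAt + v × Layout f (mem s)

          relax-run : ∀ c v f → p i + c ≤ suc v ⊎ c ≡ 0 → v < cells →
            Triple (Relaxing c v f) (while %u relax-body ∷ []) (c * 10 + 1)
                   (λ s → InItem i (regs s) × Layout (relax c v (p i) (w i) f) (mem s))
          relax-run zero    v f _ v< =
            conseq ≤-refl (λ s (it , _ , _ , _ , _ , lay) → it , lay) (exit %u relax-body (λ s (_ , _ , _ , u≡ , _) → u≡))
          relax-run (suc c) v f (inj₁ fit) v< =
            conseq (≤-reflexive refl) (λ _ post → post)
              (enter %u relax-body (λ s (_ , _ , _ , u≡ , _) → subst (0 <_) (sym u≡) z<s)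
                (block relax-body _ one-step) (relax-run c (v ∸ 1) f′ (inj₁ fit′) (≤-<-trans (m∸n≤m v 1) v<)))
            where
            y = f (v ∸ p i) ∸ w i
            f′ = f [ v ↦ raise (f v) y ]
            p+c≤v : p i + c ≤ v
            p+c≤v = s≤s⁻¹ (subst (_≤ suc v) (+-suc (p i) c) fit)
            p≤v : p i ≤ v
            p≤v = m+n≤o⇒m≤o (p i) p+c≤v
            v>0 : 0 < v
            v>0 = <-≤-trans (p⁺ i i<n) p≤v
            fit′ : p i + c ≤ suc (v ∸ 1)
            fit′ = subst (p i + c ≤_) (sym (m+[n∸m]≡n v>0)) p+c≤v
            one-step : ∀ s → Relaxing (suc c) v f s → Relaxing c (v ∸ 1) f′ (effects relax-body s)
            one-step (state r m ω) (it@((((((z≡ , one≡ , env) , _) , _) , _) , _)) , p≡ , w≡ , u≡ , v≡ , lay@(low , tab , small)) =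
              it , p≡ , w≡ ,
              on-∸ u≡ one≡ c≤K ,
              trans (on-∸ v≡ one≡ v≤K) (+-∸-assoc tableAt v>0) ,
              store-cell lay v< raise≤W v≡ t≡
              where
              v≤K : tableAt + v ≤ K
              v≤K = ≤-trans (+-monoʳ-≤ tableAt (<⇒≤ v<)) table≤
              c≤K : suc c ≤ K
              c≤K = ≤-trans (m+n≤o⇒n≤o (p i) fit) (≤-trans v< cells≤K)
              t₀≡ : m (r %v) ≡ f v
              t₀≡ = trans (cong m v≡) (tab v v<)
              y≤W : y ≤ suc W
              y≤W = ≤-trans (m∸n≤m _ (w i)) (small (v ∸ p i))
              raise≤W : raise (f v) y ≤ suc W
              raise≤W = raise≤ (small v) y≤W
              a₁≡ = trans (on-∸ v≡ p≡ v≤K) (+-∸-assoc tableAt p≤v)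
              a₂≡ = trans (cong m a₁≡) (tab (v ∸ p i) (≤-<-trans (m∸n≤m v (p i)) v<))
              a₃≡ = on-∸ a₂≡ w≡ (≤-trans (small (v ∸ p i)) W≤)
              a₄≡ = on-∸ a₃≡ t₀≡ (≤-trans y≤W W≤)
              t≡ = on-+ t₀≡ a₄≡ (≤-trans raise≤W W≤)

          item-run : ∀ f → Triple (λ s → InItem i (regs s) × Layout f (mem s)) item-body (item-time b i)
                       (λ s → InItem (suc i) (regs s) × Layout (item b f i) (mem s))
          item-run f = block item-head _ first ⨾ relax-run (width b i) (hi Gt b) f (width-fits b i) hi<cells ⨾ block item-tail _ last
            where
            first : ∀ s → InItem i (regs s) × Layout f (mem s) → Relaxing (width b i) (hi Gt b) f (effects item-head s)
            first (state r m ω) (it@((((((z≡ , one≡ , two≡ , n≡ , _ , _ , _ , _ , _ , _ , _ , tb≡) , _) , _ , row≡ , _) , _ , c≡ , lo≡ , hi≡) , i≡)) , lay@(low , tab , small)) =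
              it , p≡ , w≡ , u≡ , on-+ tb≡ hi≡ (≤-trans (+-monoʳ-≤ tableAt (<⇒≤ hi<cells)) table≤) , lay
              where
              -- The counter holds `n ∸ i`, so subtracting it from `n` recovers the index, and items
              -- are visited in increasing order.
              j≡ = trans (on-∸ n≡ i≡ n≤K) (m∸[m∸n]≡n (<⇒≤ i<n))
              a₁≡ = on-+ row≡ j≡ (≤-trans (<⇒≤ (key-addr ρ<R i<n)) tableAt≤K)
              k≡ = trans (cong m a₁≡) (trans (low _ (key-addr ρ<R i<n)) (key-at ρ i ρ<R i<n))
              key≤K : key ρ i ≤ K
              key≤K = ≤-trans (<⇒≤ (key< ρ i)) B≤K
              t₁≡ = on-∸ k≡ c≡ key≤K
              k₁≡ = on-∸ c≡ k≡ (≤-trans (<⇒≤ b<B) B≤K)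
              t₂≡ = on-+ t₁≡ k₁≡ (≤-trans (+-mono-≤ (≤-trans (m∸n≤m (key ρ i) b) (<⇒≤ (key< ρ i))) (≤-trans (m∸n≤m b (key ρ i)) (<⇒≤ b<B))) 2B≤K)
              e≡ = on-∸ one≡ t₂≡ 1≤K
              a₂≡ = on-+ j≡ two≡ (≤-trans (<⇒≤ (w-addr i<n)) tableAt≤K)
              w≡ = trans (cong m a₂≡) (trans (low _ (w-addr i<n)) (w-at i i<n))
              a₃≡ = on-+ a₂≡ n≡ (≤-trans (<⇒≤ (p-addr i<n)) tableAt≤K)
              p≡ = trans (cong m a₃≡) (trans (low _ (p-addr i<n)) (p-at i i<n))
              lo≤K : lo Gt b ≤ K
              lo≤K = ≤-trans (m∸n≤m _ Δ) (≤-trans lo-quotient≤ (≤-trans 5U≤cells cells≤K))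
              t₃≡ = on-+ (on-∸ lo≡ p≡ lo≤K) p≡ (lo+p≤K (p≤pm i i<n))
              hi+1≤K : suc (hi Gt b) ≤ K
              hi+1≤K = ≤-trans hi<cells cells≤K
              u₁≡ = trans (on-+ hi≡ one≡ (≤-trans (≤-reflexive (+-comm (hi Gt b) 1)) hi+1≤K)) (+-comm (hi Gt b) 1)
              u₂≡ = on-∸ u₁≡ t₃≡ hi+1≤K
              u≡ = on-* u₂≡ e≡ (≤-trans (*-mono-≤ (m∸n≤m (suc (hi Gt b)) (lo Gt b ∸ p i + p i)) (m∸n≤m 1 ((key ρ i ∸ b) + (b ∸ key ρ i))))
                                        (≤-trans (≤-reflexive (*-identityʳ (suc (hi Gt b)))) hi+1≤K))
            last : ∀ s → InItem i (regs s) × Layout (item b f i) (mem s) →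
                   InItem (suc i) (regs (effects item-tail s)) × Layout (item b f i) (mem (effects item-tail s))
            last (state r m ω) ((ib@((((z≡ , one≡ , _) , _) , _) , _) , i≡) , lay) =
              (ib , count-down i≡ one≡ n≤K) , lay

        bucket-run : ∀ f → Triple (λ s → (InRound (regs s) × regs s %b ≡ B ∸ b) × Layout f (mem s)) bucket-body (bucket-time b)
                       (λ s → (InRound (regs s) × regs s %b ≡ B ∸ suc b) × Layout (bucket f b) (mem s))
        bucket-run f =
          block bucket-head _ first ⨾
          for (λ i s → InItem i (regs s) × Layout (fold i (item b) f) (mem s)) %i item-body n (item-time b)
              (λ i s ((_ , i≡) , _) → i≡) (λ i i<n → item-run i i<n (fold i (item b) f)) ⨾
          block bucket-tail _ last
          where
          first : ∀ s → (InRound (regs s) × regs s %b ≡ B ∸ b) × Layout f (mem s) →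
                  InItem 0 (regs (effects bucket-head s)) × Layout f (mem (effects bucket-head s))
          first (state r m ω) ((ir@(((z≡ , one≡ , two≡ , n≡ , _ , _ , B≡ , _ , Δ≡′ , _ , _ , _) , _ , _ , Gt≡) , _ , _ , _) , b≡) , lay) =
            ((ir , b≡ , c≡ , lo≡ , hi≡) , copy n≡ z≡ n≤K) , lay
            where
            c≡ = trans (on-∸ B≡ b≡ B≤K) (m∸[m∸n]≡n (<⇒≤ b<B))
            l₁≡ = on-* c≡ Gt≡ (m+n≤o⇒m≤o (b * Gt) bG+G≤K)
            h₁≡ = on-+ l₁≡ Gt≡ bG+G≤K
            lo≡ = on-∸ (on-/ l₁≡ B≡ (m+n≤o⇒m≤o (b * Gt) bG+G≤K)) Δ≡′ (≤-trans lo-quotient≤ (≤-trans 5U≤cells cells≤K))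
            hi≡ = on-+ (on-/ h₁≡ B≡ bG+G≤K) Δ≡′ (≤-trans (<⇒≤ hi<cells) cells≤K)
          last : ∀ s → InItem n (regs s) × Layout (bucket f b) (mem s) →
                 (InRound (regs (effects bucket-tail s)) × regs (effects bucket-tail s) %b ≡ B ∸ suc b) × Layout (bucket f b) (mem (effects bucket-tail s))
          last (state r m ω) (((ir@(((_ , one≡ , _) , _) , _) , b≡ , _) , _) , lay) = (ir , count-down b≡ one≡ B≤K) , lay

      cleared : Store → ℕ → Store
      cleared f k = fold k (λ g v → g [ v ↦ 0 ]) f

      cleared-above : ∀ f k v → k ≤ v → cleared f k v ≡ f v
      cleared-above f zero    v _   = refl
      cleared-above f (suc k) v k<v = trans (update-other (cleared f k) 0 (<⇒≢ k<v)) (cleared-above f k v (<⇒≤ k<v))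

      cleared-below : ∀ f k v → v < k → cleared f k v ≡ 0
      cleared-below f (suc k) v v<1+k with m≤n⇒m<n∨m≡n v<1+k
      ... | inj₁ (s≤s v<k) = trans (update-other (cleared f k) 0 (≢-sym (<⇒≢ v<k))) (cleared-below f k v v<k)
      ... | inj₂ refl      = update-same (cleared f v) v 0

      scan-bounded : ∀ f k → k ≤ cells → scan k f best ≤ cells
      scan-bounded f k k≤ = fold-inv (λ _ b → b ≤ cells) k best≤
        λ v b v<k b≤ → raise≤ {b} b≤ (≤-trans (*-monoˡ-≤ v (sel≤ (0 <ᵇ f v) 1)) (≤-trans (≤-reflexive (*-identityˡ v)) (≤-trans (<⇒≤ v<k) k≤)))

      InScan : Store → ℕ → Store → Set
      InScan f k r = (Searching r × r %r ≡ R ∸ ρ × r %row ≡ keysAt + ρ * n × r %best ≡ scan k f best) × r %i ≡ cells ∸ k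

      scan-run : ∀ f k → k < cells →
        Triple (λ s → InScan f k (regs s) × Layout (cleared f k) (mem s)) scan-body 9
               (λ s → InScan f (suc k) (regs s) × Layout (cleared f (suc k)) (mem s))
      scan-run f k k< = block scan-body _ one-step
        where
        one-step : ∀ s → InScan f k (regs s) × Layout (cleared f k) (mem s) →
                   InScan f (suc k) (regs (effects scan-body s)) × Layout (cleared f (suc k)) (mem (effects scan-body s))
        one-step (state r m ω) ((((sr@((z≡ , one≡ , _ , _ , _ , _ , _ , _ , _ , cells≡ , _ , tb≡) , _)) , r≡ , row≡ , best≡) , i≡) , lay@(low , tab , small)) =
          ((sr , r≡ , row≡ , best′≡) , count-down {i = k} i≡ one≡ cells≤K) ,
          store-cell lay k< z≤n a≡ z≡
          where
          k≤K : k ≤ K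
          k≤K = ≤-trans (<⇒≤ k<) cells≤K
          j≡ = trans (on-∸ cells≡ i≡ cells≤K) (m∸[m∸n]≡n (<⇒≤ k<))
          a≡ = on-+ tb≡ j≡ (≤-trans (+-monoʳ-≤ tableAt (<⇒≤ k<)) table≤)
          t₁≡ = trans (cong m a≡) (trans (tab k k<) (cleared-above f k k ≤-refl))
          t₂≡ = on-< z≡ t₁≡ 1≤K
          value≤ : ind (0 <ᵇ f k) * k ≤ K
          value≤ = ≤-trans (*-monoˡ-≤ k (sel≤ (0 <ᵇ f k) 1)) (≤-trans (≤-reflexive (*-identityˡ k)) k≤K)
          t₃≡ = on-* t₂≡ j≡ value≤
          t₄≡ = on-∸ t₃≡ best≡ value≤
          best′≡ = on-+ best≡ t₄≡ (≤-trans (scan-bounded f (suc k) k<) cells≤K)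

      round-time : ℕ
      round-time = 2 + (∑ B (λ b → suc (bucket-time b)) + 1 + (1 + (cells * 10 + 1 + 2)))

      round-run : Triple (λ s → InRound (regs s) × Layout (λ _ → 0) (mem s)) round-body round-time
                    (λ s → (Searching (regs s) × regs s %r ≡ R ∸ suc ρ × regs s %row ≡ keysAt + suc ρ * n ×
                            regs s %best ≡ scan cells (table (key ρ) Gt) best) × Layout (λ _ → 0) (mem s))
      round-run =
        block round-head _ first ⨾
        for (λ b s → (InRound (regs s) × regs s %b ≡ B ∸ b) × Layout (fold b bucket start₀) (mem s)) %b bucket-body B bucket-time
            (λ b s ((_ , b≡) , _) → b≡) (λ b b<B → bucket-run b b<B (fold b bucket start₀)) ⨾
        block round-mid _ middle ⨾
        for′ (λ k s → InScan F k (regs s) × Layout (cleared F k) (mem s)) %i scan-body cells 9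
            (λ k s ((_ , i≡) , _) → i≡) (scan-run F) ⨾
        block round-tail _ last
        where
        start₀ = start (λ _ → 0)
        F = table (key ρ) Gt
        first : ∀ s → InRound (regs s) × Layout (λ _ → 0) (mem s) →
                (InRound (regs (effects round-head s)) × regs (effects round-head s) %b ≡ B) × Layout start₀ (mem (effects round-head s))
        first (state r m ω) (ir@(((z≡ , _ , _ , _ , W≡ , _ , B≡ , _ , _ , _ , _ , tb≡) , _) , _) , lay) =
          (ir , copy B≡ z≡ B≤K) , store-cell lay (s≤s z≤n) ≤-refl (trans tb≡ (sym (+-identityʳ tableAt))) W≡
        middle : ∀ s → (InRound (regs s) × regs s %b ≡ B ∸ B) × Layout F (mem s) →
                 InScan F 0 (regs (effects round-mid s)) × Layout F (mem (effects round-mid s))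
        middle (state r m ω) (((ir@((z≡ , _ , _ , _ , _ , _ , _ , _ , _ , cells≡ , _) , _) , rest) , _) , lay) =
          ((ir , rest) , copy cells≡ z≡ cells≤K) , lay
        last : ∀ s → InScan F cells (regs s) × Layout (cleared F cells) (mem s) →
               (Searching (regs (effects round-tail s)) × regs (effects round-tail s) %r ≡ R ∸ suc ρ ×
                regs (effects round-tail s) %row ≡ keysAt + suc ρ * n × regs (effects round-tail s) %best ≡ scan cells F best) ×
               Layout (λ _ → 0) (mem (effects round-tail s))
        last (state r m ω) (((sr@((_ , one≡ , _ , n≡ , _) , _) , r≡ , row≡ , best≡) , _) , (low , tab , _)) =
          (sr , count-down r≡ one≡ R≤K , trans (on-+ row≡ n≡ (≤-trans (≤-reflexive (shift keysAt ρ n)) (≤-trans (row≤ ρ<R) tableAt≤K))) (shift keysAt ρ n) , best≡) ,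
          (low , (λ v v< → trans (tab v v<) (cleared-below F cells v v<)) , λ _ → z≤n)
          where
          shift : ∀ k r n → k + r * n + n ≡ k + (1 + r) * n
          shift = solve-∀

      span-max : ℕ
      span-max = 5 * B * pm + (Δ + Δ) + 1

      module _ (b : ℕ) (b<B : b < B) where
        open Window Gt b Gt≤ b<B

        -- From one boundary to the next the prediction moves by `Gt / B`, at most `5 * B * pm`
        -- because `Gt ≤ 5 * n * pm` and `n ≤ B²`; the two `Δ` are the margins.
        span≤ : ∀ q → span (lo Gt b) (hi Gt b) q ≤ span-max
        span≤ q = m≤n+o⇒m∸n≤o (suc (hi Gt b)) (lo Gt b ∸ q + q) (begin
          suc (h + Δ)                               ≤⟨ s≤s (+-monoˡ-≤ Δ (≤-trans h≤ (+-monoˡ-≤ _ (m≤n+m∸n l Δ)))) ⟩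
          suc (Δ + (l ∸ Δ) + 5 * B * pm + Δ)        ≡⟨ e Δ (l ∸ Δ) (5 * B * pm) ⟩
          (l ∸ Δ) + span-max                        ≤⟨ +-monoˡ-≤ span-max (≤-trans (m≤n+m∸n (l ∸ Δ) q) (≤-reflexive (+-comm q _))) ⟩
          ((l ∸ Δ) ∸ q + q) + span-max              ∎)
          where
          open ≤-Reasoning
          l h : ℕ
          l = (b * Gt) / B
          h = (b * Gt + Gt) / B
          e : ∀ d x y → 1 + (d + x + y + d) ≡ x + (y + (d + d) + 1)
          e = solve-∀
          Gt≤′ : Gt ≤ 5 * B * pm * B
          Gt≤′ = ≤-trans Gt≤ (≤-trans (*-monoʳ-≤ 5 (*-monoˡ-≤ pm n≤B²)) (≤-reflexive (e′ B pm)))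
            where
            e′ : ∀ B p → 5 * (B * B * p) ≡ 5 * B * p * B
            e′ = solve-∀
          h≤ : h ≤ l + 5 * B * pm
          h≤ = s≤s⁻¹ (m<n*o⇒m/o<n {o = B} (begin-strict
            b * Gt + Gt                             ≡⟨ cong (_+ Gt) (m≡m%n+[m/n]*n (b * Gt) B) ⟩
            (b * Gt) % B + l * B + Gt               <⟨ +-mono-<-≤ (+-monoˡ-< (l * B) (m%n<n (b * Gt) B)) Gt≤′ ⟩
            B + l * B + 5 * B * pm * B              ≡⟨ e″ B l (5 * B * pm) ⟩
            suc (l + 5 * B * pm) * B                ∎))
            where
            e″ : ∀ B l q → B + l * B + q * B ≡ (1 + (l + q)) * B
            e″ = solve-∀

        -- Relaxations are charged only to the items of this bucket, whereas 20 steps are paid for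
        -- every item in every bucket.
        bucket-time≤ : suc (bucket-time b) ≤ (11 + n * 20) + inside (key ρ) (λ _ → 10 * span-max) b n
        bucket-time≤ = begin
          suc (bucket-time b)                                                ≡⟨ e (∑ n (λ i → suc (item-time b i))) ⟩
          11 + ∑ n (λ i → suc (item-time b i))                               ≤⟨ +-monoʳ-≤ 11 (∑-mono n λ i _ → item≤ i) ⟩
          11 + ∑ n (λ i → 20 + sel (key ρ i ≡ᵇ b) (10 * span-max))           ≡⟨ cong (11 +_) (trans (∑-+ n (λ _ → 20) _) (cong (_+ inside (key ρ) (λ _ → 10 * span-max) b n) (∑-const n 20))) ⟩
          11 + (n * 20 + inside (key ρ) (λ _ → 10 * span-max) b n)           ≡⟨ +-assoc 11 (n * 20) _ ⟨
          (11 + n * 20) + inside (key ρ) (λ _ → 10 * span-max) b n           ∎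
          where
          open ≤-Reasoning
          e : ∀ x → 1 + (8 + (x + 1 + 1)) ≡ 11 + x
          e = solve-∀
          e′ : ∀ x → 1 + (17 + (x * 10 + 1 + 1)) ≡ 20 + 10 * x
          e′ = solve-∀
          item≤ : ∀ i → suc (item-time b i) ≤ 20 + sel (key ρ i ≡ᵇ b) (10 * span-max)
          item≤ i = ≤-trans (≤-reflexive (trans (e′ (width b i)) (cong (λ c → 20 + 10 * c) (width≡ b i)))) (+-monoʳ-≤ 20 (pick (key ρ i ≡ᵇ b)))
            where
            pick : ∀ t → 10 * sel t (span (lo Gt b) (hi Gt b) (p i)) ≤ sel t (10 * span-max)
            pick true  = *-monoʳ-≤ 10 (span≤ (p i))
            pick false = z≤n

      round-time≤ : round-time ≤ round-cost n pm B Δ cells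
      round-time≤ = begin
        2 + (∑ B (λ b → suc (bucket-time b)) + 1 + (1 + (cells * 10 + 1 + 2)))
          ≡⟨ e (∑ B (λ b → suc (bucket-time b))) cells ⟩
        ∑ B (λ b → suc (bucket-time b)) + 10 * cells + 7
          ≤⟨ +-monoˡ-≤ 7 (+-monoˡ-≤ (10 * cells) buckets≤) ⟩
        round-cost n pm B Δ cells ∎
        where
        open ≤-Reasoning
        κ : ℕ → ℕ
        κ _ = 10 * span-max
        e : ∀ x c → 2 + (x + 1 + (1 + (c * 10 + 1 + 2))) ≡ x + 10 * c + 7
        e = solve-∀
        -- An item has only one key, so summing over all buckets charges its window at most once;
        -- `∑-inside` exchanges the sums. Without this the bound would gain a factor `B`.
        buckets≤ : ∑ B (λ b → suc (bucket-time b)) ≤ B * (11 + n * 20) + n * (10 * span-max)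
        buckets≤ = begin
          ∑ B (λ b → suc (bucket-time b))                            ≤⟨ ∑-mono B bucket-time≤ ⟩
          ∑ B (λ b → (11 + n * 20) + inside (key ρ) κ b n)           ≡⟨ ∑-+ B (λ _ → 11 + n * 20) _ ⟩
          ∑ B (λ _ → 11 + n * 20) + ∑ B (λ b → inside (key ρ) κ b n) ≡⟨ cong₂ _+_ (∑-const B _) (∑-inside n (key ρ) κ B) ⟩
          B * (11 + n * 20) + below n (key ρ) κ B                    ≤⟨ +-monoʳ-≤ _ (≤-trans (below≤ n (key ρ) κ B) (≤-reflexive (∑-const n _))) ⟩
          B * (11 + n * 20) + n * (10 * span-max)                    ∎

  module _ (x G Gt : ℕ) (Gt≤ : Gt ≤ 5 * U) (best : ℕ) (best≤ : best ≤ cells) where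
    open Round x G Gt Gt≤

    best-after : ℕ → ℕ
    best-after ρ = fold ρ (λ b r → scan cells (table (key r) Gt) b) best

    best-after≤ : ∀ ρ → ρ ≤ R → best-after ρ ≤ cells
    best-after≤ ρ ρ≤R = fold-inv (λ _ b → b ≤ cells) ρ best≤
      λ r b r<ρ b≤ → Item.scan-bounded r (<-≤-trans r<ρ ρ≤R) b b≤ (table (key r) Gt) cells ≤-refl

    AtRound : ℕ → State → Set
    AtRound ρ s = (Searching (regs s) × regs s %r ≡ R ∸ ρ × regs s %row ≡ keysAt + ρ * n × regs s %best ≡ best-after ρ) ×
                  Layout (λ _ → 0) (mem s)

    rounds-run : Triple (AtRound 0) (while %r round-body ∷ []) (R * suc (round-cost n pm B Δ cells) + 1) (AtRound R)
    rounds-run = for′ AtRound %r round-body R (round-cost n pm B Δ cells) (λ ρ s ((_ , r≡ , _) , _) → r≡)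
      λ ρ ρ<R → conseq (Item.round-time≤ ρ ρ<R (best-after ρ) (best-after≤ ρ (<⇒≤ ρ<R))) (λ _ post → post)
                  (Item.round-run ρ ρ<R (best-after ρ) (best-after≤ ρ (<⇒≤ ρ<R)))

  cost : ℕ
  cost = search-cost R n pm B Δ cells

  AtSearch : ℕ → ℕ → ℕ → State → Set
  AtSearch x G best s = (Env (regs s) × regs s %x ≡ x × regs s %G ≡ G × regs s %best ≡ best) × Layout (λ _ → 0) (mem s)

  advance≤ : ∀ G Gt b → G ≤ Gt → G + (Gt ∸ G) * (1 ∸ b) ≤ Gt
  advance≤ G Gt b G≤Gt = begin
    G + (Gt ∸ G) * (1 ∸ b) ≤⟨ +-monoʳ-≤ G (*-monoʳ-≤ (Gt ∸ G) (m∸n≤m 1 b)) ⟩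
    G + (Gt ∸ G) * 1       ≡⟨ cong (G +_) (*-identityʳ (Gt ∸ G)) ⟩
    G + (Gt ∸ G)           ≡⟨ m+[n∸m]≡n G≤Gt ⟩
    Gt                     ∎
    where open ≤-Reasoning

  module _ (x G best : ℕ) (x≤U : x ≤ U) (best≤ : best ≤ U)
           (Gt≤ : G + (x / 2 + x / 2 + 2) ≤ 5 * U) (best′≤ : rounds key (G + (x / 2 + x / 2 + 2)) best ≤ U) where

    search-run : let Gt = G + (x / 2 + x / 2 + 2); best′ = rounds key Gt best in
                 Triple (AtSearch x G best) search-body cost (AtSearch (x / 2) (advance G Gt best′) best′)
    search-run = block search-head _ first ⨾ rounds-run (x / 2) G Gt Gt≤ best (≤-trans best≤ U≤cells) ⨾ block search-tail _ last
      where
      Gt = G + (x / 2 + x / 2 + 2)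
      best′ = rounds key Gt best
      U≤cells : U ≤ cells
      U≤cells = ≤-trans (m≤n*m U 5) 5U≤cells
      Gt≤K : Gt ≤ K
      Gt≤K = ≤-trans Gt≤ (≤-trans 5U≤cells cells≤K)
      first : ∀ s → AtSearch x G best s → AtRound (x / 2) G Gt Gt≤ best (≤-trans best≤ U≤cells) 0 (effects search-head s)
      first (state r m ω) ((env@(z≡ , one≡ , two≡ , n≡ , _ , _ , _ , R≡ , _ , _ , keys≡ , _) , x≡ , G≡ , best≡) , lay) =
        (((env , x′≡ , G≡ , Gt≡) , copy R≡ z≡ R≤K , trans (copy keys≡ z≡ keysAt≤K) (sym (+-identityʳ keysAt)) , best≡) , lay)
        where
        x′≡ = on-/ x≡ two≡ (≤-trans x≤U (≤-trans U≤cells cells≤K))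
        t₂≤K : x / 2 + x / 2 + 2 ≤ K
        t₂≤K = m+n≤o⇒n≤o G Gt≤K
        t₁≡ = on-+ x′≡ x′≡ (m+n≤o⇒m≤o (x / 2 + x / 2) t₂≤K)
        t₂≡ = on-+ t₁≡ two≡ t₂≤K
        Gt≡ = on-+ G≡ t₂≡ Gt≤K
      last : ∀ s → AtRound (x / 2) G Gt Gt≤ best (≤-trans best≤ U≤cells) R s → AtSearch (x / 2) (advance G Gt best′) best′ (effects search-tail s)
      last (state r m ω) (((env@(z≡ , one≡ , _ , _ , _ , pm≡ , _) , x≡ , G≡ , Gt≡) , _ , _ , best≡) , lay) =
        (env , x≡ , on-+ G≡ u₂≡ (≤-trans (advance≤ G Gt (ind (best′ + pm <ᵇ Gt)) (m≤m+n G _)) Gt≤K) , best≡) , lay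
        where
        t₁≡ = on-+ best≡ pm≡ (≤-trans (+-mono-≤ best′≤ pm≤Δ) (≤-trans (+-monoˡ-≤ Δ (m≤n*m U 5)) (≤-trans (n≤1+n _) cells≤K)))
        t₂≡ = on-< t₁≡ Gt≡ 1≤K
        t₃≡ = on-∸ one≡ t₂≡ 1≤K
        u₁≡ = on-∸ Gt≡ G≡ Gt≤K
        u₂≡ = on-* u₁≡ t₃≡ (≤-trans (*-monoʳ-≤ (Gt ∸ G) (m∸n≤m 1 (ind (best′ + pm <ᵇ Gt)))) (≤-trans (≤-reflexive (*-identityʳ (Gt ∸ G))) (≤-trans (m∸n≤m Gt G) Gt≤K)))

  module _ (opt : ℕ) (S* : ℕ → Bool) (S*-profit : profit S* ≡ opt) (S*-light : weight S* ≤ W)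
           (optimal : ∀ S → weight S ≤ W → profit S ≤ opt) where

    Good* : List Bool → Set
    Good* = Good opt S* S*-profit S*-light optimal

    Bracketed* : ℕ → ℕ → ℕ → Set
    Bracketed* = Bracketed opt S* S*-profit S*-light optimal zs

    -- The bound `x < 2 ^ i` turns the halving of `x` into the fuel of `loop`.
    AtIteration : ℕ → State → Set
    AtIteration i s = ∃[ x ] ∃[ G ] ∃[ best ] (AtSearch x G best s × x < 2 ^ i × x ≤ U × Bracketed* x G best)

    opt≤U : opt ≤ U
    opt≤U = ≤-trans (≤-reflexive (sym S*-profit)) (profit≤U S*)

    iteration-run : ∀ i → Triple (λ s → AtIteration (suc i) s × 0 < regs s %x) search-body cost (AtIteration i)
    iteration-run i s ((x , G , best , at@((_ , x≡ , _) , _) , x< , x≤U , br) , reg>0) =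
      conseq ≤-refl (λ s at′ → x / 2 , advance G Gt best′ , best′ , at′ , half< , ≤-trans (m/n≤m x 2) x≤U , br′)
        (search-run x G best x≤U (≤-trans (Bracketed.best≤opt br) opt≤U)
          (trial≤ opt S* S*-profit S*-light optimal zs x G best U⁺ x≤U br) (≤-trans (Bracketed.best≤opt br′) opt≤U))
        s at
      where
      Gt = G + (x / 2 + x / 2 + 2)
      best′ = rounds key Gt best
      br′ : Bracketed* (x / 2) (advance G Gt best′) best′
      br′ = bracketed-step opt S* S*-profit S*-light optimal zs x G best (subst (0 <_) x≡ reg>0) br
      half< : x / 2 < 2 ^ i
      half< = m<n*o⇒m/o<n (<-≤-trans x< (≤-reflexive (*-comm 2 (2 ^ i))))

    search-loop : ∀ T → U < 2 ^ T →
      Triple (AtSearch U 0 0) (while %x search-body ∷ []) (T * suc cost + 1)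
             (λ s → regs s %best ≤ opt × (Good* zs → regs s %best ≡ opt))
    search-loop T U<2^T s at =
      conseq ≤-refl finish (loop AtIteration %x search-body cost T stop iteration-run) s
        (U , 0 , 0 , at , U<2^T , ≤-refl , bracketed-start opt S* S*-profit S*-light optimal zs U⁺)
      where
      stop : ∀ s → AtIteration 0 s → regs s %x ≡ 0
      stop s (x , _ , _ , ((_ , x≡ , _) , _) , x<1 , _) = trans x≡ (n<1⇒n≡0 x<1)
      finish : ∀ s → (∃[ i ] AtIteration i s × regs s %x ≡ 0) → regs s %best ≤ opt × (Good* zs → regs s %best ≡ opt)
      finish s (i , (x , G , best , ((_ , x≡ , _ , best≡) , _) , _ , _ , br) , reg≡0) =
        ≤-trans (≤-reflexive best≡) (Bracketed.best≤opt br) ,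
        λ good → trans best≡ (Bracketed.finished br good (trans (sym x≡) reg≡0))

-- Correctness of the preparation

-- The number of base 4 digits, so that 2^L is of order √n.
data Log₄ : ℕ → ℕ → Set where
  stop : ∀ {x} → x ≡ 0 → Log₄ 0 x
  next : ∀ {j x} → 0 < x → Log₄ j (x / 4) → Log₄ (suc j) x

log₄ : ∀ fuel x → x ≤ fuel → ∃[ j ] Log₄ j x
log₄ fuel       zero    _ = 0 , stop refl
log₄ (suc fuel) (suc x) (s≤s x≤) with log₄ fuel (suc x / 4) (≤-trans (s≤s⁻¹ (m/n<m (suc x) 4 (s≤s (s≤s z≤n)))) x≤)
... | j , log = suc j , next z<s log

four-powers : ∀ j → 2 ^ suc j * 2 ^ suc j ≡ (2 ^ j * 2 ^ j) * 4
four-powers j = e (2 ^ j)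
  where
  e : ∀ b → 2 * b * (2 * b) ≡ b * b * 4
  e = solve-∀

log₄-upper : ∀ {j x} → Log₄ j x → x < 2 ^ j * 2 ^ j
log₄-upper (stop refl) = s≤s z≤n
log₄-upper {suc j} {x} (next x>0 log) = begin-strict
  x                           ≡⟨ m≡m%n+[m/n]*n x 4 ⟩
  x % 4 + x / 4 * 4           <⟨ +-monoˡ-< _ (m%n<n x 4) ⟩
  suc (x / 4) * 4             ≤⟨ *-monoˡ-≤ 4 (log₄-upper log) ⟩
  (2 ^ j * 2 ^ j) * 4         ≡⟨ four-powers j ⟨
  2 ^ suc j * 2 ^ suc j       ∎
  where open ≤-Reasoning

-- A number with `j` base 4 digits is at least 4^(j-1), because its leading digit is not 0.
log₄-lower : ∀ {j x} → 0 < x → Log₄ j x → 2 ^ j * 2 ^ j ≤ 4 * x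
log₄-lower x>0 (stop refl) = contradiction x>0 λ ()
log₄-lower {suc j} {x} x>0 (next _ log) = begin
  2 ^ suc j * 2 ^ suc j       ≡⟨ four-powers j ⟩
  (2 ^ j * 2 ^ j) * 4         ≤⟨ *-monoˡ-≤ 4 (inner log) ⟩
  x * 4                       ≡⟨ *-comm x 4 ⟩
  4 * x                       ∎
  where
  open ≤-Reasoning
  inner : ∀ {j} → Log₄ j (x / 4) → 2 ^ j * 2 ^ j ≤ x
  inner (stop _) = x>0
  inner log@(next y>0 _) = ≤-trans (log₄-lower y>0 log) (≤-trans (≤-reflexive (*-comm 4 (x / 4))) (m/n*n≤m x 4))

log₄-positive : ∀ {j x} → 0 < x → Log₄ j x → 0 < j
log₄-positive x>0 (stop refl) = contradiction x>0 λ ()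
log₄-positive x>0 (next _ _)  = z<s

bit-take : ∀ n zs j → j < n → bit (take n zs) j ≡ bit zs j
bit-take (suc n) []       j       _         = refl
bit-take (suc n) (z ∷ zs) zero    _         = refl
bit-take (suc n) (z ∷ zs) (suc j) (s≤s j<n) = bit-take n zs j j<n

bit-drop : ∀ zs j → bit (drop j zs) 0 ≡ bit zs j
bit-drop []       zero    = refl
bit-drop []       (suc j) = refl
bit-drop (z ∷ zs) zero    = refl
bit-drop (z ∷ zs) (suc j) = bit-drop zs j

take-take-+ : ∀ m n (zs : List Bool) → take m (take (m + n) zs) ≡ take m zs
take-take-+ zero    n zs       = refl
take-take-+ (suc m) n []       = refl
take-take-+ (suc m) n (z ∷ zs) = cong (z ∷_) (take-take-+ m n zs)

drop-take-+ : ∀ m n (zs : List Bool) → drop m (take (m + n) zs) ≡ take n (drop m zs)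
drop-take-+ zero    n zs       = refl
drop-take-+ (suc m) zero    []       = refl
drop-take-+ (suc m) (suc n) []       = refl
drop-take-+ (suc m) n (z ∷ zs) = drop-take-+ m n zs

-- `row` cuts the tape into blocks while the machine simply reads on; both see the same bits, as
-- `keys` looks only at the first `L * n`.
keys-take : ∀ n L k zs → keys n L k (take (L * n) zs) ≡ keys n L k zs
keys-take n zero    k zs = refl
keys-take n (suc L) k zs =
  trans (cong₂ (λ xs ys → keys n L (refine k xs) ys) (take-take-+ n (L * n) zs) (drop-take-+ n (L * n) zs))
        (keys-take n L (refine k (take n zs)) (drop n zs))

module Preparation
  (c n : ℕ) (w p : ℕ → ℕ) (W : ℕ) (p⁺ : ∀ j → j < n → 0 < p j)
  (pm : ℕ) (p≤pm : ∀ j → j < n → p j ≤ pm) (pm⁺ : 0 < pm) (pm-least : ∀ y → (∀ j → j < n → p j ≤ y) → pm ≤ y)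
  (n⁺ : 0 < n) (L : ℕ) (log : Log₄ L n)
  (wordLength K : ℕ) (K< : K < 2 ^ wordLength)
  (table≤ : n + n + 2 + 2 * suc c * L * n + suc (5 * (n * pm) + ((L * L + L * L) * 2 ^ L + 3) * pm) ≤ K)
  (product≤ : 2 ^ L * (5 * (n * pm)) + 5 * (n * pm) ≤ K) (W≤ : suc W ≤ K)
  (m₀ : Store) (n-at : m₀ 0 ≡ n) (W-at : m₀ 1 ≡ W)
  (w-at : ∀ j → j < n → m₀ (j + 2) ≡ w j) (p-at : ∀ j → j < n → m₀ (j + 2 + n) ≡ p j)
  (blank : ∀ a → n + n + 2 ≤ a → m₀ a ≡ 0) (zs : List Bool)
  where

  L⁺ : 0 < L
  L⁺ = log₄-positive n⁺ log

  n≤B² : n ≤ 2 ^ L * 2 ^ L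
  n≤B² = <⇒≤ (log₄-upper log)

  R keysAt tableAt : ℕ
  R = 2 * suc c * L
  keysAt = n + n + 2
  tableAt = keysAt + R * n

  open DP n w p W p⁺
  open Search n w p W p⁺ pm p≤pm pm⁺ L L⁺ n≤B² R
  open Hoare wordLength
  open Bounded wordLength K K<

  tableAt≤K : tableAt ≤ K
  tableAt≤K = m+n≤o⇒m≤o tableAt table≤

  keysAt≤K : keysAt ≤ K
  keysAt≤K = m+n≤o⇒m≤o keysAt tableAt≤K

  cells≤K : cells ≤ K
  cells≤K = m+n≤o⇒n≤o tableAt table≤

  n+n≤K : n + n ≤ K
  n+n≤K = m+n≤o⇒m≤o (n + n) keysAt≤K

  n≤K : n ≤ K
  n≤K = m+n≤o⇒m≤o n n+n≤K

  Rn≤K : R * n ≤ K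
  Rn≤K = m+n≤o⇒n≤o keysAt tableAt≤K

  R≤K : R ≤ K
  R≤K = ≤-trans (m≤m*n R n {{>-nonZero n⁺}}) Rn≤K

  c≤K : 2 * suc c ≤ K
  c≤K = ≤-trans (m≤m*n (2 * suc c) L {{>-nonZero L⁺}}) R≤K

  Δ≤K : Δ ≤ K
  Δ≤K = m+n≤o⇒n≤o (5 * U) (≤-trans (n≤1+n _) cells≤K)

  B′≤K : (L * L + L * L) * B + 3 ≤ K
  B′≤K = ≤-trans (m≤m*n _ pm {{>-nonZero pm⁺}}) Δ≤K

  LLB≤K : (L * L + L * L) * B ≤ K
  LLB≤K = m+n≤o⇒m≤o _ B′≤K

  LL≤K : L * L + L * L ≤ K
  LL≤K = ≤-trans (m≤m*n _ B {{>-nonZero B⁺}}) LLB≤K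

  L²≤K : L * L ≤ K
  L²≤K = m+n≤o⇒m≤o (L * L) LL≤K

  L≤K : L ≤ K
  L≤K = ≤-trans (m≤m*n L L {{>-nonZero L⁺}}) L²≤K

  B≤K : B ≤ K
  B≤K = ≤-trans (m≤n*m B (L * L + L * L) {{>-nonZero (≤-trans (*-mono-≤ L⁺ L⁺) (m≤m+n (L * L) (L * L)))}}) LLB≤K

  5U+Δ≤K : 5 * U + Δ ≤ K
  5U+Δ≤K = ≤-trans (n≤1+n _) cells≤K

  5U≤K : 5 * U ≤ K
  5U≤K = m+n≤o⇒m≤o (5 * U) 5U+Δ≤K

  5≤K : 5 ≤ K
  5≤K = ≤-trans (*-monoʳ-≤ 5 (*-mono-< n⁺ pm⁺)) 5U≤K

  at-most-5 : ∀ {x} → x ≤ 5 → x ≤ K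
  at-most-5 x≤5 = ≤-trans x≤5 5≤K

  Base : State → Set
  Base s = (regs s %zero ≡ 0 × regs s %one ≡ 1 × regs s %two ≡ 2 × regs s %n ≡ n × regs s %W ≡ suc W ×
            regs s %G ≡ 0 × regs s %best ≡ 0) × mem s ≡ m₀ × coins s ≡ zs

  -- The counter runs down from `n` and serves directly as address offset, so profits are read from
  -- last to first.
  maximum : ℕ → ℕ
  maximum k = fold k (λ y j → raise y (p (n ∸ suc j))) 0

  InMax : ℕ → State → Set
  InMax k s = (Base s × regs s %four ≡ 4 × regs s %L ≡ 0) × regs s %pm ≡ maximum k × regs s %i ≡ n ∸ k

  flipped< : ∀ k → k < n → n ∸ suc k < n
  flipped< k k<n = ∸-monoʳ-< {o = 0} z<s k<n

  maximum≤ : ∀ k → k ≤ n → maximum k ≤ pm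
  maximum≤ k k≤n = fold-inv (λ _ y → y ≤ pm) k z≤n
    λ j y j<k y≤ → raise≤ {y} y≤ (p≤pm _ (flipped< j (<-≤-trans j<k k≤n)))

  maximum-hit : ∀ k j → j < k → p (n ∸ suc j) ≤ maximum k
  maximum-hit (suc k) j j<1+k with m≤n⇒m<n∨m≡n j<1+k
  ... | inj₁ (s≤s j<k) = ≤-trans (maximum-hit k j j<k) (x≤raise (maximum k) _)
  ... | inj₂ refl      = y≤raise (maximum j) _

  flip-flip : ∀ j → j < n → n ∸ suc (n ∸ suc j) ≡ j
  flip-flip j j<n = trans (sym (pred[m∸n]≡m∸[1+n] n (n ∸ suc j))) (cong pred (m∸[m∸n]≡n j<n))

  maximum≡ : maximum n ≡ pm
  maximum≡ = ≤-antisym (maximum≤ n ≤-refl)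
    (pm-least (maximum n) λ j j<n → subst (λ i → p i ≤ maximum n) (flip-flip j j<n) (maximum-hit n (n ∸ suc j) (flipped< j j<n)))

  pm≤K : pm ≤ K
  pm≤K = ≤-trans (≤-trans (m≤n*m pm n {{>-nonZero n⁺}}) (m≤n*m U 5)) 5U≤K

  pm-run : ∀ k → k < n → Triple (InMax k) pm-body 6 (InMax (suc k))
  pm-run k k<n = block pm-body _ one-step
    where
    one-step : ∀ s → InMax k s → InMax (suc k) (effects pm-body s)
    one-step (state r m ω) ((base@((z≡ , one≡ , two≡ , n≡ , _) , refl , _) , rest) , pm≡ , i≡) =
      (base , rest) , on-+ pm≡ p₂≡ (≤-trans (maximum≤ (suc k) k<n) pm≤K) , count-down i≡ one≡ n≤K
      where
      j = n ∸ suc k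
      n∸k : n ∸ k ≡ suc j
      n∸k = sym (trans (cong suc (sym (pred[m∸n]≡m∸[1+n] n k))) (suc-pred (n ∸ k) {{>-nonZero (m<n⇒0<n∸m k<n)}}))
      addr : n + (n ∸ k) + 1 ≡ j + 2 + n
      addr = trans (cong (λ y → n + y + 1) n∸k) (e n j)
        where
        e : ∀ n j → n + (1 + j) + 1 ≡ j + 2 + n
        e = solve-∀
      addr≤ : n + (n ∸ k) + 1 ≤ K
      addr≤ = ≤-trans (+-monoˡ-≤ 1 (+-monoʳ-≤ n (m∸n≤m n k))) (≤-trans (+-monoʳ-≤ (n + n) (s≤s z≤n)) keysAt≤K)
      a₁≡ = on-+ n≡ i≡ (m+n≤o⇒m≤o (n + (n ∸ k)) addr≤)
      a₂≡ = trans (on-+ a₁≡ one≡ addr≤) addr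
      p₁≡ = trans (cong m a₂≡) (p-at j (flipped< k k<n))
      p₂≡ = on-∸ p₁≡ pm≡ (≤-trans (p≤pm j (flipped< k k<n)) pm≤K)

  InLog : ℕ → ℕ → ℕ → State → Set
  InLog x b l s = (Base s × regs s %four ≡ 4 × regs s %pm ≡ pm) × regs s %x ≡ x × regs s %B ≡ b × regs s %L ≡ l

  log-run : ∀ {j} x b l → Log₄ j x → x ≤ K → b * 2 ^ j ≤ K → l + j ≤ K →
            Triple (InLog x b l) (while %x log-body ∷ []) (j * 4 + 1) (InLog 0 (b * 2 ^ j) (l + j))
  log-run x b l (stop refl) x≤ b≤ l≤ =
    conseq ≤-refl (λ s (base , x≡ , b≡ , l≡) → base , x≡ , trans b≡ (sym (*-identityʳ b)) , trans l≡ (sym (+-identityʳ l)))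
      (exit %x log-body λ s (_ , x≡ , _) → x≡)
  log-run {suc j} x b l (next x>0 log) x≤ b≤ l≤ =
    conseq ≤-refl (λ s → subst₂ (λ b l → InLog 0 b l s) shift (sym (+-suc l j)))
      (enter %x log-body (λ s (_ , x≡ , _) → subst (0 <_) (sym x≡) x>0) (block log-body _ one-step)
        (log-run (x / 4) (b + b) (suc l) log (≤-trans (m/n≤m x 4) x≤) (≤-trans (≤-reflexive shift) b≤) (≤-trans (≤-reflexive (sym (+-suc l j))) l≤)))
    where
    shift : (b + b) * 2 ^ j ≡ b * 2 ^ suc j
    shift = e b (2 ^ j)
      where
      e : ∀ b t → (b + b) * t ≡ b * (2 * t)
      e = solve-∀
    one-step : ∀ s → InLog x b l s → InLog (x / 4) (b + b) (suc l) (effects log-body s)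
    one-step (state r m ω) ((base@((z≡ , one≡ , _) , _) , four≡ , pm≡) , x≡ , b≡ , l≡) =
      (base , four≡ , pm≡) , on-/ x≡ four≡ x≤ ,
      on-+ b≡ b≡ (≤-trans (m≤m*n (b + b) (2 ^ j) {{m^n≢0 2 j}}) (≤-trans (≤-reflexive shift) b≤)) ,
      trans (on-+ l≡ one≡ (≤-trans (+-monoʳ-≤ l (s≤s z≤n)) l≤)) (+-comm l 1)

  Fixed : State → Set
  Fixed s = Constants n W pm B R Δ cells keysAt tableAt (regs s) × regs s %L ≡ L × regs s %x ≡ U × regs s %G ≡ 0 × regs s %best ≡ 0

  constants-run : Triple (InLog 0 B L) (constants c) 19
    (λ s → (Fixed s × regs s %r ≡ R × regs s %row ≡ keysAt) × mem s ≡ m₀ × coins s ≡ zs)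
  constants-run = block (constants c) _ post
    where
    post : ∀ s → InLog 0 B L s → let s′ = effects (constants c) s in
           (Fixed s′ × regs s′ %r ≡ R × regs s′ %row ≡ keysAt) × mem s′ ≡ m₀ × coins s′ ≡ zs
    post (state r m ω) ((((z≡ , one≡ , two≡ , n≡ , W≡ , G≡ , best≡) , m≡ , ω≡) , four≡ , pm≡) , x≡ , B≡ , L≡) =
      ((((z≡ , one≡ , two≡ , n≡ , W≡ , pm≡ , B≡ , R≡ , Δ≡′ , cells≡ , keys≡ , table≡) , L≡ , x′≡ , G≡ , best≡) , copy R≡ z≡ R≤K , copy keys≡ z≡ keysAt≤K) , m≡ , ω≡)
      where
      R≡ = on-* (fits c≤K) L≡ R≤K
      t₁≡ = on-* L≡ L≡ L²≤K
      t₂≡ = on-+ t₁≡ t₁≡ LL≤K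
      t₃≡ = on-* t₂≡ B≡ LLB≤K
      t₄≡ = on-+ t₃≡ (fits (at-most-5 (s≤s (s≤s (s≤s z≤n))))) B′≤K
      Δ≡′ = on-* t₄≡ pm≡ Δ≤K
      keys≡ = on-+ (on-+ n≡ n≡ n+n≤K) two≡ keysAt≤K
      t₅≡ = on-* R≡ n≡ Rn≤K
      table≡ = on-+ keys≡ t₅≡ tableAt≤K
      x′≡ = on-* n≡ pm≡ (≤-trans (m≤n*m U 5) 5U≤K)
      t₆≡ = on-* (fits 5≤K) x′≡ 5U≤K
      t₇≡ = on-+ t₆≡ Δ≡′ 5U+Δ≤K
      cells≡ = trans (on-+ t₇≡ one≡ (≤-trans (≤-reflexive (+-comm _ 1)) cells≤K)) (+-comm _ 1)

  module Row (ρ : ℕ) (ρ<R : ρ < R) (m₁ : Store) where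

    base : ℕ
    base = keysAt + ρ * n

    row-end : base + n ≤ tableAt
    row-end = ≤-trans (≤-reflexive (e keysAt ρ n)) (+-monoʳ-≤ keysAt (*-monoˡ-≤ n ρ<R))
      where
      e : ∀ k r n → k + r * n + n ≡ k + (1 + r) * n
      e = solve-∀

    Outside : Store → Set
    Outside m = ∀ a → a < base ⊎ base + n ≤ a → m a ≡ m₁ a

    InRow : ℕ → State → Set
    InRow ℓ s = Fixed s × regs s %r ≡ R ∸ ρ × regs s %row ≡ base × regs s %l ≡ ℓ

    AtLevel : ℕ → (ℕ → ℕ) → List Bool → State → Set
    AtLevel ℓ k ys s = InRow ℓ s × (Outside (mem s) × (∀ j → j < n → mem s (base + j) ≡ k j)) × coins s ≡ ys

    AtBit : ℕ → (ℕ → ℕ) → List Bool → ℕ → State → Set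
    AtBit ℓ k ys j s =
      InRow ℓ s × regs s %i ≡ n ∸ j ×
      (Outside (mem s) × (∀ i → i < j → mem s (base + i) ≡ refine k (take n ys) i) × (∀ i → j ≤ i → i < n → mem s (base + i) ≡ k i)) ×
      coins s ≡ drop j ys

    refine-bound : ∀ k b ys → (∀ j → k j < b) → ∀ j → refine k (take n ys) j < b + b
    refine-bound k b ys k<b j = subst (refine k (take n ys) j <_) (double b) (keys< n 1 k b ys k<b j)

    bit-run : ∀ ℓ k b ys → (∀ j → k j < b) → b + b ≤ K → ∀ j → j < n →
              Triple (AtBit ℓ k ys j) bit-body 8 (AtBit ℓ k ys (suc j))
    bit-run ℓ k b ys k<b 2b≤K j j<n = block bit-body _ one-step
      where
      value = refine k (take n ys) j
      one-step : ∀ s → AtBit ℓ k ys j s → AtBit ℓ k ys (suc j) (effects bit-body s)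
      one-step (state r m ω) (ir@(((z≡ , one≡ , _ , n≡ , _) , _) , _ , row≡ , _) , i≡ , (out , before , after) , ω≡) =
        ir , count-down i≡ one≡ n≤K , (out′ , before′ , after′) ,
        trans (cong (drop 1) ω≡) (trans (Listₚ.drop-drop j 1 ys) (cong (λ q → drop q ys) (+-comm j 1)))
        where
        a₁≡ = on-+ row≡ n≡ (≤-trans row-end tableAt≤K)
        a₂≡ = trans (on-∸ a₁≡ i≡ (≤-trans row-end tableAt≤K)) (trans (+-∸-assoc base (m∸n≤m n j)) (cong (base +_) (m∸[m∸n]≡n (<⇒≤ j<n))))
        k≡ = trans (cong m a₂≡) (after j ≤-refl j<n)
        value≤K : value ≤ K
        value≤K = ≤-trans (<⇒≤ (refine-bound k b ys k<b j)) 2b≤K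
        k₂≡ = on-+ k≡ k≡ (m+n≤o⇒m≤o (k j + k j) value≤K)
        flip≡ : ind (bit ω 0) ≡ ind (bit (take n ys) j)
        flip≡ = cong ind (trans (cong (λ q → bit q 0) ω≡) (trans (bit-drop ys j) (sym (bit-take n ys j j<n))))
        t≡ = trans (fits (≤-trans (sel≤ (bit ω 0) 1) (at-most-5 (s≤s z≤n)))) flip≡
        k₃≡ = on-+ k₂≡ t≡ value≤K
        m′ = mem (effects bit-body (state r m ω))
        written : ∀ a → m′ a ≡ (m [ base + j ↦ value ]) a
        written a = cong₂ (λ u v → (m [ u ↦ v ]) a) a₂≡ k₃≡
        out′ : Outside m′
        out′ a far = trans (written a) (trans (update-other m value (apart far)) (out a far))
          where
          apart : a < base ⊎ base + n ≤ a → base + j ≢ a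
          apart (inj₁ a<) eq = <⇒≱ a< (subst (base ≤_) eq (m≤m+n base j))
          apart (inj₂ a≥) eq = <⇒≱ (+-monoʳ-< base j<n) (subst (base + n ≤_) (sym eq) a≥)
        before′ : ∀ i → i < suc j → m′ (base + i) ≡ refine k (take n ys) i
        before′ i i<1+j with m≤n⇒m<n∨m≡n i<1+j
        ... | inj₁ (s≤s i<j) = trans (written (base + i)) (trans (update-other m value (λ eq → <⇒≢ i<j (sym (+-cancelˡ-≡ base j i eq)))) (before i i<j))
        ... | inj₂ refl      = trans (written (base + i)) (update-same m (base + i) value)
        after′ : ∀ i → suc j ≤ i → i < n → m′ (base + i) ≡ k i
        after′ i j<i i<n = trans (written (base + i)) (trans (update-other m value (λ eq → <⇒≢ j<i (+-cancelˡ-≡ base j i eq))) (after i (<⇒≤ j<i) i<n))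

    level-time : ℕ
    level-time = 1 + (n * 9 + 1 + 1)

    level-run : ∀ ℓ k b ys → (∀ j → k j < b) → b * 2 ^ ℓ ≤ K → ℓ ≤ L →
                Triple (AtLevel ℓ k ys) (while %l level-body ∷ []) (ℓ * suc level-time + 1) (AtLevel 0 (keys n ℓ k ys) (drop (ℓ * n) ys))
    level-run zero    k b ys k<b b≤ ℓ≤L = exit %l level-body λ s ((_ , _ , _ , l≡) , _) → l≡
    level-run (suc ℓ) k b ys k<b b≤ ℓ≤L =
      conseq (≤-reflexive (sym (+-assoc (suc level-time) (ℓ * suc level-time) 1)))
        (λ s (ir , mems , ω≡) → ir , mems , trans ω≡ (Listₚ.drop-drop n (ℓ * n) ys))
        (enter %l level-body (λ s ((_ , _ , _ , l≡) , _) → subst (0 <_) (sym l≡) z<s)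
          (block level-head _ first ⨾
           for′ (AtBit (suc ℓ) k ys) %i bit-body n 8 (λ j s (_ , i≡ , _) → i≡) (bit-run (suc ℓ) k b ys k<b 2b≤K) ⨾
           block level-tail _ last)
          (level-run ℓ (refine k (take n ys)) (b + b) (drop n ys) (refine-bound k b ys k<b) (≤-trans (≤-reflexive shift) b≤) (<⇒≤ ℓ≤L)))
      where
      shift : (b + b) * 2 ^ ℓ ≡ b * 2 ^ suc ℓ
      shift = e b (2 ^ ℓ)
        where
        e : ∀ b t → (b + b) * t ≡ b * (2 * t)
        e = solve-∀
      2b≤K : b + b ≤ K
      2b≤K = ≤-trans (m≤m*n (b + b) (2 ^ ℓ) {{m^n≢0 2 ℓ}}) (≤-trans (≤-reflexive shift) b≤)
      first : ∀ s → AtLevel (suc ℓ) k ys s → AtBit (suc ℓ) k ys 0 (effects level-head s)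
      first (state r m ω) (ir@(((z≡ , _ , _ , n≡ , _) , _) , _) , (out , vals) , ω≡) =
        ir , copy n≡ z≡ n≤K , (out , (λ i ()) , (λ i _ → vals i)) , ω≡
      last : ∀ s → AtBit (suc ℓ) k ys n s → AtLevel ℓ (refine k (take n ys)) (drop n ys) (effects level-tail s)
      last (state r m ω) ((fx@((_ , one≡ , _) , _) , r≡ , row≡ , l≡) , _ , (out , before , _) , ω≡) =
        (fx , r≡ , row≡ , on-∸ l≡ one≡ (≤-trans ℓ≤L L≤K)) , (out , before) , ω≡

  -- Memory beyond the input is blank. The last clause preserves this: each new row of keys starts
  -- from 0, and after `R` rows the table is empty.
  Filled : ℕ → Store → Set
  Filled ρ m = (∀ a → a < keysAt → m a ≡ m₀ a) ×
               (∀ r j → r < ρ → j < n → m (keysAt + r * n + j) ≡ keys n L (λ _ → 0) (row (L * n) r zs) j) ×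
               (∀ a → keysAt + ρ * n ≤ a → m a ≡ 0)

  AtRow : ℕ → State → Set
  AtRow ρ s = (Fixed s × regs s %r ≡ R ∸ ρ × regs s %row ≡ keysAt + ρ * n) × Filled ρ (mem s) × coins s ≡ drop (ρ * (L * n)) zs

  -- The initial state is fixed before the triples are composed, so that `mem s₀` can serve as the
  -- reference memory of `Outside`.
  row-run : ∀ ρ → ρ < R → Triple (AtRow ρ) row-body (row-cost n L) (AtRow (suc ρ))
  row-run ρ ρ<R s₀ at@((fx₀ , r₀≡ , row₀≡) , (inp , done , fresh) , ω₀≡) = (block row-head _ first ⨾ level-run L (λ _ → 0) 1 ys (λ _ → s≤s z≤n) (≤-trans (≤-reflexive (*-identityˡ B)) B≤K) ≤-refl ⨾ block round-tail _ last) s₀ (at , refl)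
    where
    open Row ρ ρ<R (mem s₀)
    ys = drop (ρ * (L * n)) zs
    first : ∀ s → AtRow ρ s × mem s ≡ mem s₀ → AtLevel L (λ _ → 0) ys (effects row-head s)
    first (state r m ω) (((fx@((z≡ , _) , L≡ , _) , r≡ , row≡) , _ , ω≡) , m≡) =
      (fx , r≡ , row≡ , copy L≡ z≡ L≤K) ,
      ((λ a _ → cong (λ f → f a) m≡) , λ j j<n → trans (cong (λ f → f (base + j)) m≡) (fresh (base + j) (m≤m+n base j))) , ω≡
    last : ∀ s → AtLevel 0 (keys n L (λ _ → 0) ys) (drop (L * n) ys) s → AtRow (suc ρ) (effects round-tail s)
    last (state r m ω) ((fx@((_ , one≡ , _ , n≡ , _) , _) , r≡ , row≡ , _) , (out , vals) , ω≡) =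
      (fx , count-down r≡ one≡ R≤K , trans (on-+ row≡ n≡ (≤-trans row-end tableAt≤K)) (shift keysAt ρ n)) ,
      (inp′ , done′ , fresh′) ,
      trans ω≡ (trans (Listₚ.drop-drop (ρ * (L * n)) (L * n) zs) (cong (λ q → drop q zs) (+-comm (ρ * (L * n)) (L * n))))
      where
      shift : ∀ k r n → k + r * n + n ≡ k + (1 + r) * n
      shift = solve-∀
      inp′ : ∀ a → a < keysAt → m a ≡ m₀ a
      inp′ a a< = trans (out a (inj₁ (<-≤-trans a< (m≤m+n keysAt (ρ * n))))) (inp a a<)
      done′ : ∀ r j → r < suc ρ → j < n → m (keysAt + r * n + j) ≡ keys n L (λ _ → 0) (row (L * n) r zs) j
      done′ r j r<1+ρ j<n with m≤n⇒m<n∨m≡n r<1+ρ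
      ... | inj₂ refl = trans (vals j j<n) (cong (λ f → f j) (sym (keys-take n L (λ _ → 0) ys)))
      ... | inj₁ (s≤s r<ρ) = trans (out _ (inj₁ early)) (done r j r<ρ j<n)
        where
        early : keysAt + r * n + j < base
        early = <-≤-trans (+-monoʳ-< (keysAt + r * n) j<n) (≤-trans (≤-reflexive (shift keysAt r n)) (+-monoʳ-≤ keysAt (*-monoˡ-≤ n r<ρ)))
      fresh′ : ∀ a → keysAt + suc ρ * n ≤ a → m a ≡ 0
      fresh′ a a≥ = trans (out a (inj₂ (≤-trans (≤-reflexive (shift keysAt ρ n)) a≥)))
                          (fresh a (≤-trans (+-monoʳ-≤ keysAt (m≤n+m (ρ * n) n)) a≥))

  module _ (opt : ℕ) (S* : ℕ → Bool) (S*-profit : profit S* ≡ opt) (S*-light : weight S* ≤ W)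
           (optimal : ∀ S → weight S ≤ W → profit S ≤ opt) where

    Solved : State → Set
    Solved s = regs s %best ≤ opt × (Good opt S* S*-profit S*-light optimal zs → regs s %best ≡ opt)

    solver-run : ∀ T → U < 2 ^ T →
      Triple (λ s → (∀ x → regs s x ≡ 0) × mem s ≡ m₀ × coins s ≡ zs) (solver c) (solver-cost R n pm B L Δ cells T) Solved
    solver-run T U<2^T =
      conseq (≤-reflexive (regroup 7 (n * 7 + 1) 2 (L * 4 + 1) 19 (R * suc (row-cost n L) + 1) _)) (λ _ post → post)
        (block inputs _ first ⨾
         for′ InMax %i pm-body n 6 (λ k s (_ , _ , i≡) → i≡) pm-run ⨾
         block log-head _ second ⨾
         conseq ≤-refl (λ s → subst (λ b → InLog 0 b L s) (*-identityˡ B))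
           (log-run n 1 0 log n≤K (≤-trans (≤-reflexive (*-identityˡ B)) B≤K) L≤K) ⨾
         conseq ≤-refl third constants-run ⨾
         for′ AtRow %r row-body R (row-cost n L) (λ ρ s ((_ , r≡ , _) , _) → r≡) row-run ⨾
         search)
      where
      regroup : ∀ a b c d e f g → a + (b + (c + (d + (e + (f + g))))) ≡ a + (b + (c + (d + (e + f)))) + g
      regroup = solve-∀
      first : ∀ s → (∀ x → regs s x ≡ 0) × mem s ≡ m₀ × coins s ≡ zs → InMax 0 (effects inputs s)
      first (state r m ω) (zero≡ , refl , ω≡) =
        (((zero≡ %zero , fits 1≤K , fits (at-most-5 (s≤s (s≤s z≤n))) , n≡ , W≡ , zero≡ %G , zero≡ %best) , refl , ω≡) ,
         fits (at-most-5 (s≤s (s≤s (s≤s (s≤s z≤n))))) , zero≡ %L) , zero≡ %pm , copy n≡ (zero≡ %zero) n≤K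
        where
        1≤K : 1 ≤ K
        1≤K = at-most-5 (s≤s z≤n)
        n≡ = trans (cong m (zero≡ %zero)) n-at
        W≡ = trans (on-+ (trans (cong m (fits 1≤K)) W-at) (fits 1≤K) (≤-trans (≤-reflexive (+-comm W 1)) W≤)) (+-comm W 1)
      second : ∀ s → InMax n s → InLog n 1 0 (effects log-head s)
      second (state r m ω) ((base@((z≡ , _ , _ , n≡ , _) , _) , four≡ , L≡) , pm≡ , _) =
        (base , four≡ , trans pm≡ maximum≡) , copy n≡ z≡ n≤K , fits (at-most-5 (s≤s z≤n)) , L≡
      third : ∀ s → (Fixed s × regs s %r ≡ R × regs s %row ≡ keysAt) × mem s ≡ m₀ × coins s ≡ zs → AtRow 0 s
      third s ((fx , r≡ , row≡) , m≡ , ω≡) =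
        (fx , r≡ , trans row≡ (sym (+-identityʳ keysAt))) ,
        ((λ a _ → cong (λ f → f a) m≡) , (λ r j ()) ,
         λ a a≥ → trans (cong (λ f → f a) m≡) (blank a (≤-trans (≤-reflexive (sym (+-identityʳ keysAt))) a≥))) , ω≡
      search : Triple (AtRow R) (while %x search-body ∷ []) _ Solved
      search s (((env , _ , x≡ , G≡ , best≡) , _) , (inp , filled , fresh) , _) =
        Execution.search-loop n w p W p⁺ pm p≤pm pm⁺ L L⁺ n≤B² R n⁺ wordLength K K< keysAt tableAt ≤-refl ≤-refl table≤ product≤ W≤
          (mem s)
          (λ j j<n → trans (inp (j + 2) (≤-<-trans (m≤m+n (j + 2) n) (item-addr j<n))) (w-at j j<n))
          (λ j j<n → trans (inp (j + 2 + n) (item-addr j<n)) (p-at j j<n))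
          zs filled opt S* S*-profit S*-light optimal T U<2^T s
          ((env , x≡ , G≡ , best≡) , (λ a _ → refl) , (λ v v< → fresh (tableAt + v) (m≤m+n tableAt v)) , (λ v → z≤n))
        where
        item-addr : ∀ {j} → j < n → j + 2 + n < keysAt
        item-addr {j} j<n = <-≤-trans (+-monoˡ-< n (+-monoˡ-< 2 j<n)) (≤-reflexive (e n))
          where
          e : ∀ n → n + 2 + n ≡ n + n + 2
          e = solve-∀

-- Knapsack instances

nth : List ℕ → ℕ → ℕ
nth []       _       = 0
nth (x ∷ xs) zero    = x
nth (x ∷ xs) (suc j) = nth xs j

entry : ∀ {n} → Vec ℕ n → ℕ → ℕ
entry xs = nth (toList xs)

nth-++ˡ : ∀ {n} (xs : Vec ℕ n) ys j → j < n → nth (toList xs ++ ys) j ≡ entry xs j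
nth-++ˡ (x Vec.∷ xs) ys zero    _         = refl
nth-++ˡ (x Vec.∷ xs) ys (suc j) (s≤s j<n) = nth-++ˡ xs ys j j<n

nth-++ʳ : ∀ {n} (xs : Vec ℕ n) ys j → nth (toList xs ++ ys) (n + j) ≡ nth ys j
nth-++ʳ Vec.[]       ys j = refl
nth-++ʳ (x Vec.∷ xs) ys j = nth-++ʳ xs ys j

entry-beyond : ∀ {n} (xs : Vec ℕ n) j → n ≤ j → entry xs j ≡ 0
entry-beyond Vec.[]       j       _         = refl
entry-beyond (x Vec.∷ xs) (suc j) (s≤s n≤j) = entry-beyond xs j n≤j

entry⁺ : ∀ {n} {xs : Vec ℕ n} → VecAll.All (0 <_) xs → ∀ j → j < n → 0 < entry xs j
entry⁺ (x>0 VecAll.∷ _)  zero    _         = x>0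
entry⁺ (_ VecAll.∷ xs>0) (suc j) (s≤s j<n) = entry⁺ xs>0 j j<n

entry≤max : ∀ {n} (xs : Vec ℕ n) j → j < n → entry xs j ≤ max 0 (toList xs)
entry≤max xs j j<n = go xs j j<n (xs≤max 0 (toList xs))
  where
  go : ∀ {n b} (xs : Vec ℕ n) j → j < n → All.All (_≤ b) (toList xs) → entry xs j ≤ b
  go (x Vec.∷ xs) zero    _         (x≤ All.∷ _)  = x≤
  go (x Vec.∷ xs) (suc j) (s≤s j<n) (_ All.∷ xs≤) = go xs j j<n xs≤

max-least : ∀ {n} (xs : Vec ℕ n) b → (∀ j → j < n → entry xs j ≤ b) → max 0 (toList xs) ≤ b
max-least xs b le = max≤v⁺ z≤n (go xs le)
  where
  go : ∀ {n} (xs : Vec ℕ n) → (∀ j → j < n → entry xs j ≤ b) → All.All (_≤ b) (toList xs)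
  go Vec.[]       _  = All.[]
  go (x Vec.∷ xs) le = le 0 z<s All.∷ go xs λ j j<n → le (suc j) (s≤s j<n)

sumOver-∑ : ∀ {n} (S : Vec Bool n) xs → sumOver S xs ≡ ∑ n (λ j → sel (bit (toList S) j) (entry xs j))
sumOver-∑ Vec.[]       Vec.[]       = refl
sumOver-∑ {suc n} (b Vec.∷ S) (x Vec.∷ xs) =
  trans (cong (sel b x +_) (sumOver-∑ S xs)) (sym (∑-front n λ j → sel (bit (b ∷ toList S) j) (entry (x Vec.∷ xs) j)))

indicator : ∀ n → (ℕ → Bool) → Vec Bool n
indicator zero    S = Vec.[]
indicator (suc n) S = S 0 Vec.∷ indicator n (S ∘ suc)

sumOver-indicator : ∀ {n} (S : ℕ → Bool) (xs : Vec ℕ n) → sumOver (indicator n S) xs ≡ ∑ n (λ j → sel (S j) (entry xs j))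
sumOver-indicator S Vec.[]       = refl
sumOver-indicator {suc n} S (x Vec.∷ xs) =
  trans (cong (sel (S 0) x +_) (sumOver-indicator (S ∘ suc) xs)) (sym (∑-front n λ j → sel (S j) (entry (x Vec.∷ xs) j)))

∈-bitVectors : ∀ {n} (S : Vec Bool n) → S ∈ bitVectors n
∈-bitVectors Vec.[]                = here refl
∈-bitVectors {suc n} (false Vec.∷ S) = ∈-++⁺ˡ (∈-map⁺ (false Vec.∷_) (∈-bitVectors S))
∈-bitVectors {suc n} (true Vec.∷ S)  = ∈-++⁺ʳ (map (false Vec.∷_) (bitVectors n)) (∈-map⁺ (true Vec.∷_) (∈-bitVectors S))

module _ {n : ℕ} (I : Knapsack n) where
  open Knapsack I

  profitOf weightOf : (ℕ → Bool) → ℕ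
  profitOf S = ∑ n λ j → sel (S j) (entry profits j)
  weightOf S = ∑ n λ j → sel (S j) (entry weights j)

  OPT-upper : ∀ S → weightOf S ≤ capacity → profitOf S ≤ OPT I
  OPT-upper S light = subst (_≤ OPT I) (sumOver-indicator S profits)
    (All.lookup (xs≤max 0 candidates)
      (∈-map⁺ (λ S → sumOver S profits)
        (∈-filter⁺ (feasible? I) (∈-bitVectors (indicator n S)) (subst (_≤ capacity) (sym (sumOver-indicator S weights)) light))))
    where
    candidates = map (λ S → sumOver S profits) (filter (feasible? I) (bitVectors n))

  OPT-attained : ∃[ S ] (profitOf S ≡ OPT I × weightOf S ≤ capacity)
  OPT-attained with argmax-sel (λ x → x) 0 (map (λ S → sumOver S profits) (filter (feasible? I) (bitVectors n)))
  -- The maximum is the base value 0, which the empty set attains.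
  ... | inj₁ zero≡ = (λ _ → false) , trans (∑-zero n) (sym zero≡) , ≤-trans (≤-reflexive (∑-zero n)) z≤n
  ... | inj₂ found with ∈-map⁻ (λ S → sumOver S profits) found
  ...   | S , S∈ , eq = bit (toList S) , trans (sym (sumOver-∑ S profits)) (sym eq) ,
          subst (_≤ capacity) (sumOver-∑ S weights) (proj₂ (∈-filter⁻ (feasible? I) {xs = bitVectors n} S∈))

  w-at-encode : ∀ j → j < n → nth (encode I) (j + 2) ≡ entry weights j
  w-at-encode j j<n = trans (cong (nth (encode I)) (+-comm j 2)) (nth-++ˡ weights (toList profits) j j<n)

  p-at-encode : ∀ j → nth (encode I) (j + 2 + n) ≡ entry profits j
  p-at-encode j = trans (cong (nth (encode I)) (e j n)) (nth-++ʳ weights (toList profits) j)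
    where
    e : ∀ j n → j + 2 + n ≡ 2 + (n + j)
    e = solve-∀

  blank-encode : ∀ a → n + n + 2 ≤ a → nth (encode I) a ≡ 0
  blank-encode a le = subst (λ a → nth (encode I) a ≡ 0) (m+[n∸m]≡n le)
    (trans (cong (nth (encode I)) (e n (a ∸ (n + n + 2))))
      (trans (nth-++ʳ weights (toList profits) (n + (a ∸ (n + n + 2)))) (entry-beyond profits _ (m≤m+n n _))))
    where
    e : ∀ n d → n + n + 2 + d ≡ 2 + (n + (n + d))
    e = solve-∀

inputMemory-nth : ∀ wordLength xs i → WordRAM.inputMemory wordLength xs i ≡ WordRAM.truncate wordLength (nth xs i)
inputMemory-nth wl []       i       = sym (m<n⇒m%n≡m {{m^n≢0 2 wl}} (m^n>0 2 wl))
inputMemory-nth wl (x ∷ xs) zero    = refl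
inputMemory-nth wl (x ∷ xs) (suc i) = inputMemory-nth wl xs i

-- Probabilities as counts of coin tapes

length-filter-map : ∀ {A B : Set} {P : B → Set} (P? : Decidable P) (f : A → B) xs →
                    length (filter P? (map f xs)) ≡ length (filter (λ x → P? (f x)) xs)
length-filter-map P? f []       = refl
length-filter-map P? f (x ∷ xs) with does (P? (f x))
... | true  = cong suc (length-filter-map P? f xs)
... | false = length-filter-map P? f xs

-- `𝔼` and `bitVectors` branch on the first coin alike, so the counts compare by induction on the
-- tape. `g` is a Boolean condition sufficient for the event.
count-≥ : ∀ t {P : Vec Bool t → Set} (P? : Decidable P) (g : List Bool → Bool) →
          (∀ ω → g (toList ω) ≡ true → P ω) → 𝔼 t (ind ∘ g) ≤ length (filter P? (bitVectors t))
count-≥ zero    P? g sound with P? Vec.[]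
... | yes _ = sel≤ (g []) 1
... | no ¬P with g [] in eq
...   | true  = contradiction (sound Vec.[] eq) ¬P
...   | false = z≤n
count-≥ (suc t) P? g sound = begin
  𝔼 t (ind ∘ g ∘ (false ∷_)) + 𝔼 t (ind ∘ g ∘ (true ∷_))
    ≤⟨ +-mono-≤ (count-≥ t (P? ∘ (false Vec.∷_)) (g ∘ (false ∷_)) (λ ω → sound (false Vec.∷ ω)))
                (count-≥ t (P? ∘ (true Vec.∷_)) (g ∘ (true ∷_)) (λ ω → sound (true Vec.∷ ω))) ⟩
  length (filter (P? ∘ (false Vec.∷_)) (bitVectors t)) + length (filter (P? ∘ (true Vec.∷_)) (bitVectors t))
    ≡⟨ cong₂ _+_ (length-filter-map P? (false Vec.∷_) (bitVectors t)) (length-filter-map P? (true Vec.∷_) (bitVectors t)) ⟨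
  length (filter P? (map (false Vec.∷_) (bitVectors t))) + length (filter P? (map (true Vec.∷_) (bitVectors t)))
    ≡⟨ Listₚ.length-++ (filter P? (map (false Vec.∷_) (bitVectors t))) ⟨
  length (filter P? (map (false Vec.∷_) (bitVectors t)) ++ filter P? (map (true Vec.∷_) (bitVectors t)))
    ≡⟨ cong length (Listₚ.filter-++ P? (map (false Vec.∷_) (bitVectors t)) (map (true Vec.∷_) (bitVectors t))) ⟨
  length (filter P? (bitVectors (suc t))) ∎
  where open ≤-Reasoning

/-toℚᵘ : ∀ i n .{{_ : NonZero n}} → ℚ.toℚᵘ (i ℚ./ n) ℚᵘ.≃ (i ℚᵘ./ n)
/-toℚᵘ i (suc n) = ℚₚ.toℚᵘ-fromℚᵘ (ℚᵘ.mkℚᵘ i n)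

-- The hypothesis is the conclusion multiplied by `a * b`, with the subtracted term moved across;
-- for unnormalised rationals the order is cross multiplication.
complement-≤ : ∀ a b x .{{_ : NonZero a}} .{{_ : NonZero b}} → a * b ≤ a * x + b →
               (ℚ.1ℚ ℚ.- (ℤ⁺ 1 ℚ./ a)) ℚ.≤ (ℤ⁺ x ℚ./ b)
complement-≤ a@(suc a-1) b@(suc b-1) x le = ℚₚ.toℚᵘ-cancel-≤ (begin
  ℚ.toℚᵘ (ℚ.1ℚ ℚ.- (ℤ⁺ 1 ℚ./ a))               ≃⟨ ℚₚ.toℚᵘ-homo-+ ℚ.1ℚ (ℚ.- (ℤ⁺ 1 ℚ./ a)) ⟩
  ℚᵘ.1ℚᵘ ℚᵘ.+ ℚ.toℚᵘ (ℚ.- (ℤ⁺ 1 ℚ./ a))        ≃⟨ ℚᵘₚ.+-congʳ ℚᵘ.1ℚᵘ (ℚᵘₚ.≃-trans (ℚₚ.toℚᵘ-homo‿- (ℤ⁺ 1 ℚ./ a)) (ℚᵘₚ.-‿cong (/-toℚᵘ (ℤ⁺ 1) a))) ⟩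
  ℚᵘ.1ℚᵘ ℚᵘ.- (ℤ⁺ 1 ℚᵘ./ a)                     ≤⟨ ℚᵘ.*≤* cross ⟩
  ℤ⁺ x ℚᵘ./ b                                    ≃⟨ /-toℚᵘ (ℤ⁺ x) b ⟨
  ℚ.toℚᵘ (ℤ⁺ x ℚ./ b)                            ∎)
  where
  open ℚᵘₚ.≤-Reasoning
  e : ∀ a b → (ℤ⁺ 1 ℤ.* a ℤ.+ ℤ.-1ℤ ℤ.* ℤ⁺ 1) ℤ.* b ≡ a ℤ.* b ℤ.- b
  e = ℤSolver.solve-∀
  cross : (ℤ⁺ 1 ℤ.* ℤ⁺ a ℤ.+ ℤ.-1ℤ ℤ.* ℤ⁺ 1) ℤ.* ℤ⁺ b ℤ.≤ ℤ⁺ x ℤ.* (ℤ⁺ 1 ℤ.* ℤ⁺ a)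
  cross = ℤₚ.≤-trans (ℤₚ.≤-reflexive (e (ℤ⁺ a) (ℤ⁺ b)))
    (ℤₚ.≤-trans (ℤₚ.+-monoˡ-≤ (ℤ.- ℤ⁺ b) (ℤ.+≤+ le))
      (ℤₚ.≤-reflexive (trans (cong (ℤ._- ℤ⁺ b) (trans (ℤₚ.pos-+ (a * x) b) (cong (ℤ._+ ℤ⁺ b) (ℤₚ.pos-* a x)))) (e′ (ℤ⁺ a) (ℤ⁺ x) (ℤ⁺ b)))))
    where
    e′ : ∀ a x b → (a ℤ.* x ℤ.+ b) ℤ.- b ≡ x ℤ.* (ℤ⁺ 1 ℤ.* a)
    e′ = ℤSolver.solve-∀

-- Time and word length

halted-stays : ∀ wordLength s t → iterate (WordRAM.step wordLength) ([] ▸ s) t ≡ ([] ▸ s)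
halted-stays wl s zero    = refl
halted-stays wl s (suc t) = halted-stays wl s t

-- The number of steps depends on the coins, but a halted configuration is a fixed point of `step`,
-- so every run can be padded to the same `time`.
halting : ∀ wordLength {P Q : State → Set} prog t time → t ≤ time → Hoare.Triple wordLength P prog t Q →
          ∀ s → P s → ∃[ s′ ] (iterate (WordRAM.step wordLength) (prog ▸ s) time ≡ ([] ▸ s′) × Q s′)
halting wl prog t time t≤time triple s Ps with triple s Ps
... | u , s′ , u≤t , Qs′ , run = s′ , ends , Qs′
  where
  open ≡-Reasoning
  open WordRAM wl
  ends : iterate step (prog ▸ s) time ≡ ([] ▸ s′)
  ends = begin
    iterate step (prog ▸ s) time                            ≡⟨ cong (iterate step (prog ▸ s)) (m+[n∸m]≡n (≤-trans u≤t t≤time)) ⟨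
    iterate step (prog ▸ s) (u + (time ∸ u))                ≡⟨ iterate-+ step (prog ▸ s) u (time ∸ u) ⟩
    iterate step (iterate step (prog ▸ s) u) (time ∸ u)     ≡⟨ cong (λ q → iterate step (iterate step (q ▸ s) u) (time ∸ u)) (Listₚ.++-identityʳ prog) ⟨
    iterate step (iterate step (prog ++ [] ▸ s) u) (time ∸ u) ≡⟨ cong (λ q → iterate step q (time ∸ u)) (run []) ⟩
    iterate step ([] ▸ s′) (time ∸ u)                       ≡⟨ halted-stays wl s′ (time ∸ u) ⟩
    ([] ▸ s′)                                               ∎

suc≤2^ : ∀ x → suc x ≤ 2 ^ x
suc≤2^ zero    = ≤-refl
suc≤2^ (suc x) = begin
  suc (suc x)         ≤⟨ +-mono-≤ (m^n>0 2 x) (suc≤2^ x) ⟩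
  2 ^ x + 2 ^ x       ≡⟨ double (2 ^ x) ⟨
  2 ^ suc x           ∎
  where open ≤-Reasoning

<2^log₂ : ∀ x → x < 2 ^ suc ⌊log₂ x ⌋
<2^log₂ x = ≰⇒> λ le → <⇒≱ (n<1+n ⌊log₂ x ⌋) (≤-trans (≤-reflexive (sym (⌊log₂[2^n]⌋≡n (suc ⌊log₂ x ⌋)))) (⌊log₂⌋-mono-≤ le))

infix  4 _≲_·_
infixl 6 _⊕_
infixl 7 _⊗_

-- A record, so that the coefficient α and the unit Z can be inferred even
-- though 3 * Z computes to a sum.
record _≲_·_ (a α Z : ℕ) : Set where
  constructor ⟪_⟫
  field bound : a ≤ α * Z
open _≲_·_

_⊕_ : ∀ {a b α β Z} → a ≲ α · Z → b ≲ β · Z → a + b ≲ α + β · Z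
_⊕_ {α = α} {β} {Z} ⟪ a≤ ⟫ ⟪ b≤ ⟫ = ⟪ ≤-trans (+-mono-≤ a≤ b≤) (≤-reflexive (sym (*-distribʳ-+ Z α β))) ⟫

_⊗_ : ∀ {a b α β Y Z} → a ≲ α · Y → b ≲ β · Z → a * b ≲ α * β · (Y * Z)
_⊗_ {α = α} {β} {Y} {Z} ⟪ a≤ ⟫ ⟪ b≤ ⟫ = ⟪ ≤-trans (*-mono-≤ a≤ b≤) (≤-reflexive (e α β Y Z)) ⟫
  where
  e : ∀ α β Y Z → α * Y * (β * Z) ≡ α * β * (Y * Z)
  e = solve-∀

once : ∀ {a Z} → a ≤ Z → a ≲ 1 · Z
once {Z = Z} a≤ = ⟪ ≤-trans a≤ (≤-reflexive (sym (*-identityˡ Z))) ⟫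

itself : ∀ a → a ≲ 1 · a
itself a = once ≤-refl

const≤ : ∀ α {Z} → 0 < Z → α ≲ α · Z
const≤ α Z>0 = ⟪ m≤m*n α _ {{>-nonZero Z>0}} ⟫

times : ∀ k {a Z} → a ≤ Z → k * a ≲ k · Z
times k a≤ = ⟪ *-monoʳ-≤ k a≤ ⟫

times′ : ∀ {a Z} k → a ≤ Z → a * k ≲ k · Z
times′ {a} k a≤ = ⟪ ≤-trans (≤-reflexive (*-comm a k)) (*-monoʳ-≤ k a≤) ⟫

weaken≤ : ∀ {a α Y Z} → Y ≤ Z → a ≲ α · Y → a ≲ α · Z
weaken≤ {α = α} Y≤Z ⟪ a≤ ⟫ = ⟪ ≤-trans a≤ (*-monoʳ-≤ α Y≤Z) ⟫

below≲ : ∀ {a b α Z} → a ≤ b → b ≲ α · Z → a ≲ α · Z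
below≲ a≤b ⟪ b≤ ⟫ = ⟪ ≤-trans a≤b b≤ ⟫

widen : ∀ {x y} → 0 < y → x ≤ y * x
widen {x} {y} y>0 = m≤n*m x y {{>-nonZero y>0}}

widenʳ : ∀ {x y} → 0 < y → x ≤ x * y
widenʳ {x} {y} y>0 = m≤m*n x y {{>-nonZero y>0}}

module WordSize (c n pm L H : ℕ) (n⁺ : 0 < n) (n≤H : n ≤ H) (pm≤H : pm ≤ H) (2≤H : 2 ≤ H) (B²≤4n : 2 ^ L * 2 ^ L ≤ 4 * n) where

  -- Every number to be stored will be at most `15 * Z`. The 4 in `M` makes room for
  -- `B * B ≤ 4 * n`.
  B M k Z : ℕ
  B = 2 ^ L
  M = 4 * H
  k = 2 * suc c
  Z = k * (M * (M * M))

  H⁺ : 0 < H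
  H⁺ = <⇒≤ 2≤H

  M⁺ : 0 < M
  M⁺ = ≤-trans H⁺ (m≤n*m H 4)

  M³≤Z : M * (M * M) ≤ Z
  M³≤Z = widen {y = k} z<s

  M²≤Z : M * M ≤ Z
  M²≤Z = ≤-trans (widen M⁺) M³≤Z

  M≤Z : M ≤ Z
  M≤Z = ≤-trans (widen M⁺) M²≤Z

  Z⁺ : 0 < Z
  Z⁺ = ≤-trans M⁺ M≤Z

  H≤Z : H ≤ Z
  H≤Z = ≤-trans (m≤n*m H 4) M≤Z

  n≤M : n ≤ M
  n≤M = ≤-trans n≤H (m≤n*m H 4)

  pm≤M : pm ≤ M
  pm≤M = ≤-trans pm≤H (m≤n*m H 4)

  B²≤M : B * B ≤ M
  B²≤M = ≤-trans B²≤4n (*-monoʳ-≤ 4 n≤H)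

  B≤M : B ≤ M
  B≤M = ≤-trans (widen (m^n>0 2 L)) B²≤M

  L≤B : L ≤ B
  L≤B = <⇒≤ (suc≤2^ L)

  L≤M : L ≤ M
  L≤M = ≤-trans L≤B B≤M

  L²≤M : L * L ≤ M
  L²≤M = ≤-trans (*-mono-≤ L≤B L≤B) B²≤M

  U≤Z : n * pm ≤ Z
  U≤Z = ≤-trans (*-mono-≤ n≤M pm≤M) M²≤Z

  table≤ : n + n + 2 + 2 * suc c * L * n + suc (5 * (n * pm) + ((L * L + L * L) * B + 3) * pm) ≲ 15 · Z
  table≤ = once (≤-trans n≤M M≤Z) ⊕ once (≤-trans n≤M M≤Z) ⊕ once (≤-trans 2≤H H≤Z) ⊕ once kLn≤ ⊕
           (const≤ 1 Z⁺ ⊕ (times 5 U≤Z ⊕ Δ≤))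
    where
    kLn≤ : k * L * n ≤ Z
    kLn≤ = ≤-trans (*-mono-≤ (*-monoʳ-≤ k L≤M) n≤M) (≤-trans (≤-reflexive (*-assoc k M M)) (*-monoʳ-≤ k (widen M⁺)))
    e : ∀ s B p → (s * B + 3) * p ≡ s * (B * p) + 3 * p
    e = solve-∀
    Δ≤ : ((L * L + L * L) * B + 3) * pm ≲ 5 · Z
    Δ≤ = below≲ (≤-reflexive (e (L * L + L * L) B pm))
      (weaken≤ M³≤Z ((once L²≤M ⊕ once L²≤M) ⊗ once (*-mono-≤ B≤M pm≤M)) ⊕ times 3 (≤-trans pm≤M M≤Z))

  product≤ : B * (5 * (n * pm)) + 5 * (n * pm) ≲ 10 · Z
  product≤ = weaken≤ M³≤Z (once B≤M ⊗ times 5 (*-mono-≤ n≤M pm≤M)) ⊕ times 5 U≤Z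

  -- The source of the word factor `14 + c`: 16 · 4³ = 2^10 costs H^10, the three factors `H` of
  -- `M³` cost H^3, and `k = 2 (c + 1) ≤ 2^(c + 1)` costs H^(c + 1).
  Z≤power : 16 * Z ≤ H ^ (14 + c)
  Z≤power = begin
    16 * Z                                    ≡⟨ e k H ⟩
    2 ^ 10 * (H * (H * (H * k)))              ≤⟨ *-mono-≤ (^-monoˡ-≤ 10 2≤H) (*-monoʳ-≤ H (*-monoʳ-≤ H (*-monoʳ-≤ H k≤))) ⟩
    H ^ 10 * (H ^ (4 + c))                    ≡⟨ ^-distribˡ-+-* H 10 (4 + c) ⟨
    H ^ (14 + c)                              ∎
    where
    open ≤-Reasoning
    e : ∀ k H → 16 * (k * (4 * H * (4 * H * (4 * H)))) ≡ 1024 * (H * (H * (H * k)))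
    e = solve-∀
    k≤ : k ≤ H ^ suc c
    k≤ = ≤-trans (*-monoʳ-≤ 2 (suc≤2^ c)) (^-monoˡ-≤ (suc c) 2≤H)

  fits-word : ∀ {a α} → a ≲ α · Z → α ≤ 15 → a < H ^ (14 + c)
  fits-word {a} {α} ⟪ a≤ ⟫ α≤15 = begin-strict
    a              ≤⟨ a≤ ⟩
    α * Z          ≤⟨ *-monoˡ-≤ Z α≤15 ⟩
    15 * Z         <⟨ *-monoˡ-< Z {{>-nonZero Z⁺}} (n<1+n 15) ⟩
    16 * Z         ≤⟨ Z≤power ⟩
    H ^ (14 + c)   ∎
    where open ≤-Reasoning

module Cost (d n pm B L V : ℕ) (d⁺ : 0 < d) (n⁺ : 0 < n) (pm⁺ : 0 < pm) (B⁺ : 0 < B) (L≤V : L ≤ V) (V⁺ : 0 < V) where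

  U Δ cells R : ℕ
  U = n * pm
  Δ = ((L * L + L * L) * B + 3) * pm
  cells = suc (5 * U + Δ)
  R = 2 * d * L

  -- Units for the window of one item, one round, one guess and the whole run. The four factors `V`
  -- of the last: two for the `L * L` in `Δ`, one for the number of rows, one for the number of
  -- guesses.
  Y₂ Z₂ Z₃ Z : ℕ
  Y₂ = V * (V * (B * pm))
  Z₂ = n * Y₂
  Z₃ = d * V * Z₂
  Z = V * Z₃

  dV⁺ : 0 < d * V
  dV⁺ = *-mono-< d⁺ V⁺

  Bpm≤Y₂ : B * pm ≤ Y₂
  Bpm≤Y₂ = ≤-trans (widen V⁺) (widen V⁺)

  pm≤Y₂ : pm ≤ Y₂
  pm≤Y₂ = ≤-trans (widen B⁺) Bpm≤Y₂

  B≤Y₂ : B ≤ Y₂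
  B≤Y₂ = ≤-trans (widenʳ pm⁺) Bpm≤Y₂

  V≤Y₂ : V ≤ Y₂
  V≤Y₂ = widenʳ (*-mono-< V⁺ (*-mono-< B⁺ pm⁺))

  Y₂⁺ : 0 < Y₂
  Y₂⁺ = ≤-trans pm⁺ pm≤Y₂

  Y₂≤Z₂ : Y₂ ≤ Z₂
  Y₂≤Z₂ = widen n⁺

  Z₂⁺ : 0 < Z₂
  Z₂⁺ = ≤-trans Y₂⁺ Y₂≤Z₂

  Z₂≤Z₃ : Z₂ ≤ Z₃
  Z₂≤Z₃ = widen dV⁺

  Z₃⁺ : 0 < Z₃
  Z₃⁺ = ≤-trans Z₂⁺ Z₂≤Z₃

  Z₃≤Z : Z₃ ≤ Z
  Z₃≤Z = widen V⁺

  Z⁺ : 0 < Z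
  Z⁺ = ≤-trans Z₃⁺ Z₃≤Z

  Z₂≤Z : Z₂ ≤ Z
  Z₂≤Z = ≤-trans Z₂≤Z₃ Z₃≤Z

  R≤ : R ≲ 2 · (d * V)
  R≤ = ⟪ ≤-trans (*-monoʳ-≤ (2 * d) L≤V) (≤-reflexive (*-assoc 2 d V)) ⟫

  Δ≤ : Δ ≲ 5 · Y₂
  Δ≤ = below≲ (≤-reflexive (e L B pm)) (times 2 (*-mono-≤ L≤V (*-monoˡ-≤ (B * pm) L≤V)) ⊕ times 3 pm≤Y₂)
    where
    e : ∀ L B p → ((L * L + L * L) * B + 3) * p ≡ 2 * (L * (L * (B * p))) + 3 * p
    e = solve-∀

  cells≤ : cells ≲ 11 · Z₂
  cells≤ = const≤ 1 Z₂⁺ ⊕ (times 5 (*-monoʳ-≤ n pm≤Y₂) ⊕ weaken≤ Y₂≤Z₂ Δ≤)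

  span≤ : 5 * B * pm + (Δ + Δ) + 1 ≲ 16 · Y₂
  span≤ = below≲ (≤-reflexive (*-assoc 5 B pm)) (times 5 Bpm≤Y₂) ⊕ (Δ≤ ⊕ Δ≤) ⊕ const≤ 1 Y₂⁺

  round-cost≤ : round-cost n pm B Δ cells ≲ 308 · Z₂
  round-cost≤ = scan-buckets ⊕ relaxations ⊕ tables ⊕ const≤ 7 Z₂⁺
    where
    scan-buckets : B * (11 + n * 20) ≲ 31 · Z₂
    scan-buckets = weaken≤ (≤-trans (≤-reflexive (*-comm B n)) (*-monoʳ-≤ n B≤Y₂)) (itself B ⊗ (const≤ 11 n⁺ ⊕ times′ 20 ≤-refl))
    scaled : ∀ k {a α Z} → a ≲ α · Z → k * a ≲ k * α · Z
    scaled k {α = α} {Z} ⟪ a≤ ⟫ = ⟪ ≤-trans (*-monoʳ-≤ k a≤) (≤-reflexive (sym (*-assoc k α Z))) ⟫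
    relaxations : n * (10 * (5 * B * pm + (Δ + Δ) + 1)) ≲ 160 · Z₂
    relaxations = itself n ⊗ scaled 10 span≤
    tables : 10 * cells ≲ 110 · Z₂
    tables = scaled 10 cells≤

  search-cost≤ : search-cost R n pm B Δ cells ≲ 631 · Z₃
  search-cost≤ = const≤ 6 Z₃⁺ ⊕ (R≤ ⊗ (const≤ 1 Z₂⁺ ⊕ round-cost≤) ⊕ const≤ 1 Z₃⁺ ⊕ const≤ 6 Z₃⁺)

  rows : ℕ
  rows = d * V * (V * n)

  rows≤Z : rows ≤ Z
  rows≤Z = ≤-trans (*-monoʳ-≤ (d * V) (≤-trans (≤-reflexive (*-comm V n)) (*-monoʳ-≤ n V≤Y₂))) Z₃≤Z

  Vn⁺ : 0 < V * n
  Vn⁺ = *-mono-< V⁺ n⁺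

  row-cost≤ : suc (row-cost n L) ≲ 18 · (V * n)
  row-cost≤ = const≤ 2 Vn⁺ ⊕ (once L≤V ⊗ level ⊕ const≤ 1 Vn⁺ ⊕ const≤ 2 Vn⁺)
    where
    level : suc (1 + (n * 9 + 1 + 1)) ≲ 13 · n
    level = const≤ 2 n⁺ ⊕ (times′ 9 ≤-refl ⊕ const≤ 1 n⁺ ⊕ const≤ 1 n⁺)

  preparation-cost≤ : preparation-cost R n L ≲ 78 · Z
  preparation-cost≤ =
    const≤ 7 Z⁺ ⊕ (times′ 7 n≤Z ⊕ const≤ 1 Z⁺ ⊕
      (const≤ 2 Z⁺ ⊕ (times′ 4 L≤Z ⊕ const≤ 1 Z⁺ ⊕
        (const≤ 19 Z⁺ ⊕ (weaken≤ rows≤Z (R≤ ⊗ row-cost≤) ⊕ const≤ 1 Z⁺)))))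
    where
    n≤Z : n ≤ Z
    n≤Z = ≤-trans (widenʳ Y₂⁺) Z₂≤Z
    L≤Z : L ≤ Z
    L≤Z = ≤-trans L≤V (≤-trans V≤Y₂ (≤-trans Y₂≤Z₂ Z₂≤Z))

  -- 711 is 78 for the preparation, 1 + 631 per guess including the loop test, and 1 for the final
  -- test.
  total≤ : solver-cost R n pm B L Δ cells V ≲ 711 · Z
  total≤ = (preparation-cost≤ ⊕ (itself V ⊗ (const≤ 1 Z₃⁺ ⊕ search-cost≤) ⊕ const≤ 1 Z⁺))

  tape≤ : R * (L * n) ≲ 2 · Z
  tape≤ = weaken≤ rows≤Z (R≤ ⊗ once (*-monoˡ-≤ n L≤V))

  -- `Z` has one factor `n` and one factor `B`, whose squares give `n² * B² ≤ 4 * n³`: the origin of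
  -- n^(3/2) and of the extra 2 in the constant.
  square≤ : ∀ q → B * B ≤ 4 * n → (q * Z) ^ 2 ≤ n ^ 3 * (2 * q * d * pm * V ^ 4) ^ 2
  square≤ q B²≤4n = begin
    (q * Z) ^ 2                              ≡⟨ e₁ q d n B pm V ⟩
    B * B * rest                             ≤⟨ *-monoˡ-≤ rest B²≤4n ⟩
    4 * n * rest                             ≡⟨ e₂ q d n pm V ⟩
    n ^ 3 * (2 * q * d * pm * V ^ 4) ^ 2     ∎
    where
    open ≤-Reasoning
    s rest : ℕ
    s = q * d * pm * (V * V * (V * V))
    rest = n * n * (s * s)
    e₁ : ∀ q d n B p V → q * (V * (d * V * (n * (V * (V * (B * p)))))) * (q * (V * (d * V * (n * (V * (V * (B * p)))))) * 1) ≡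
         B * B * (n * n * (q * d * p * (V * V * (V * V)) * (q * d * p * (V * V * (V * V)))))
    e₁ = solve-∀
    e₂ : ∀ q d n p V → 4 * n * (n * n * (q * d * p * (V * V * (V * V)) * (q * d * p * (V * V * (V * V))))) ≡
         n * (n * (n * 1)) * (2 * q * d * p * (V * (V * (V * (V * 1)))) * (2 * q * d * p * (V * (V * (V * (V * 1)))) * 1))
    e₂ = solve-∀

-- Assembly for a single instance

module Analysis
  (c n : ℕ) (n⁺ : 0 < n) (I : Knapsack n) (L : ℕ) (log : Log₄ L n) (wordLength K V time : ℕ) (K+1 : suc K ≡ 2 ^ wordLength)
  (table≤ : n + n + 2 + 2 * suc c * L * n + suc (5 * (n * p-max I) + ((L * L + L * L) * 2 ^ L + 3) * p-max I) ≤ K)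
  (product≤ : 2 ^ L * (5 * (n * p-max I)) + 5 * (n * p-max I) ≤ K)
  (n≤K : n ≤ K) (capacity<K : Knapsack.capacity I < K) (w-max≤K : w-max I ≤ K) (p-max≤K : p-max I ≤ K)
  (total<2^V : n * p-max I < 2 ^ V)
  (cost≤ : solver-cost (2 * suc c * L) n (p-max I) (2 ^ L) L (((L * L + L * L) * 2 ^ L + 3) * p-max I)
             (suc (5 * (n * p-max I) + ((L * L + L * L) * 2 ^ L + 3) * p-max I)) V ≤ time)
  (tape≤ : 2 * suc c * L * (L * n) ≤ time)
  where

  open Knapsack I
  open WordRAM wordLength

  w p : ℕ → ℕ
  w = entry weights
  p = entry profits

  pm B R : ℕ
  pm = p-max I
  B = 2 ^ L
  R = 2 * suc c * L

  p⁺ : ∀ j → j < n → 0 < p j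
  p⁺ = entry⁺ profits⁺

  p≤pm : ∀ j → j < n → p j ≤ pm
  p≤pm = entry≤max profits

  pm⁺ : 0 < pm
  pm⁺ = <-≤-trans (p⁺ 0 n⁺) (p≤pm 0 n⁺)

  memory₀ : Store
  memory₀ = inputMemory (encode I)

  stored : ∀ {i x} → nth (encode I) i ≡ x → x ≤ K → memory₀ i ≡ x
  stored {i} {x} nth≡ x≤K = trans (inputMemory-nth wordLength (encode I) i)
    (trans (cong truncate nth≡) (Hoare.truncate-small wordLength (subst (x <_) K+1 (s≤s x≤K))))

  S* : ℕ → Bool
  S* = proj₁ (OPT-attained I)

  S*-profit : profitOf I S* ≡ OPT I
  S*-profit = proj₁ (proj₂ (OPT-attained I))

  S*-light : weightOf I S* ≤ capacity
  S*-light = proj₂ (proj₂ (OPT-attained I))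

  open Search n w p capacity p⁺ pm p≤pm pm⁺ L (log₄-positive n⁺ log) (<⇒≤ (log₄-upper log)) R using (failures; failures-rare; Δ; cells)

  failed : List Bool → ℕ
  failed = failures (OPT I) S* S*-profit S*-light (OPT-upper I)

  start : List Bool → State
  start = state (λ _ → 0) memory₀

  Started Finished : List Bool → State → Set
  Started zs s = (∀ x → regs s x ≡ 0) × mem s ≡ memory₀ × coins s ≡ zs
  Finished zs s = regs s %best ≤ OPT I × (failed zs ≡ 0 → regs s %best ≡ OPT I)

  solver-triple : ∀ zs → Hoare.Triple wordLength (Started zs) (solver c) (solver-cost R n pm B L Δ cells V) (Finished zs)
  solver-triple zs = Preparation.solver-run c n w p capacity p⁺ pm p≤pm pm⁺ (max-least profits) n⁺ L log wordLength K
    (≤-reflexive K+1) table≤ product≤ capacity<K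
    memory₀ (stored {0} refl n≤K) (stored {1} refl (<⇒≤ capacity<K))
    (λ j j<n → stored {j + 2} (w-at-encode I j j<n) (≤-trans (entry≤max weights j j<n) w-max≤K))
    (λ j j<n → stored {j + 2 + n} (p-at-encode I j) (≤-trans (p≤pm j j<n) p-max≤K))
    (λ a a≥ → stored {a} (blank-encode I a a≥) z≤n) zs
    (OPT I) S* S*-profit S*-light (OPT-upper I) V total<2^V

  final : ∀ zs → ∃[ s ] (iterate step (solver c ▸ start zs) time ≡ ([] ▸ s) × Finished zs s)
  final zs = halting wordLength {Started zs} {Finished zs} (solver c) (solver-cost R n pm B L Δ cells V) time cost≤
    (solver-triple zs) (start zs) ((λ _ → refl) , refl , refl)

  outcome : Vec Bool time → Config
  outcome ω = iterate step (initial (solver c) (encode I) (toList ω)) time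

  halts : ∀ ω → Halted (outcome ω)
  halts ω = cong Config.control (proj₁ (proj₂ (final (toList ω))))

  correct : ∀ ω → (failed (toList ω) ≡ᵇ 0) ≡ true → output (outcome ω) ≡ OPT I
  correct ω good = conclude (final (toList ω))
    where
    conclude : ∃[ s ] (outcome ω ≡ ([] ▸ s) × Finished (toList ω) s) → output (outcome ω) ≡ OPT I
    conclude (s , ends , _ , solved) = trans (cong output ends) (solved (≡ᵇ-true⁻¹ {failed (toList ω)} {0} good))

  -- The reason for `R = 2 (c + 1) L`: `2 ^ R` is `(B * B) ^ (c + 1)` with `B * B > n`, which pays
  -- for `n ^ c` and for the union over `n + 1` truncations.
  powers≤ : suc n * n ^ c ≤ 2 ^ R
  powers≤ = begin
    suc n * n ^ c                 ≤⟨ *-monoʳ-≤ (suc n) (^-monoˡ-≤ c (n≤1+n n)) ⟩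
    suc n ^ suc c                 ≤⟨ ^-monoˡ-≤ (suc c) (log₄-upper log) ⟩
    (B * B) ^ suc c               ≡⟨ cong (_^ suc c) (^-distribˡ-+-* 2 L L) ⟨
    (2 ^ (L + L)) ^ suc c         ≡⟨ ^-*-assoc 2 (L + L) (suc c) ⟩
    2 ^ ((L + L) * suc c)         ≡⟨ cong (2 ^_) (e L c) ⟩
    2 ^ R                         ∎
    where
    open ≤-Reasoning
    e : ∀ L c → (L + L) * (1 + c) ≡ 2 * (1 + c) * L
    e = solve-∀

  failure-rare : n ^ c * 𝔼 time failed ≤ 2 ^ time
  failure-rare = *-cancelˡ-≤ (suc n) (begin
    suc n * (n ^ c * 𝔼 time failed)   ≡⟨ *-assoc (suc n) (n ^ c) _ ⟨
    suc n * n ^ c * 𝔼 time failed     ≤⟨ *-monoˡ-≤ (𝔼 time failed) powers≤ ⟩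
    2 ^ R * 𝔼 time failed             ≤⟨ subst (λ t → 2 ^ R * 𝔼 t failed ≤ suc n * 2 ^ t) (m+[n∸m]≡n tape≤)
                                           (failures-rare (OPT I) S* S*-profit S*-light (OPT-upper I) (time ∸ R * (L * n))) ⟩
    suc n * 2 ^ time                  ∎)
    where open ≤-Reasoning

  successes : ℕ
  successes = length (filter (λ ω → output (outcome ω) ≟ OPT I) (bitVectors time))

  -- On each tape 1 is at most the indicator of no failure plus the number of failures; summing over
  -- all tapes gives the complement bound without subtraction.
  counting : n ^ c * 2 ^ time ≤ n ^ c * successes + 2 ^ time
  counting = begin
    n ^ c * 2 ^ time
      ≡⟨ cong (n ^ c *_) (trans (𝔼-const time 1) (*-identityʳ (2 ^ time))) ⟨
    n ^ c * 𝔼 time (λ _ → 1)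
      ≤⟨ *-monoʳ-≤ (n ^ c) (𝔼-mono time λ zs → good-or-failed (failed zs)) ⟩
    n ^ c * 𝔼 time (λ zs → ind (failed zs ≡ᵇ 0) + failed zs)
      ≡⟨ cong (n ^ c *_) (𝔼-+ time (λ zs → ind (failed zs ≡ᵇ 0)) failed) ⟩
    n ^ c * (𝔼 time (λ zs → ind (failed zs ≡ᵇ 0)) + 𝔼 time failed)
      ≡⟨ *-distribˡ-+ (n ^ c) _ (𝔼 time failed) ⟩
    n ^ c * 𝔼 time (λ zs → ind (failed zs ≡ᵇ 0)) + n ^ c * 𝔼 time failed
      ≤⟨ +-mono-≤ (*-monoʳ-≤ (n ^ c) (count-≥ time (λ ω → output (outcome ω) ≟ OPT I) (λ zs → failed zs ≡ᵇ 0) correct)) failure-rare ⟩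
    n ^ c * successes + 2 ^ time ∎
    where
    open ≤-Reasoning
    good-or-failed : ∀ x → 1 ≤ ind (x ≡ᵇ 0) + x
    good-or-failed zero    = ≤-refl
    good-or-failed (suc x) = s≤s z≤n

  probability : .{{_ : NonZero n}} → (1-1/ n ^ c) ℚ.≤ Pr (λ ω → output (outcome ω) ≟ OPT I)
  probability = complement-≤ (n ^ c) (2 ^ time) successes {{m^n≢0 n c}} {{m^n≢0 2 time}} counting

algorithm : ℕ → Algorithm
algorithm c = record { program = solver c ; wordFactor = 14 + c }

^-*-swap : ∀ m a b → (m ^ a) ^ b ≡ m ^ (b * a)
^-*-swap m a b = trans (^-*-assoc m a b) (cong (m ^_) (*-comm a b))

module Instance (c n : ℕ) (n⁺ : 0 < n) (I : Knapsack n) where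
  open Knapsack I

  -- `V` is the bit length of `n * pm`: the base of the polylogarithmic factor and at the same time
  -- a bound on the number of guesses.
  pm L B V wordLength K H : ℕ
  pm = p-max I
  L = proj₁ (log₄ n n ≤-refl)
  B = 2 ^ L
  V = suc ⌊log₂ (n * pm) ⌋
  wordLength = (14 + c) * inputBits I
  K = 2 ^ wordLength ∸ 1
  H = 2 ^ inputBits I

  log : Log₄ L n
  log = proj₂ (log₄ n n ≤-refl)

  pm⁺ : 0 < pm
  pm⁺ = <-≤-trans (entry⁺ profits⁺ 0 n⁺) (entry≤max profits 0 n⁺)

  B²≤4n : B * B ≤ 4 * n
  B²≤4n = log₄-lower n⁺ log

  n<H : n < H
  n<H = ≤-<-trans (≤-trans (m≤m⊔n n capacity) (≤-trans (m≤m⊔n _ (w-max I)) (m≤m⊔n _ pm))) (<2^log₂ _)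

  capacity<H : capacity < H
  capacity<H = ≤-<-trans (≤-trans (m≤n⊔m n capacity) (≤-trans (m≤m⊔n _ (w-max I)) (m≤m⊔n _ pm))) (<2^log₂ _)

  w-max<H : w-max I < H
  w-max<H = ≤-<-trans (≤-trans (m≤n⊔m (n ⊔ capacity) (w-max I)) (m≤m⊔n _ pm)) (<2^log₂ _)

  pm<H : pm < H
  pm<H = ≤-<-trans (m≤n⊔m (n ⊔ capacity ⊔ w-max I) pm) (<2^log₂ _)

  open WordSize c n pm L H n⁺ (<⇒≤ n<H) (<⇒≤ pm<H) (≤-<-trans n⁺ n<H) B²≤4n using (Z; table≤; product≤; fits-word; H≤Z)

  K+1 : suc K ≡ 2 ^ wordLength
  K+1 = m+[n∸m]≡n (m^n>0 2 wordLength)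

  H-power : H ^ (14 + c) ≡ 2 ^ wordLength
  H-power = ^-*-swap 2 (inputBits I) (14 + c)

  word≤K : ∀ {a α} → a ≲ α · Z → α ≤ 15 → a ≤ K
  word≤K {a} a≤ α≤15 = s≤s⁻¹ (subst (a <_) (trans H-power (sym K+1)) (fits-word a≤ α≤15))

  input≤K : ∀ {a} → a ≤ H → a ≤ K
  input≤K a≤H = word≤K (once (≤-trans a≤H H≤Z)) (s≤s z≤n)

  -- From `4^L ≤ 4 n ≤ (2 n)²` follows `2^L ≤ 2 n`, so `L` is at most one more than the logarithm of
  -- `n`, and `pm ≥ 1` gives the rest.
  L≤V : L ≤ V
  L≤V = begin
    L                          ≡⟨ ⌊log₂[2^n]⌋≡n L ⟨
    ⌊log₂ 2 ^ L ⌋              ≤⟨ ⌊log₂⌋-mono-≤ (square-cancel {B} {2 * n} (≤-trans B²≤4n 4n≤)) ⟩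
    ⌊log₂ (2 * n) ⌋            ≡⟨ ⌊log₂[2*b]⌋≡1+⌊log₂b⌋ n {{>-nonZero n⁺}} ⟩
    suc ⌊log₂ n ⌋              ≤⟨ s≤s (⌊log₂⌋-mono-≤ (widenʳ {n} pm⁺)) ⟩
    V                          ∎
    where
    open ≤-Reasoning
    e : ∀ n → 4 * n * n ≡ 2 * n * (2 * n)
    e = solve-∀
    4n≤ : 4 * n ≤ 2 * n * (2 * n)
    4n≤ = ≤-trans (widenʳ n⁺) (≤-reflexive (e n))

  open Cost (suc c) n pm B L V z<s n⁺ pm⁺ (m^n>0 2 L) L≤V z<s using (total≤; tape≤; square≤) renaming (Z to unit)

  time : ℕ
  time = 711 * unit

  time≤ : time ≤ n ^3/2· (2 * 711 * suc c * pm * polylog 4 (n * pm))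
  time≤ = square≤ 711 B²≤4n

  open Analysis c n n⁺ I L log wordLength K V time K+1 (word≤K table≤ ≤-refl) (word≤K product≤ (m≤m+n 10 5))
    (input≤K (<⇒≤ n<H)) (input≤K capacity<H) (input≤K (<⇒≤ w-max<H)) (input≤K (<⇒≤ pm<H)) (<2^log₂ (n * pm))
    (bound total≤) (≤-trans (bound tape≤) (*-monoˡ-≤ unit {2} {711} (s≤s (s≤s z≤n)))) public using (halts; probability)

theorem2 : ∀ (c : ℕ) →
    ∃[ A ] ∃[ C ] ∃[ k ]
    (∀ (n : ℕ) .{{_ : NonZero n}} (I : Knapsack n) →
    ∃[ t ] (t ≤ n ^3/2· (C * p-max I * polylog k (n * p-max I)))
    × HaltsWithin A I t
    × (1-1/ n ^ c) ℚ.≤ PrCorrect A I t)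
theorem2 c = algorithm c , 2 * 711 * suc c , 4 , λ n I →
  let open Instance c n (>-nonZero⁻¹ n) I in time , time≤ , halts , probability
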